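{- Let $H$ be a realizable 3-uniform hypergraph. Then the number $|\mathscr{R}(H)|$ of realizations of $H$ is $$|\mathscr{R}(H)|=2^{|\mathscr{D}_\triangle(H)|}\times\prod_{X\in\mathscr{D}_\circ(H)}|\Pi(H[X])|!\,.$$
   Context: All structures are finite. A 3-uniform hypergraph $H$ consists of a vertex set $V(H)$ and an edge set $E(H)\subseteq\binom{V(H)}{3}$; it is empty if $E(H)=\emptyset$. For $W\subseteq V(H)$, $H[W]$ is the hypergraph with vertex set $W$ and edge set $\{e\in E(H):e\subseteq W\}$. A 3-cycle is a tournament on three vertices isomorphic to $(\{0,1,2\},\{01,12,20\})$. The $C_3$-structure $C_3(T)$ of a tournament $T$ is the 3-uniform hypergraph on $V(T)$ whose edges are the 3-element subsets $X$ of $V(T)$ such that $T[X]$ is a 3-cycle. A tournament $T$ with $V(T)=V(H)$ is a realization of $H$ if $H=C_3(T)$; $\mathscr{R}(H)$ is the set of realizations of $H$, and $H$ is realizable if $\mathscr{R}(H)\neq\emptyset$. A subset $M$ of $V(H)$ is a module of $H$ if for each $e\in E(H)$ such that $e\cap M\neq\emptyset$ and $e\setminus M\neq\emptyset$, there exists $m\in M$ such that $e\cap M=\{m\}$ and for every $n\in M$, $(e\setminus\{m\})\cup\{n\}\in E(H)$. The sets $\emptyset$, $V(H)$ and $\{v\}$ ($v\in V(H)$) are modules, called trivial. $H$ is prime if $|V(H)|\geq 3$ and all its modules are trivial. A module $M$ of $H$ is strong if for every module $N$ of $H$ with $M\cap N\neq\emptyset$, we have $M\subseteq N$ or $N\subseteq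 M$. When $|V(H)|\geq 2$, $\Pi(H)$ denotes the set of the strong modules of $H$ distinct from $V(H)$ that are maximal under inclusion among those; it is a partition of $V(H)$. For a partition $P$ of $V(H)$ into modules of $H$, the quotient $H/P$ is the hypergraph with vertex set $P$ such that $\mathcal{E}\subseteq P$ is an edge of $H/P$ iff $|\mathcal{E}|\geq 2$ and there exists $e\in E(H)$ with $\mathcal{E}=\{X\in P:X\cap e\neq\emptyset\}$. $\mathscr{D}_{\geq 2}(H)$ is the set of strong modules $X$ of $H$ with $|X|\geq 2$. $\mathscr{D}_\triangle(H)$ is the set of $X\in\mathscr{D}_{\geq 2}(H)$ such that $H[X]/\Pi(H[X])$ is prime, and $\mathscr{D}_\circ(H)$ is the set of $X\in\mathscr{D}_{\geq 2}(H)$ such that $H[X]/\Pi(H[X])$ is empty. -}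

module Defs where

open import Data.Bool.Base using (true; false)
open import Data.Bool.Properties using () renaming (_≟_ to _≟ᵇ_)
open import Data.Fin.Base using (Fin; zero; suc)
open import Data.Fin.Properties using (any?; all?) renaming (_≟_ to _≟ᶠ_)
open import Data.Fin.Subset
open import Data.Fin.Subset.Properties
  using (_∈?_; _⊆?_; nonempty?; anySubset?; ∈⊤)
open import Data.List.Base as List
  using (List; []; _∷_; length; filter; cartesianProductWith)
open import Data.List.Membership.Propositional using () renaming (_∈_ to _∈ˡ_)
open import Data.List.Membership.Propositional.Properties
  using (∈-cartesianProductWith⁺)
open import Data.List.Relation.Unary.All using ([]; _∷_)
open import Data.List.Relation.Unary.AllPairs using ([]; _∷_)
open import Data.List.Relation.Unary.Any using (here; there)
open import Data.List.Relation.Unary.Unique.Propositional using (Unique)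
open import Data.List.Relation.Unary.Unique.Propositional.Properties
  using (cartesianProductWith⁺)
open import Data.Nat.Base using (ℕ; zero; suc; _≥_)
open import Data.Nat.Properties using (_≥?_) renaming (_≟_ to _≟ⁿ_)
open import Data.Product.Base using (∃-syntax; _×_; _,_; proj₁; proj₂)
open import Data.Sum.Base using (_⊎_)
open import Data.Vec.Base using (Vec; []; _∷_; lookup; tabulate)
open import Data.Vec.Properties using (∷-injective; ≡-dec)
open import Function.Base using (_∘_)
open import Level using (0ℓ)
open import Relation.Binary.PropositionalEquality using (_≡_; _≢_; refl)
open import Relation.Nullary.Decidable
  using (Dec; yes; no; does; map′; ¬?; _×-dec_; _⊎-dec_; _→-dec_; decidable-stable)
open import Relation.Nullary.Negation using (¬_)
open import Relation.Unary using (Pred; Decidable; _≐_)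

private
  variable
    m n : ℕ
    A : Set

-- `vecs xs n` lists the vectors of length n with entries in xs; it is
-- complete and free of repetitions whenever xs is, so that the length of
-- `filter P? (vecs xs n)` is the number of vectors satisfying P.

vecs : List A → ∀ n → List (Vec A n)
vecs xs zero    = [] ∷ []
vecs xs (suc n) = cartesianProductWith _∷_ xs (vecs xs n)

vecs-complete : {xs : List A} → (∀ x → x ∈ˡ xs) → (v : Vec A n) → v ∈ˡ vecs xs n
vecs-complete all []      = here refl
vecs-complete all (x ∷ v) = ∈-cartesianProductWith⁺ _∷_ (all x) (vecs-complete all v)

vecs-unique : {xs : List A} → Unique xs → ∀ n → Unique (vecs xs n)
vecs-unique uniq zero    = [] ∷ []
vecs-unique uniq (suc n) = cartesianProductWith⁺ _∷_ ∷-injective uniq (vecs-unique uniq n)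

subsets : ∀ n → List (Subset n)
subsets = vecs (inside ∷ outside ∷ [])

subsets-complete : (p : Subset n) → p ∈ˡ subsets n
subsets-complete = vecs-complete λ where
  true  → here refl
  false → there (here refl)

subsets-unique : ∀ n → Unique (subsets n)
subsets-unique = vecs-unique (((λ ()) ∷ []) ∷ ([] ∷ []))

_≟ˢ_ : (p q : Subset n) → Dec (p ≡ q)
_≟ˢ_ = ≡-dec _≟ᵇ_

allSubset? : {P : Pred (Subset n) 0ℓ} → Decidable P → Dec (∀ p → P p)
allSubset? P? = map′
  (λ ¬∃¬ p → decidable-stable (P? p) (λ ¬Pp → ¬∃¬ (p , ¬Pp)))
  (λ ∀P (p , ¬Pp) → ¬Pp (∀P p))
  (¬? (anySubset? (¬? ∘ P?)))

-- The vertex set is an arbitrary subset of an ambient Fin n, so that H [ W ]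
-- needs no relabelling of vertices.

record Hypergraph (n : ℕ) : Set₁ where
  field
    V   : Subset n
    E   : Pred (Subset n) 0ℓ
    E?  : Decidable E
    E⊆V : ∀ {e} → E e → e ⊆ V

open Hypergraph public

IsUniform : ℕ → Hypergraph n → Set
IsUniform k H = ∀ {e} → E H e → ∣ e ∣ ≡ k

infix 4 _≋_

_≋_ : Hypergraph n → Hypergraph n → Set
H ≋ K = V H ≡ V K × E H ≐ E K

IsEmpty : Hypergraph n → Set
IsEmpty H = ∀ e → ¬ E H e

-- Only meant for W ⊆ V H.
infixl 9 _[_]

_[_] : Hypergraph n → Subset n → Hypergraph n
H [ W ] = record
  { V   = W
  ; E   = λ e → E H e × e ⊆ W
  ; E?  = λ e → E? H e ×-dec e ⊆? W
  ; E⊆V = proj₂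
  }

-- A set of arcs on Fin n, given by the out-neighbourhood of each vertex.
Arcs : ℕ → Set
Arcs n = Vec (Subset n) n

arcSets : ∀ n → List (Arcs n)
arcSets n = vecs (subsets n) n

arcSets-complete : (T : Arcs n) → T ∈ˡ arcSets n
arcSets-complete = vecs-complete subsets-complete

arcSets-unique : ∀ n → Unique (arcSets n)
arcSets-unique n = vecs-unique (subsets-unique n) n

infix 4 _⊢_⟶_ _⊢_⟶?_

_⊢_⟶_ : Arcs n → Fin n → Fin n → Set
T ⊢ u ⟶ v = v ∈ lookup T u

_⊢_⟶?_ : (T : Arcs n) (u v : Fin n) → Dec (T ⊢ u ⟶ v)
T ⊢ u ⟶? v = v ∈? lookup T u

record IsTournament (V : Subset n) (T : Arcs n) : Set where
  field
    arcs⊆V×V    : ∀ u v → T ⊢ u ⟶ v → u ∈ V × v ∈ V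
    irreflexive : ∀ u → ¬ T ⊢ u ⟶ u
    exactlyOne  : ∀ u v → u ∈ V → v ∈ V → u ≢ v →
                  (T ⊢ u ⟶ v × ¬ T ⊢ v ⟶ u) ⊎ (T ⊢ v ⟶ u × ¬ T ⊢ u ⟶ v)

isTournament? : (V : Subset n) (T : Arcs n) → Dec (IsTournament V T)
isTournament? V T = map′
  (λ (a , i , e) → record { arcs⊆V×V = a ; irreflexive = i ; exactlyOne = e })
  (λ t → let open IsTournament t in arcs⊆V×V , irreflexive , exactlyOne)
  (    all? (λ u → all? λ v → T ⊢ u ⟶? v →-dec (u ∈? V ×-dec v ∈? V))
  ×-dec all? (λ u → ¬? (T ⊢ u ⟶? u))
  ×-dec all? (λ u → all? λ v → u ∈? V →-dec v ∈? V →-dec ¬? (u ≟ᶠ v) →-dec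
         (    (T ⊢ u ⟶? v ×-dec ¬? (T ⊢ v ⟶? u))
         ⊎-dec (T ⊢ v ⟶? u ×-dec ¬? (T ⊢ u ⟶? v)))))

-- The tournament ({0,1,2}, {01,12,20}).
cycle₃ : Arcs 3
cycle₃ = ⁅ suc zero ⁆ ∷ ⁅ suc (suc zero) ⁆ ∷ ⁅ zero ⁆ ∷ []

-- f, as the map i ↦ lookup f i, is an isomorphism from the digraph
-- (Fin m, S) onto the subdigraph of T induced on X.
record IsIsomorphism (S : Arcs m) (T : Arcs n) (X : Subset n) (f : Vec (Fin n) m) : Set where
  field
    into       : ∀ i → lookup f i ∈ X
    injective  : ∀ i j → lookup f i ≡ lookup f j → i ≡ j
    surjective : ∀ v → v ∈ X → ∃[ i ] lookup f i ≡ v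
    preserves  : ∀ i j → S ⊢ i ⟶ j → T ⊢ lookup f i ⟶ lookup f j
    reflects   : ∀ i j → T ⊢ lookup f i ⟶ lookup f j → S ⊢ i ⟶ j

isIsomorphism? : (S : Arcs m) (T : Arcs n) (X : Subset n) → Decidable (IsIsomorphism S T X)
isIsomorphism? S T X f = map′
  (λ (a , b , c , d , e) → record
    { into = a ; injective = b ; surjective = c ; preserves = d ; reflects = e })
  (λ t → let open IsIsomorphism t in into , injective , surjective , preserves , reflects)
  (    all? (λ i → lookup f i ∈? X)
  ×-dec all? (λ i → all? λ j → lookup f i ≟ᶠ lookup f j →-dec i ≟ᶠ j)
  ×-dec all? (λ v → v ∈? X →-dec any? (λ i → lookup f i ≟ᶠ v))
  ×-dec all? (λ i → all? λ j → S ⊢ i ⟶? j →-dec T ⊢ lookup f i ⟶? lookup f j)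
  ×-dec all? (λ i → all? λ j → T ⊢ lookup f i ⟶? lookup f j →-dec S ⊢ i ⟶? j))

Is3Cycle : Arcs n → Subset n → Set
Is3Cycle T X = ∃[ f ] IsIsomorphism cycle₃ T X f

is3Cycle? : (T : Arcs n) → Decidable (Is3Cycle T)
is3Cycle? T X = map′
  (λ (a , b , c , iso) → a ∷ b ∷ c ∷ [] , iso)
  (λ { (a ∷ b ∷ c ∷ [] , iso) → a , b , c , iso })
  (any? λ a → any? λ b → any? λ c → isIsomorphism? cycle₃ T X (a ∷ b ∷ c ∷ []))

C₃ : Subset n → Arcs n → Hypergraph n
C₃ V T = record
  { V   = V
  ; E   = λ X → X ⊆ V × ∣ X ∣ ≡ 3 × Is3Cycle T X
  ; E?  = λ X → X ⊆? V ×-dec ∣ X ∣ ≟ⁿ 3 ×-dec is3Cycle? T X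
  ; E⊆V = proj₁
  }

IsRealization : Hypergraph n → Arcs n → Set
IsRealization H T = IsTournament (V H) T × H ≋ C₃ (V H) T

isRealization? : (H : Hypergraph n) → Decidable (IsRealization H)
isRealization? H T = isTournament? (V H) T ×-dec V H ≟ˢ V K ×-dec
  map′ (λ (f , g) → (λ {e} → f e) , (λ {e} → g e)) (λ (f , g) → (λ e → f) , (λ e → g))
    (    allSubset? (λ e → E? H e →-dec E? K e)
    ×-dec allSubset? (λ e → E? K e →-dec E? H e))
  where K = C₃ (V H) T

Realizable : Hypergraph n → Set
Realizable H = ∃[ T ] IsRealization H T

𝓡 : Hypergraph n → List (Arcs n)
𝓡 {n} H = filter (isRealization? H) (arcSets n)

record IsModule (H : Hypergraph n) (M : Subset n) : Set where
  field
    M⊆V     : M ⊆ V H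
    replace : ∀ e → E H e → Nonempty (e ∩ M) → Nonempty (e ─ M) →
              ∃[ m ] m ∈ M × e ∩ M ≡ ⁅ m ⁆ × (∀ n → n ∈ M → E H ((e - m) ∪ ⁅ n ⁆))

isModule? : (H : Hypergraph n) → Decidable (IsModule H)
isModule? H M with M ⊆? V H
... | no  M⊈V = no (M⊈V ∘ IsModule.M⊆V)
... | yes M⊆V = map′ (λ r → record { M⊆V = M⊆V ; replace = r }) IsModule.replace
  (allSubset? λ e →
    E? H e →-dec nonempty? (e ∩ M) →-dec nonempty? (e ─ M) →-dec
    any? λ m → m ∈? M ×-dec (e ∩ M) ≟ˢ ⁅ m ⁆ ×-dec
      all? λ n → n ∈? M →-dec E? H ((e - m) ∪ ⁅ n ⁆))

IsTrivial : Hypergraph n → Subset n → Set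
IsTrivial H M = M ≡ ⊥ ⊎ M ≡ V H ⊎ ∃[ v ] v ∈ V H × M ≡ ⁅ v ⁆

IsPrime : Hypergraph n → Set
IsPrime H = ∣ V H ∣ ≥ 3 × (∀ M → IsModule H M → IsTrivial H M)

IsStrong : Hypergraph n → Subset n → Set
IsStrong H M = IsModule H M ×
  (∀ N → IsModule H N → Nonempty (M ∩ N) → M ⊆ N ⊎ N ⊆ M)

IsMaximalProperStrong : Hypergraph n → Subset n → Set
IsMaximalProperStrong H M = (IsStrong H M × M ≢ V H) ×
  (∀ N → IsStrong H N × N ≢ V H → M ⊆ N → M ≡ N)

isEmpty? : (H : Hypergraph n) → Dec (IsEmpty H)
isEmpty? H = allSubset? (¬? ∘ E? H)

isPrime? : (H : Hypergraph n) → Dec (IsPrime H)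
isPrime? H = ∣ V H ∣ ≥? 3 ×-dec allSubset? λ M → isModule? H M →-dec
  (M ≟ˢ ⊥ ⊎-dec M ≟ˢ V H ⊎-dec any? λ v → v ∈? V H ×-dec M ≟ˢ ⁅ v ⁆)

isStrong? : (H : Hypergraph n) → Decidable (IsStrong H)
isStrong? H M = isModule? H M ×-dec allSubset? λ N →
  isModule? H N →-dec nonempty? (M ∩ N) →-dec (M ⊆? N ⊎-dec N ⊆? M)

isMaximalProperStrong? : (H : Hypergraph n) → Decidable (IsMaximalProperStrong H)
isMaximalProperStrong? H M = (isStrong? H M ×-dec ¬? (M ≟ˢ V H)) ×-dec
  allSubset? λ N → (isStrong? H N ×-dec ¬? (N ≟ˢ V H)) →-dec M ⊆? N →-dec M ≟ˢ N

Π : Hypergraph n → List (Subset n)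
Π {n} H = filter (isMaximalProperStrong? H) (subsets n)

-- The blocks of P that meet e, each block being identified with its position in P.
trace : (P : List (Subset n)) → Subset n → Subset (length P)
trace P e = tabulate λ i → does (nonempty? (List.lookup P i ∩ e))

-- Only meant for P listing, without repetition, the blocks of a partition of
-- V H into modules of H.
infixl 8 _/_

_/_ : Hypergraph n → (P : List (Subset n)) → Hypergraph (length P)
H / P = record
  { V   = ⊤
  ; E   = λ 𝓔 → ∣ 𝓔 ∣ ≥ 2 × (∃[ e ] E H e × 𝓔 ≡ trace P e)
  ; E?  = λ 𝓔 → ∣ 𝓔 ∣ ≥? 2 ×-dec anySubset? (λ e → E? H e ×-dec 𝓔 ≟ˢ trace P e)
  ; E⊆V = λ _ _ → ∈⊤
  }

𝓓≥2 : Hypergraph n → List (Subset n)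
𝓓≥2 {n} H = filter (λ X → isStrong? H X ×-dec ∣ X ∣ ≥? 2) (subsets n)

𝓓△ : Hypergraph n → List (Subset n)
𝓓△ H = filter (λ X → isPrime? (H [ X ] / Π (H [ X ]))) (𝓓≥2 H)

𝓓∘ : Hypergraph n → List (Subset n)
𝓓∘ H = filter (λ X → isEmpty? (H [ X ] / Π (H [ X ]))) (𝓓≥2 H)

module Submission where

-- Call a pair of vertices of a strong module X a cross pair of X if it meets two
-- blocks of Π(H[X]). Every pair of vertices is a cross pair of exactly one X.
-- Strong modules of H are modules of every realization, so realizations can
-- exchange their arcs on the cross pairs of each X independently, and |𝓡(H)| is
-- the product over X of the number of patterns that occur on the cross pairs of X.
-- If no edge of H[X] meets two blocks, the patterns are the linear orders of the
-- blocks. Otherwise H[X] is connected and its proper modules lie inside blocks.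
-- Given two realizations T and T′ on X, colour a pair A if they agree on it and D
-- if they differ. When x → y → z in T and xy, yz have the same colour, so has xz.
-- By induction along strongly connected subtournaments of T, the graph A or the
-- graph D is disconnected; its components are modules of T, hence lie inside
-- blocks, so all cross pairs have the same colour and there are two patterns.

open import Algebra.Properties.CommutativeSemigroup using (x∙yz≈y∙xz)
open import Data.Fin.Base using (Fin; zero; suc; punchIn; punchOut)
open import Data.Fin.Properties using (any?; all?; punchIn-punchOut; punchIn-injective; punchInᵢ≢i) renaming (_≟_ to _≟ᶠ_)
open import Data.Fin.Subset
open import Data.Fin.Subset.Properties
open import Data.List.Base as List
  using (List; []; _∷_; length; map; filter; cartesianProduct; cartesianProductWith; allFin)
open import Data.List.Membership.Propositional using () renaming (_∈_ to _∈ˡ_; _∉_ to _∉ˡ_)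
open import Data.List.Membership.Propositional.Properties
  using (∈-filter⁺; ∈-filter⁻; ∈-lookup; ∈-map⁺; ∈-map⁻; ∈-allFin; ∈-cartesianProduct⁺; ∈-cartesianProduct⁻; ∈-cartesianProductWith⁺; ∈-cartesianProductWith⁻)
open import Data.List.Membership.Propositional.Properties.WithK using (unique∧set⇒bag)
import Data.List.Properties as List
open import Data.List.Relation.Binary.BagAndSetEquality using (∼bag⇒↭)
open import Data.List.Relation.Binary.Permutation.Propositional.Properties using (↭-length)
open import Data.List.Relation.Unary.All as All using (All; []; _∷_)
open import Data.List.Relation.Unary.AllPairs using ([]; _∷_)
open import Data.List.Relation.Unary.Any as Any using (here; there)
import Data.List.Relation.Unary.Any.Properties as Any
open import Data.List.Relation.Unary.Unique.Propositional using (Unique)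
open import Data.List.Relation.Unary.Unique.Propositional.Properties
  using (filter⁺; cartesianProduct⁺; cartesianProductWith⁺; allFin⁺; Unique[x∷xs]⇒x∉xs)
open import Data.Nat.Base using (ℕ; zero; suc; _+_; _*_; _^_; _!; _∸_; _≤_; _<_; _≥_; s≤s; z≤n)
open import Data.Nat.Induction using (<-wellFounded)
open import Data.Nat.ListAction using (product)
open import Data.Nat.Properties
  using (suc-injective; ≤-trans; ∸-monoʳ-<; _<?_; _≥?_; <-asym; <-trans; <-irrefl; <-cmp; *-assoc; *-commutativeSemigroup)
open import Data.Product.Base using (∃-syntax; _×_; _,_; proj₁; proj₂; -,_)
open import Data.Sum.Base as Sum using (_⊎_; inj₁; inj₂; [_,_]′; swap)
open import Data.Vec.Base as Vec using (Vec; []; _∷_; lookup; tabulate; insertAt; here; there)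
open import Data.Vec.Properties
  using (lookup∘tabulate; tabulate∘lookup; tabulate-cong; lookup⇒[]=; []=⇒lookup; insertAt-lookup; insertAt-punchIn; lookup-map)
open import Function.Base using (_∘_; id; flip)
open import Function.Bundles using (mk⇔)
open import Induction.WellFounded using (Acc; acc)
open import Level using (0ℓ)
open import Relation.Binary.Definitions using (tri<; tri≈; tri>)
open import Relation.Binary.PropositionalEquality
  using (_≡_; _≢_; refl; sym; trans; cong; cong₂; subst; subst₂; ≢-sym; module ≡-Reasoning)
open import Relation.Nullary.Decidable
  using (Dec; yes; no; does; dec-true; ¬?; _×-dec_; _⊎-dec_; _→-dec_; decidable-stable)
open import Relation.Nullary.Negation using (¬_; contradiction)
open import Relation.Unary using (Pred; Decidable)
open import Defs

-- A module of `H` need not be a module of a realization: if `H` has no edges, every set of vertices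
-- is a module of `H`, while the realizations are linear orders, whose modules are intervals.
-- Passing from hypergraph modules to tournament modules therefore uses strongness, whereas every
-- module of a realization is a module of the hypergraph. Reversing all arcs keeps the 3-cycles, so
-- a pair on which `T` and `T′` differ is a pair on which `T` agrees with the reverse of `T′`, again
-- a realization. The two colours thus obey the same rules, and what is proved for `A` also serves
-- `D`. The induction needs a vertex whose deletion preserves strong connectivity. It is found from
-- a maximal strongly connected proper subset; at most three vertices are left to be treated
-- directly. To count patterns, one realization `T₀` is fixed, and a pattern on the cross pairs of
-- `X` is represented by the realization that shows it there and equals `T₀` elsewhere.

private
  variable
    n k : ℕ
    a b c u v x y z : Fin n
    e p q M N U W X : Subset n
    H K : Hypergraph n
    S T T′ : Arcs n

-- Subsets of `Fin n`: comprehension, extremal sets, sizes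

⟪_⟫ : {P : Pred (Fin n) 0ℓ} → Decidable P → Subset n
⟪ P? ⟫ = tabulate (does ∘ P?)

∈⟪⟫⁺ : {P : Pred (Fin n) 0ℓ} (P? : Decidable P) → P x → x ∈ ⟪ P? ⟫
∈⟪⟫⁺ {x = x} P? px = lookup⇒[]= x _ (trans (lookup∘tabulate _ x) (dec-true (P? x) px))

∈⟪⟫⁻ : {P : Pred (Fin n) 0ℓ} (P? : Decidable P) → x ∈ ⟪ P? ⟫ → P x
∈⟪⟫⁻ {x = x} P? x∈ with P? x | trans (sym (lookup∘tabulate (does ∘ P?) x)) ([]=⇒lookup x∈)
... | yes px | _ = px
... | no _   | ()

∈─⁻ : x ∈ p ─ q → x ∈ p × x ∉ q
∈─⁻ {p = p} {q = q} x∈ = p─q⊆p p q x∈ , λ x∈q → go q p x∈ x∈q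
  where
  go : ∀ {m} {x : Fin m} (q p : Subset m) → x ∈ p ─ q → x ∉ q
  go (s ∷ q) (t ∷ p) x∈p─q (there x∈q) = go q p (drop-there x∈p─q) x∈q
  go (inside ∷ q) (t ∷ p) () here

⊈⇒∃∉ : ¬ p ⊆ q → ∃[ x ] x ∈ p × x ∉ q
⊈⇒∃∉ {p = p} {q = q} p⊈q with nonempty? (p ─ q)
... | yes (x , x∈) = x , ∈─⁻ x∈
... | no  ∄        = contradiction
  (λ {x} x∈p → decidable-stable (x ∈? q) λ x∉q → ∄ (x , x∈p∧x∉q⇒x∈p─q x∈p x∉q)) p⊈q

abstract
  maximal : {P : Pred (Subset n) 0ℓ} → Decidable P → ∀ {p} → P p →
            ∃[ q ] p ⊆ q × P q × (∀ r → P r → q ⊆ r → q ≡ r)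
  maximal {n = n} {P = P} P? {p} Pp = go p Pp (<-wellFounded _)
    where
    go : ∀ p → P p → Acc _<_ (n ∸ ∣ p ∣) → ∃[ q ] p ⊆ q × P q × (∀ r → P r → q ⊆ r → q ≡ r)
    go p Pp (acc rec) with anySubset? (λ r → P? r ×-dec p ⊂? r)
    ... | no ∄ = p , ⊆-refl , Pp , λ r Pr p⊆r → ⊆-antisym p⊆r λ {x} x∈r →
          decidable-stable (x ∈? p) λ x∉p → ∄ (r , Pr , p⊆r , x , x∈r , x∉p)
    ... | yes (r , Pr , p⊂r) =
          let q , r⊆q , rest = go r Pr (rec (∸-monoʳ-< (p⊂q⇒∣p∣<∣q∣ p⊂r) (∣p∣≤n r)))
          in  q , ⊆-trans (proj₁ p⊂r) r⊆q , rest

  minimal : {P : Pred (Subset n) 0ℓ} → Decidable P → ∀ {p} → P p →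
            ∃[ q ] q ⊆ p × P q × (∀ r → P r → r ⊆ q → q ⊆ r)
  minimal {n = n} {P = P} P? {p} Pp = go p Pp (<-wellFounded _)
    where
    go : ∀ p → P p → Acc _<_ ∣ p ∣ → ∃[ q ] q ⊆ p × P q × (∀ r → P r → r ⊆ q → q ⊆ r)
    go p Pp (acc rec) with anySubset? (λ r → P? r ×-dec r ⊂? p)
    ... | no ∄ = p , ⊆-refl , Pp , λ r Pr r⊆p {x} x∈p →
          decidable-stable (x ∈? r) λ x∉r → ∄ (r , Pr , r⊆p , x , x∈p , x∉r)
    ... | yes (r , Pr , r⊂p) =
          let q , q⊆r , rest = go r Pr (rec (p⊂q⇒∣p∣<∣q∣ r⊂p))
          in  q , ⊆-trans q⊆r (proj₁ r⊂p) , rest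

two≤∣p∣ : x ∈ p → y ∈ p → x ≢ y → 2 ≤ ∣ p ∣
two≤∣p∣ {x = x} {p = p} {y = y} x∈p y∈p x≢y = subst (_< ∣ p ∣) (∣⁅x⁆∣≡1 x) (p⊂q⇒∣p∣<∣q∣
  ( (λ z∈ → subst (_∈ p) (sym (x∈⁅y⁆⇒x≡y x z∈)) x∈p)
  , y , y∈p , λ y∈ → x≢y (sym (x∈⁅y⁆⇒x≡y x y∈))))

two≤∣p∣⁻ : {p : Subset n} → 2 ≤ ∣ p ∣ → ∃[ x ] ∃[ y ] x ∈ p × y ∈ p × x ≢ y
two≤∣p∣⁻ {n = n} {p = p} 2≤ with nonempty? p
... | no ∄ = contradiction (subst (2 ≤_) (trans (cong ∣_∣ (Empty-unique ∄)) (∣⊥∣≡0 n)) 2≤) λ ()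
... | yes (x , x∈p) with nonempty? (p - x)
...   | yes (y , y∈) = let y∈p , y∉ = ∈─⁻ y∈ in
        x , y , x∈p , y∈p , λ x≡y → y∉ (subst (_∈ ⁅ x ⁆) x≡y (x∈⁅x⁆ x))
...   | no ∄ = contradiction (subst (2 ≤_) (∣⁅x⁆∣≡1 x) (≤-trans 2≤ (p⊆q⇒∣p∣≤∣q∣ p⊆⁅x⁆))) λ { (s≤s ()) }
  where
  p⊆⁅x⁆ : p ⊆ ⁅ x ⁆
  p⊆⁅x⁆ {y} y∈p with y ≟ᶠ x
  ... | yes refl = x∈⁅x⁆ x
  ... | no y≢x   = contradiction (y , x∈p∧x≢y⇒x∈p-y y∈p y≢x) ∄

-- Realizations in terms of triples

tri : Fin n → Fin n → Fin n → Subset n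
tri a b c = ⁅ a ⁆ ∪ (⁅ b ⁆ ∪ ⁅ c ⁆)

∈tri⁻ : x ∈ tri a b c → x ≡ a ⊎ x ≡ b ⊎ x ≡ c
∈tri⁻ {a = a} {b} {c} x∈ with x∈p∪q⁻ ⁅ a ⁆ _ x∈
... | inj₁ x∈a = inj₁ (x∈⁅y⁆⇒x≡y a x∈a)
... | inj₂ x∈bc with x∈p∪q⁻ ⁅ b ⁆ _ x∈bc
...   | inj₁ x∈b = inj₂ (inj₁ (x∈⁅y⁆⇒x≡y b x∈b))
...   | inj₂ x∈c = inj₂ (inj₂ (x∈⁅y⁆⇒x≡y c x∈c))

tri-∋₁ : a ∈ tri a b c
tri-∋₁ {a = a} = x∈p∪q⁺ (inj₁ (x∈⁅x⁆ a))

tri-∋₂ : b ∈ tri a b c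
tri-∋₂ {b = b} = x∈p∪q⁺ (inj₂ (x∈p∪q⁺ (inj₁ (x∈⁅x⁆ b))))

tri-∋₃ : c ∈ tri a b c
tri-∋₃ {c = c} = x∈p∪q⁺ (inj₂ (x∈p∪q⁺ (inj₂ (x∈⁅x⁆ c))))

tri-⊆ : a ∈ p → b ∈ p → c ∈ p → tri a b c ⊆ p
tri-⊆ a∈ b∈ c∈ x∈ with ∈tri⁻ x∈
... | inj₁ refl        = a∈
... | inj₂ (inj₁ refl) = b∈
... | inj₂ (inj₂ refl) = c∈

tri-rot : tri {n} a b c ≡ tri b c a
tri-rot = ⊆-antisym (tri-⊆ tri-∋₃ tri-∋₁ tri-∋₂) (tri-⊆ tri-∋₂ tri-∋₃ tri-∋₁)

tri-swap : tri {n} a b c ≡ tri b a c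
tri-swap = ⊆-antisym (tri-⊆ tri-∋₂ tri-∋₁ tri-∋₃) (tri-⊆ tri-∋₂ tri-∋₁ tri-∋₃)

x∉p⇒∣⁅x⁆∪p∣ : x ∉ p → ∣ ⁅ x ⁆ ∪ p ∣ ≡ ℕ.suc ∣ p ∣
x∉p⇒∣⁅x⁆∪p∣ {x = zero}  {inside  ∷ p} x∉ = contradiction here x∉
x∉p⇒∣⁅x⁆∪p∣ {x = zero}  {outside ∷ p} x∉ = cong ℕ.suc (cong ∣_∣ (⊆-antisym
  (λ y∈ → [ (λ y∈⊥ → contradiction y∈⊥ ∉⊥) , id ]′ (x∈p∪q⁻ _ p y∈)) (q⊆p∪q _ p)))
x∉p⇒∣⁅x⁆∪p∣ {x = suc x} {inside  ∷ p} x∉ = cong ℕ.suc (x∉p⇒∣⁅x⁆∪p∣ (x∉ ∘ there))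
x∉p⇒∣⁅x⁆∪p∣ {x = suc x} {outside ∷ p} x∉ = x∉p⇒∣⁅x⁆∪p∣ (x∉ ∘ there)

∣tri∣ : a ≢ b → a ≢ c → b ≢ c → ∣ tri a b c ∣ ≡ 3
∣tri∣ {a = a} {b} {c} a≢b a≢c b≢c = trans
  (x∉p⇒∣⁅x⁆∪p∣ λ a∈ → [ a≢b ∘ x∈⁅y⁆⇒x≡y b , a≢c ∘ x∈⁅y⁆⇒x≡y c ]′ (x∈p∪q⁻ ⁅ b ⁆ _ a∈))
  (cong ℕ.suc (trans (x∉p⇒∣⁅x⁆∪p∣ (b≢c ∘ x∈⁅y⁆⇒x≡y c)) (cong ℕ.suc (∣⁅x⁆∣≡1 c))))

Cyc : Arcs n → Fin n → Fin n → Fin n → Set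
Cyc T a b c = T ⊢ a ⟶ b × T ⊢ b ⟶ c × T ⊢ c ⟶ a

rot : {T : Arcs n} → Cyc T a b c → Cyc T b c a
rot (ab , bc , ca) = bc , ca , ab

-- T may have arcs leaving V K: a realization of H realizes every H [ W ]
-- in this sense.
record Realizes (T : Arcs n) (K : Hypergraph n) : Set where
  field
    asym     : T ⊢ a ⟶ b → ¬ T ⊢ b ⟶ a
    total    : a ∈ V K → b ∈ V K → a ≢ b → T ⊢ a ⟶ b ⊎ T ⊢ b ⟶ a
    cyc⇒edge : a ∈ V K → b ∈ V K → c ∈ V K → Cyc T a b c → E K (tri a b c)
    edge⇒cyc : ∀ {e} → E K e → ∃[ a ] ∃[ b ] ∃[ c ] Cyc T a b c × e ≡ tri a b c

  irrefl : ¬ T ⊢ a ⟶ a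
  irrefl aa = asym aa aa

  ⟶⇒≢ : T ⊢ a ⟶ b → a ≢ b
  ⟶⇒≢ ab refl = irrefl ab

  ¬⟶⇒⟵ : a ∈ V K → b ∈ V K → a ≢ b → ¬ T ⊢ a ⟶ b → T ⊢ b ⟶ a
  ¬⟶⇒⟵ a∈ b∈ a≢b ¬ab = [ (λ ab → contradiction ab ¬ab) , id ]′ (total a∈ b∈ a≢b)

realizes-restrict : {T : Arcs n} {H : Hypergraph n} {W : Subset n} →
                    Realizes T H → W ⊆ V H → Realizes T (H [ W ])
realizes-restrict r W⊆V = record
  { asym     = asym
  ; total    = λ a∈ b∈ → total (W⊆V a∈) (W⊆V b∈)
  ; cyc⇒edge = λ a∈ b∈ c∈ cyc → cyc⇒edge (W⊆V a∈) (W⊆V b∈) (W⊆V c∈) cyc , tri-⊆ a∈ b∈ c∈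
  ; edge⇒cyc = edge⇒cyc ∘ proj₁
  }
  where open Realizes r

module _ {T : Arcs n} where

  3cycle⁻ : {e : Subset n} → Is3Cycle T e → ∃[ a ] ∃[ b ] ∃[ c ] Cyc T a b c × e ≡ tri a b c
  3cycle⁻ {e} (a ∷ b ∷ c ∷ [] , iso) = a , b , c
    , ( preserves zero (suc zero) (x∈⁅x⁆ (suc zero))
      , preserves (suc zero) (suc (suc zero)) (x∈⁅x⁆ (suc (suc zero)))
      , preserves (suc (suc zero)) zero (x∈⁅x⁆ zero))
    , ⊆-antisym (λ {x} x∈ → e⊆ (surjective x x∈))
                (tri-⊆ (into zero) (into (suc zero)) (into (suc (suc zero))))
    where
    open IsIsomorphism iso
    e⊆ : ∃[ i ] lookup (a ∷ b ∷ c ∷ []) i ≡ x → x ∈ tri a b c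
    e⊆ (zero , refl) = tri-∋₁
    e⊆ (suc zero , refl) = tri-∋₂
    e⊆ (suc (suc zero) , refl) = tri-∋₃

  3cycle⁺ : (∀ {a b} → T ⊢ a ⟶ b → ¬ T ⊢ b ⟶ a) → Cyc T a b c → Is3Cycle T (tri a b c)
  3cycle⁺ {a = a} {b} {c} asym (ab , bc , ca) = f , record
    { into       = λ { zero → tri-∋₁ ; (suc zero) → tri-∋₂ ; (suc (suc zero)) → tri-∋₃ }
    ; injective  = injective
    ; surjective = λ v → [ (λ { refl → zero , refl })
                         , [ (λ { refl → suc zero , refl })
                           , (λ { refl → suc (suc zero) , refl }) ]′ ]′ ∘ ∈tri⁻
    ; preserves  = preserves
    ; reflects   = reflects
    }
    where
    f = a ∷ b ∷ c ∷ []
    irrefl : ∀ {a} → ¬ T ⊢ a ⟶ a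
    irrefl aa = asym aa aa
    ≢ : ∀ {a b} → T ⊢ a ⟶ b → a ≢ b
    ≢ ab refl = irrefl ab
    injective : ∀ i j → lookup f i ≡ lookup f j → i ≡ j
    injective zero zero _ = refl
    injective zero (suc zero) eq = contradiction eq (≢ ab)
    injective zero (suc (suc zero)) eq = contradiction (sym eq) (≢ ca)
    injective (suc zero) zero eq = contradiction (sym eq) (≢ ab)
    injective (suc zero) (suc zero) _ = refl
    injective (suc zero) (suc (suc zero)) eq = contradiction eq (≢ bc)
    injective (suc (suc zero)) zero eq = contradiction eq (≢ ca)
    injective (suc (suc zero)) (suc zero) eq = contradiction (sym eq) (≢ bc)
    injective (suc (suc zero)) (suc (suc zero)) _ = refl
    preserves : ∀ i j → cycle₃ ⊢ i ⟶ j → T ⊢ lookup f i ⟶ lookup f j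
    preserves zero j ij with refl ← x∈⁅y⁆⇒x≡y (suc zero) ij = ab
    preserves (suc zero) j ij with refl ← x∈⁅y⁆⇒x≡y (suc (suc zero)) ij = bc
    preserves (suc (suc zero)) j ij with refl ← x∈⁅y⁆⇒x≡y zero ij = ca
    reflects : ∀ i j → T ⊢ lookup f i ⟶ lookup f j → cycle₃ ⊢ i ⟶ j
    reflects zero zero ij = contradiction ij irrefl
    reflects zero (suc zero) ij = x∈⁅x⁆ (suc zero)
    reflects zero (suc (suc zero)) ij = contradiction ij (asym ca)
    reflects (suc zero) zero ij = contradiction ij (asym ab)
    reflects (suc zero) (suc zero) ij = contradiction ij irrefl
    reflects (suc zero) (suc (suc zero)) ij = x∈⁅x⁆ (suc (suc zero))
    reflects (suc (suc zero)) zero ij = x∈⁅x⁆ zero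
    reflects (suc (suc zero)) (suc zero) ij = contradiction ij (asym bc)
    reflects (suc (suc zero)) (suc (suc zero)) ij = contradiction ij irrefl

module _ {T : Arcs n} {H : Hypergraph n} where

  isRealization⇒realizes : IsRealization H T → Realizes T H
  isRealization⇒realizes (isT , _ , E⊆ , ⊆E) = record
    { asym     = asym
    ; total    = λ a∈ b∈ a≢b → Sum.map proj₁ proj₁ (exactlyOne _ _ a∈ b∈ a≢b)
    ; cyc⇒edge = λ a∈ b∈ c∈ cyc@(ab , bc , ca) → ⊆E
        (tri-⊆ a∈ b∈ c∈ , ∣tri∣ (≢ ab) (≢-sym (≢ ca)) (≢ bc) , 3cycle⁺ asym cyc)
    ; edge⇒cyc = λ e∈ → 3cycle⁻ (proj₂ (proj₂ (E⊆ e∈)))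
    }
    where
    open IsTournament isT
    ≢ : ∀ {a b} → T ⊢ a ⟶ b → a ≢ b
    ≢ ab refl = irreflexive _ ab
    asym : ∀ {a b} → T ⊢ a ⟶ b → ¬ T ⊢ b ⟶ a
    asym ab ba with arcs⊆V×V _ _ ab
    ... | a∈ , b∈ with exactlyOne _ _ a∈ b∈ (≢ ab)
    ...   | inj₁ (_ , ¬ba) = ¬ba ba
    ...   | inj₂ (_ , ¬ab) = ¬ab ab

  realizes⇒isRealization : IsUniform 3 H → (∀ a b → T ⊢ a ⟶ b → a ∈ V H × b ∈ V H) →
                           Realizes T H → IsRealization H T
  realizes⇒isRealization uni arcs⊆ r =
      record
        { arcs⊆V×V    = arcs⊆
        ; irreflexive = λ _ → irrefl
        ; exactlyOne  = λ _ _ a∈ b∈ a≢b → Sum.map (λ ab → ab , asym ab) (λ ba → ba , asym ba) (total a∈ b∈ a≢b)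
        }
    , refl
    , (λ e∈ → E⊆V H e∈ , uni e∈ , is3 (edge⇒cyc e∈))
    , (λ (e⊆ , _ , e3) → edge e⊆ (3cycle⁻ e3))
    where
    open Realizes r
    is3 : ∀ {e} → ∃[ a ] ∃[ b ] ∃[ c ] Cyc T a b c × e ≡ tri a b c → Is3Cycle T e
    is3 (_ , _ , _ , cyc , refl) = 3cycle⁺ asym cyc
    edge : ∀ {e} → e ⊆ V H → ∃[ a ] ∃[ b ] ∃[ c ] Cyc T a b c × e ≡ tri a b c → E H e
    edge e⊆ (_ , _ , _ , cyc , refl) = cyc⇒edge (e⊆ tri-∋₁) (e⊆ tri-∋₂) (e⊆ tri-∋₃) cyc

-- Modules of hypergraphs and of tournaments

∈∧∉⇒≢ : x ∈ p → y ∉ p → x ≢ y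
∈∧∉⇒≢ x∈ y∉ refl = y∉ x∈

replace-tri : a ≢ b → a ≢ c → (tri a b c - a) ∪ ⁅ x ⁆ ≡ tri x b c
replace-tri {a = a} {b} {c} {x} a≢b a≢c = ⊆-antisym to
  (tri-⊆ (x∈p∪q⁺ (inj₂ (x∈⁅x⁆ x)))
         (x∈p∪q⁺ (inj₁ (x∈p∧x≢y⇒x∈p-y tri-∋₂ (≢-sym a≢b))))
         (x∈p∪q⁺ (inj₁ (x∈p∧x≢y⇒x∈p-y tri-∋₃ (≢-sym a≢c)))))
  where
  to : (tri a b c - a) ∪ ⁅ x ⁆ ⊆ tri x b c
  to y∈ with x∈p∪q⁻ (tri a b c - a) _ y∈
  ... | inj₂ y∈x with refl ← x∈⁅y⁆⇒x≡y x y∈x = tri-∋₁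
  ... | inj₁ y∈- with ∈─⁻ y∈-
  ...   | y∈tri , y∉a with ∈tri⁻ y∈tri
  ...     | inj₁ refl        = contradiction (x∈⁅x⁆ a) y∉a
  ...     | inj₂ (inj₁ refl) = tri-∋₂
  ...     | inj₂ (inj₂ refl) = tri-∋₃

E₃ : Hypergraph n → Fin n → Fin n → Fin n → Set
E₃ K a b c = E K (tri a b c)

-- The definition of a module, read on triples.
record Module (K : Hypergraph n) (M : Subset n) : Set where
  field
    ⊆V      : M ⊆ V K
    single  : E₃ K a b c → a ∈ M → c ∉ M → b ∉ M
    replace : E₃ K a b c → a ∈ M → c ∉ M → x ∈ M → E₃ K x b c

open Module

-- Comparing the arcs that leave the outside vertex is enough: in a tournament the arcs entering it
-- from `M` are then determined too.
TModule : Arcs n → Subset n → Subset n → Set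
TModule T W M = ∀ {v a b} → v ∈ W → v ∉ M → a ∈ M → b ∈ M → T ⊢ v ⟶ a → T ⊢ v ⟶ b

module _ {K : Hypergraph n} where

  E₃-rot : E₃ K a b c → E₃ K b c a
  E₃-rot = subst (E K) tri-rot

  E₃-swap : E₃ K a b c → E₃ K b a c
  E₃-swap = subst (E K) tri-swap

  E₃-swap₂₃ : E₃ K a b c → E₃ K a c b
  E₃-swap₂₃ = E₃-swap ∘ E₃-rot ∘ E₃-rot

  E₃⇒∈₁ : E₃ K a b c → a ∈ V K
  E₃⇒∈₁ abc = E⊆V K abc tri-∋₁

  E₃⇒∈₂ : E₃ K a b c → b ∈ V K
  E₃⇒∈₂ abc = E⊆V K abc tri-∋₂

  E₃⇒∈₃ : E₃ K a b c → c ∈ V K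
  E₃⇒∈₃ abc = E⊆V K abc tri-∋₃

  V-module : Module K (V K)
  V-module = record
    { ⊆V = id
    ; single  = λ abc _ c∉ → contradiction (E₃⇒∈₃ abc) c∉
    ; replace = λ abc _ c∉ → contradiction (E₃⇒∈₃ abc) c∉
    }

  -- An edge that leaves the union from a vertex of `M` can be moved within `M` to the common vertex
  -- `x`, and there the module `N` applies to it as well.
  ∪-module : Module K M → Module K N → x ∈ M → x ∈ N → Module K (M ∪ N)
  ∪-module {M} {N} {x} mM mN x∈M x∈N = record
    { ⊆V      = λ y∈ → [ ⊆V mM , ⊆V mN ]′ (x∈p∪q⁻ M N y∈)
    ; single  = λ abc a∈ c∉ → proj₁ (both abc a∈ c∉)
    ; replace = λ abc a∈ c∉ → proj₂ (both abc a∈ c∉)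
    }
    where
    half : ∀ {M N} → Module K M → Module K N → x ∈ M → x ∈ N → E₃ K a b c → a ∈ M → c ∉ M → c ∉ N →
           (b ∉ M × b ∉ N) × (∀ {y} → y ∈ M ⊎ y ∈ N → E₃ K y b c)
    half mM mN x∈M x∈N abc a∈M c∉M c∉N =
      let xbc = replace mM abc a∈M c∉M x∈M in
        (single mM abc a∈M c∉M , single mN xbc x∈N c∉N)
      , [ replace mM abc a∈M c∉M , replace mN xbc x∈N c∉N ]′
    both : ∀ {a b c} → E₃ K a b c → a ∈ M ∪ N → c ∉ M ∪ N → b ∉ M ∪ N × (∀ {y} → y ∈ M ∪ N → E₃ K y b c)
    both abc a∈ c∉ with x∈p∪q⁻ M N a∈
    ... | inj₁ a∈M with half mM mN x∈M x∈N abc a∈M (c∉ ∘ x∈p∪q⁺ ∘ inj₁) (c∉ ∘ x∈p∪q⁺ ∘ inj₂)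
    ...   | (b∉M , b∉N) , r = [ b∉M , b∉N ]′ ∘ x∈p∪q⁻ M N , r ∘ x∈p∪q⁻ M N
    both abc a∈ c∉ | inj₂ a∈N with half mN mM x∈N x∈M abc a∈N (c∉ ∘ x∈p∪q⁺ ∘ inj₂) (c∉ ∘ x∈p∪q⁺ ∘ inj₁)
    ...   | (b∉N , b∉M) , r = [ b∉M , b∉N ]′ ∘ x∈p∪q⁻ M N , r ∘ [ inj₂ , inj₁ ]′ ∘ x∈p∪q⁻ M N

  -- An edge from `M` to a vertex outside `Z` is moved by the module `Z`. If it goes to a vertex of
  -- `Z`, it lies wholly in `Z`, because no edge meets `Z` in exactly two vertices.
  module-sub⁺ : ∀ {Z} → Module K Z → Module (K [ Z ]) M → Module K M
  module-sub⁺ {M} {Z} mZ mM = record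
    { ⊆V      = ⊆V mZ ∘ ⊆V mM
    ; single  = λ abc a∈ c∉ → proj₁ (both abc a∈ c∉)
    ; replace = λ abc a∈ c∉ → proj₂ (both abc a∈ c∉)
    }
    where
    both : ∀ {a b c} → E₃ K a b c → a ∈ M → c ∉ M → b ∉ M × (∀ {y} → y ∈ M → E₃ K y b c)
    both {a} {b} {c} abc a∈ c∉ with c ∈? Z
    ... | no c∉Z = single mZ abc (⊆V mM a∈) c∉Z ∘ ⊆V mM
                 , replace mZ abc (⊆V mM a∈) c∉Z ∘ ⊆V mM
    ... | yes c∈Z = single mM abc′ a∈ c∉ , λ y∈ → proj₁ (replace mM abc′ a∈ c∉ y∈)
      where
      b∈Z : b ∈ Z
      b∈Z = decidable-stable (b ∈? Z) λ b∉Z → single mZ (E₃-swap₂₃ abc) (⊆V mM a∈) b∉Z c∈Z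
      abc′ : E₃ (K [ Z ]) a b c
      abc′ = abc , tri-⊆ (⊆V mM a∈) b∈Z c∈Z

  module-sub⁻ : ∀ {Z} → Module K M → M ⊆ Z → Module (K [ Z ]) M
  module-sub⁻ mM M⊆Z = record
    { ⊆V      = M⊆Z
    ; single  = single mM ∘ proj₁
    ; replace = λ (abc , ⊆Z) a∈ c∉ x∈ → replace mM abc a∈ c∉ x∈
        , tri-⊆ (M⊆Z x∈) (⊆Z tri-∋₂) (⊆Z tri-∋₃)
    }

-- Since `tri` ignores the order of its arguments, closure from the first vertex to the second says
-- that no edge meets both `Z` and its complement.
Connected : Hypergraph n → Set
Connected {n} K = ∀ {Z} {x : Fin n} → x ∈ Z → Z ⊆ V K → (∀ {a b c} → E₃ K a b c → a ∈ Z → b ∈ Z) → Z ≡ V K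

module Realized {n} {T : Arcs n} {K : Hypergraph n} (r : Realizes T K) where
  open Realizes r

  edge⇒dir : E₃ K a b c → Cyc T a b c ⊎ Cyc T b a c
  edge⇒dir {a} {b} {c} abc = go (edge⇒cyc abc)
    where
    fixed : ∀ {y z} → Cyc T a y z → tri a b c ≡ tri a y z → Cyc T a b c ⊎ Cyc T b a c
    fixed cyc@(ay , yz , za) eq
      with ∈tri⁻ (subst (b ∈_) eq tri-∋₂)
         | ∈tri⁻ (subst (_ ∈_) (sym eq) tri-∋₂)
         | ∈tri⁻ (subst (_ ∈_) (sym eq) tri-∋₃)
    ... | _ | inj₁ refl | _         = contradiction ay irrefl
    ... | _ | _         | inj₁ refl = contradiction za irrefl
    ... | inj₂ (inj₁ refl) | _ | inj₂ (inj₁ refl) = contradiction yz irrefl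
    ... | inj₂ (inj₁ refl) | _ | inj₂ (inj₂ refl) = inj₁ cyc
    ... | inj₂ (inj₂ refl) | inj₂ (inj₁ refl) | _ = contradiction yz irrefl
    ... | inj₂ (inj₂ refl) | inj₂ (inj₂ refl) | _ = inj₂ (za , ay , yz)
    ... | inj₁ refl | inj₂ (inj₁ refl) | _ = contradiction ay irrefl
    ... | inj₁ refl | _ | inj₂ (inj₁ refl) = contradiction za irrefl
    ... | inj₁ refl | inj₂ (inj₂ refl) | inj₂ (inj₂ refl) = contradiction yz irrefl
    go : ∃[ x ] ∃[ y ] ∃[ z ] Cyc T x y z × tri a b c ≡ tri x y z → Cyc T a b c ⊎ Cyc T b a c
    go (x , y , z , cyc , eq) with ∈tri⁻ (subst (a ∈_) eq tri-∋₁)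
    ... | inj₁ refl        = fixed cyc eq
    ... | inj₂ (inj₁ refl) = fixed (rot {T = T} cyc) (trans eq tri-rot)
    ... | inj₂ (inj₂ refl) = fixed (rot {T = T} (rot {T = T} cyc)) (trans eq (trans tri-rot tri-rot))

  E₃⇒≢ : E₃ K a b c → a ≢ b
  E₃⇒≢ abc with edge⇒dir abc
  ... | inj₁ (ab , _) = ⟶⇒≢ ab
  ... | inj₂ (ba , _) = ≢-sym (⟶⇒≢ ba)

  pick : E K e → x ∈ e → y ∈ e → x ≢ y → ∃[ z ] E₃ K x y z × e ≡ tri x y z
  pick {e} {x} {y} e∈ x∈ y∈ x≢y with edge⇒cyc e∈
  ... | a , b , c , _ , refl with ∈tri⁻ x∈ | ∈tri⁻ y∈
  ... | inj₁ refl        | inj₁ refl        = contradiction refl x≢y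
  ... | inj₁ refl        | inj₂ (inj₁ refl) = c , e∈ , refl
  ... | inj₁ refl        | inj₂ (inj₂ refl) = b , E₃-swap₂₃ {K = K} e∈ , trans tri-rot (trans tri-rot tri-swap)
  ... | inj₂ (inj₁ refl) | inj₁ refl        = c , E₃-swap {K = K} e∈ , tri-swap
  ... | inj₂ (inj₁ refl) | inj₂ (inj₁ refl) = contradiction refl x≢y
  ... | inj₂ (inj₁ refl) | inj₂ (inj₂ refl) = a , E₃-rot {K = K} e∈ , tri-rot
  ... | inj₂ (inj₂ refl) | inj₁ refl        = b , E₃-rot {K = K} (E₃-rot {K = K} e∈) , trans tri-rot tri-rot
  ... | inj₂ (inj₂ refl) | inj₂ (inj₁ refl) = a , E₃-swap {K = K} (E₃-rot {K = K} e∈) , trans tri-rot tri-swap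
  ... | inj₂ (inj₂ refl) | inj₂ (inj₂ refl) = contradiction refl x≢y

  isModule⇒module : IsModule K M → Module K M
  isModule⇒module {M} isM = record
    { ⊆V      = IsModule.M⊆V isM
    ; single  = λ abc a∈ c∉ → proj₁ (both abc a∈ c∉)
    ; replace = λ abc a∈ c∉ → proj₂ (both abc a∈ c∉)
    }
    where
    both : ∀ {a b c} → E₃ K a b c → a ∈ M → c ∉ M → b ∉ M × (∀ {y} → y ∈ M → E₃ K y b c)
    both {a} {b} {c} abc a∈M c∉M
      with IsModule.replace isM _ abc (a , x∈p∩q⁺ (tri-∋₁ , a∈M)) (c , x∈p∧x∉q⇒x∈p─q tri-∋₃ c∉M)
    ... | m , m∈M , eq , rep
      with refl ← x∈⁅y⁆⇒x≡y m (subst (a ∈_) eq (x∈p∩q⁺ (tri-∋₁ , a∈M)))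
      = (λ b∈M → E₃⇒≢ abc (sym (x∈⁅y⁆⇒x≡y m (subst (b ∈_) eq (x∈p∩q⁺ (tri-∋₂ , b∈M))))))
      , λ y∈M → subst (E K) (replace-tri (E₃⇒≢ abc) (∈∧∉⇒≢ a∈M c∉M)) (rep _ y∈M)

  module⇒isModule : Module K M → IsModule K M
  module⇒isModule {M} mM = record { M⊆V = ⊆V mM ; replace = rep }
    where
    rep : ∀ e → E K e → Nonempty (e ∩ M) → Nonempty (e ─ M) →
          ∃[ m ] m ∈ M × e ∩ M ≡ ⁅ m ⁆ × (∀ n → n ∈ M → E K ((e - m) ∪ ⁅ n ⁆))
    rep e e∈ (x , x∈) (y , y∈) with x∈p∩q⁻ e M x∈ | ∈─⁻ y∈
    ... | x∈e , x∈M | y∈e , y∉M with pick e∈ x∈e y∈e (∈∧∉⇒≢ x∈M y∉M)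
    ...   | z , xyz , refl = x , x∈M , ⊆-antisym e∩M⊆ ⊆e∩M
        , λ n n∈M → subst (E K) (sym (replace-tri (E₃⇒≢ xyz) (E₃⇒≢ xzy)))
                      (E₃-swap₂₃ {K = K} (replace mM xzy x∈M y∉M n∈M))
      where
      xzy : E₃ K x z y
      xzy = E₃-swap₂₃ {K = K} xyz
      e∩M⊆ : e ∩ M ⊆ ⁅ x ⁆
      e∩M⊆ w∈ with x∈p∩q⁻ e M w∈
      ... | w∈e , w∈M with ∈tri⁻ w∈e
      ...   | inj₁ refl        = x∈⁅x⁆ x
      ...   | inj₂ (inj₁ refl) = contradiction w∈M y∉M
      ...   | inj₂ (inj₂ refl) = contradiction w∈M (single mM xzy x∈M y∉M)
      ⊆e∩M : ⁅ x ⁆ ⊆ e ∩ M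
      ⊆e∩M w∈ with refl ← x∈⁅y⁆⇒x≡y x w∈ = x∈p∩q⁺ (x∈e , x∈M)

  singleton-module : x ∈ V K → Module K ⁅ x ⁆
  singleton-module {x} x∈V = record
    { ⊆V      = λ y∈ → subst (_∈ V K) (sym (x∈⁅y⁆⇒x≡y x y∈)) x∈V
    ; single  = λ abc a∈ _ b∈ → E₃⇒≢ abc (trans (x∈⁅y⁆⇒x≡y x a∈) (sym (x∈⁅y⁆⇒x≡y x b∈)))
    ; replace = λ {a} {b} {c} abc a∈ _ y∈ →
        subst (λ y → E₃ K y b c) (trans (x∈⁅y⁆⇒x≡y x a∈) (sym (x∈⁅y⁆⇒x≡y x y∈))) abc
    }

  -- A vertex outside `M` that lies on a 3-cycle with two vertices of `M` would point to one of them
  -- and not to the other. So a 3-cycle leaving `M` has a single vertex in it, and replacing that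
  -- vertex preserves its two arcs.
  tModule⇒module : M ⊆ V K → TModule T (V K) M → Module K M
  tModule⇒module {M} M⊆V tM = record
    { ⊆V      = M⊆V
    ; single  = λ abc a∈ c∉ → proj₁ (both abc a∈ c∉)
    ; replace = λ abc a∈ c∉ → proj₂ (both abc a∈ c∉)
    }
    where
    both : ∀ {a b c} → E₃ K a b c → a ∈ M → c ∉ M → b ∉ M × (∀ {y} → y ∈ M → E₃ K y b c)
    both {a} {b} {c} abc a∈ c∉ with edge⇒dir abc
    ... | inj₁ (ab , bc , ca) = b∉ , λ y∈ → cyc⇒edge (M⊆V y∈) (E₃⇒∈₂ {K = K} abc) c∈
            ( ¬⟶⇒⟵ (E₃⇒∈₂ {K = K} abc) (M⊆V y∈) (≢-sym (∈∧∉⇒≢ y∈ b∉))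
                (λ by → asym ab (tM (E₃⇒∈₂ {K = K} abc) b∉ y∈ a∈ by))
            , bc , tM c∈ c∉ a∈ y∈ ca)
      where
      c∈ = E₃⇒∈₃ {K = K} abc
      b∉ : b ∉ M
      b∉ b∈ = asym bc (tM c∈ c∉ a∈ b∈ ca)
    ... | inj₂ (ba , ac , cb) = b∉ , λ y∈ → E₃-swap {K = K} (cyc⇒edge (E₃⇒∈₂ {K = K} abc) (M⊆V y∈) c∈
            ( tM (E₃⇒∈₂ {K = K} abc) b∉ a∈ y∈ ba
            , ¬⟶⇒⟵ c∈ (M⊆V y∈) (≢-sym (∈∧∉⇒≢ y∈ c∉)) (λ cy → asym ac (tM c∈ c∉ y∈ a∈ cy))
            , cb))
      where
      c∈ = E₃⇒∈₃ {K = K} abc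
      b∉ : b ∉ M
      b∉ b∈ = asym ac (tM c∈ c∉ b∈ a∈ cb)

  V-strong : IsStrong K (V K)
  V-strong = module⇒isModule V-module , λ N isN _ → inj₂ (IsModule.M⊆V isN)

  singleton-strong : x ∈ V K → IsStrong K ⁅ x ⁆
  singleton-strong {x} x∈V = module⇒isModule (singleton-module x∈V) , λ N _ (y , y∈) →
    let y∈x , y∈N = x∈p∩q⁻ ⁅ x ⁆ N y∈ in
    inj₁ λ z∈ → subst (_∈ N) (trans (x∈⁅y⁆⇒x≡y x y∈x) (sym (x∈⁅y⁆⇒x≡y x z∈))) y∈N

  -- If v separated X, then S, the set of all vertices separating X, together
  -- with the in-neighbours of v in X would be a module overlapping X.
  strong⇒tModule : IsStrong K M → TModule T (V K) M
  strong⇒tModule {X} (isX , strong) {v} {a} {b} v∈ v∉ a∈ b∈ va =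
    decidable-stable (T ⊢ v ⟶? b) λ ¬vb →
      comparable (strong Y (module⇒isModule Y-module)
        (b , x∈p∩q⁺ (b∈ , x∈p∪q⁺ (inj₁ (∈⟪⟫⁺ X⁻? (b∈ , ¬⟶⇒⟵ v∈ (⊆V mX b∈) (≢-sym (∈∧∉⇒≢ b∈ v∉)) ¬vb))))))
        (¬⟶⇒⟵ v∈ (⊆V mX b∈) (≢-sym (∈∧∉⇒≢ b∈ v∉)) ¬vb)
    where
    mX : Module K X
    mX = isModule⇒module isX
    Separates : Fin n → Set
    Separates s = (s ∈ V K × s ∉ X) × (∃[ p ] p ∈ X × T ⊢ s ⟶ p) × (∃[ q ] q ∈ X × T ⊢ q ⟶ s)
    S? : Decidable Separates
    S? s = (s ∈? V K ×-dec ¬? (s ∈? X)) ×-dec any? (λ p → p ∈? X ×-dec T ⊢ s ⟶? p)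
             ×-dec any? (λ q → q ∈? X ×-dec T ⊢ q ⟶? s)
    X⁻? : Decidable (λ x → x ∈ X × T ⊢ x ⟶ v)
    X⁻? x = x ∈? X ×-dec T ⊢ x ⟶? v
    Y : Subset n
    Y = ⟪ X⁻? ⟫ ∪ ⟪ S? ⟫
    comparable : X ⊆ Y ⊎ Y ⊆ X → ¬ T ⊢ b ⟶ v
    comparable (inj₁ X⊆Y) _ with x∈p∪q⁻ ⟪ X⁻? ⟫ _ (X⊆Y a∈)
    ... | inj₁ a∈X⁻ = asym va (proj₂ (∈⟪⟫⁻ X⁻? a∈X⁻))
    ... | inj₂ a∈S  = proj₂ (proj₁ (∈⟪⟫⁻ S? a∈S)) a∈
    comparable (inj₂ Y⊆X) bv = v∉ (Y⊆X (x∈p∪q⁺ (inj₂ (∈⟪⟫⁺ S? ((v∈ , v∉) , (a , a∈ , va) , (b , b∈ , bv))))))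
    -- For `z` outside `X`, moving the edge to the out-neighbour `p` of `s` forces `z → s`, and
    -- moving it to the in-neighbour `q` forces `s → z`.
    no-edge : ∀ {x s z} → x ∈ X → Separates s → ¬ E₃ K x s z
    no-edge {x} {s} {z} x∈ ((s∈ , s∉) , (p , p∈ , sp) , (q , q∈ , qs)) xsz with z ∈? X
    ... | yes z∈ = single mX (E₃-swap₂₃ {K = K} xsz) x∈ s∉ z∈
    ... | no z∉ with edge⇒dir (replace mX xsz x∈ z∉ p∈) | edge⇒dir (replace mX xsz x∈ z∉ q∈)
    ...   | inj₁ (ps , _)      | _                  = asym sp ps
    ...   | _                  | inj₂ (sq , _)      = asym qs sq
    ...   | inj₂ (_ , _ , zs)  | inj₁ (_ , sz , _)  = asym sz zs
    -- A vertex `w` outside this set has all of `X` on one side. If some separating `s` were on the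
    -- other side, `w`, `s` and a suitable neighbour of `s` in `X` would form a 3-cycle forbidden by
    -- `no-edge`.
    X∪S-tModule : TModule T (V K) (X ∪ ⟪ S? ⟫)
    X∪S-tModule {w} {a′} {b′} w∈ w∉ a′∈ b′∈ wa′ = decide (all? λ x → x ∈? X →-dec T ⊢ w ⟶? x)
      where
      w∉X : w ∉ X
      w∉X = w∉ ∘ x∈p∪q⁺ ∘ inj₁
      ¬S : ∀ {p q} → p ∈ X → q ∈ X → T ⊢ w ⟶ p → ¬ T ⊢ q ⟶ w
      ¬S p∈ q∈ wp qw = w∉ (x∈p∪q⁺ (inj₂ (∈⟪⟫⁺ S? ((w∈ , w∉X) , (-, p∈ , wp) , (-, q∈ , qw)))))
      w≢S : ∀ {s} → Separates s → w ≢ s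
      w≢S sS refl = w∉ (x∈p∪q⁺ (inj₂ (∈⟪⟫⁺ S? sS)))
      decide : Dec (∀ x → x ∈ X → T ⊢ w ⟶ x) → T ⊢ w ⟶ b′
      decide (yes w⟶X) with x∈p∪q⁻ X _ b′∈
      ... | inj₁ b′∈X = w⟶X _ b′∈X
      ... | inj₂ b′∈S with ∈⟪⟫⁻ S? b′∈S
      ...   | sS@((s∈ , _) , _ , (q , q∈ , qs)) = ¬⟶⇒⟵ s∈ w∈ (≢-sym (w≢S sS)) λ sw →
                no-edge q∈ sS (cyc⇒edge (⊆V mX q∈) s∈ w∈ (qs , sw , w⟶X q q∈))
      decide (no ¬w⟶X) with x∈p∪q⁻ X _ a′∈
      ... | inj₁ a′∈X = contradiction
              (λ x x∈ → decidable-stable (T ⊢ w ⟶? x) λ ¬wx →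
                ¬S a′∈X x∈ wa′ (¬⟶⇒⟵ w∈ (⊆V mX x∈) (≢-sym (∈∧∉⇒≢ x∈ w∉X)) ¬wx))
              ¬w⟶X
      ... | inj₂ a′∈S with ∈⟪⟫⁻ S? a′∈S
      ...   | sS@((s∈ , _) , (p , p∈ , sp) , _) = contradiction
              (λ x x∈ → decidable-stable (T ⊢ w ⟶? x) λ ¬wx →
                no-edge p∈ sS (E₃-swap {K = K} (cyc⇒edge s∈ (⊆V mX p∈) w∈
                  (sp , ¬⟶⇒⟵ w∈ (⊆V mX p∈) (≢-sym (∈∧∉⇒≢ p∈ w∉X))
                          (λ wp → ¬S p∈ x∈ wp (¬⟶⇒⟵ w∈ (⊆V mX x∈) (≢-sym (∈∧∉⇒≢ x∈ w∉X)) ¬wx)) , wa′))))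
              ¬w⟶X
    X∪S-module : Module K (X ∪ ⟪ S? ⟫)
    X∪S-module = tModule⇒module
      (λ x∈ → [ ⊆V mX , proj₁ ∘ proj₁ ∘ ∈⟪⟫⁻ S? ]′ (x∈p∪q⁻ X _ x∈)) X∪S-tModule
    Y⊆X∪S : Y ⊆ X ∪ ⟪ S? ⟫
    Y⊆X∪S x∈ = x∈p∪q⁺ (Sum.map (proj₁ ∘ ∈⟪⟫⁻ X⁻?) id (x∈p∪q⁻ ⟪ X⁻? ⟫ _ x∈))
    v⟶ : ∀ {x} → x ∈ X → x ∉ Y → T ⊢ v ⟶ x
    v⟶ x∈ x∉ = ¬⟶⇒⟵ (⊆V mX x∈) v∈ (∈∧∉⇒≢ x∈ v∉) λ xv → x∉ (x∈p∪q⁺ (inj₁ (∈⟪⟫⁺ X⁻? (x∈ , xv))))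
    -- Otherwise `y → x → v → y` would be an edge with exactly two vertices in `X`.
    X⁻⟶X⁺ : ∀ {x y} → x ∈ X → T ⊢ x ⟶ v → y ∈ X → T ⊢ v ⟶ y → T ⊢ x ⟶ y
    X⁻⟶X⁺ {x} {y} x∈ xv y∈ vy = ¬⟶⇒⟵ (⊆V mX y∈) (⊆V mX x∈)
      (λ { refl → asym xv vy })
      λ yx → single mX (cyc⇒edge (⊆V mX y∈) (⊆V mX x∈) v∈ (yx , xv , vy)) y∈ v∉ x∈
    no-edge-in-X : ∀ {x y z} → x ∈ X → T ⊢ x ⟶ v → y ∈ X → T ⊢ v ⟶ y → z ∈ X → ¬ E₃ K x y z
    no-edge-in-X {x} {y} {z} x∈ xv y∈ vy z∈ xyz with edge⇒dir xyz
    ... | inj₂ (yx , _) = asym yx (X⁻⟶X⁺ x∈ xv y∈ vy)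
    ... | inj₁ (_ , yz , zx) with total v∈ (⊆V mX z∈) (≢-sym (∈∧∉⇒≢ z∈ v∉))
    ...   | inj₁ vz = asym zx (X⁻⟶X⁺ x∈ xv z∈ vz)
    ...   | inj₂ zv = asym yz (X⁻⟶X⁺ z∈ zv y∈ vy)
    -- `Y` arises from the module `X ∪ ⟪ S? ⟫` by omitting the out-neighbours of `v` in `X`. So it
    -- remains to see that no edge meets both `Y` and these out-neighbours.
    both : ∀ {a b c} → E₃ K a b c → a ∈ Y → c ∉ Y → b ∉ Y × (∀ {y} → y ∈ Y → E₃ K y b c)
    both {a} {b} {c} abc a∈Y c∉Y with c ∈? X
    ... | no c∉X = single X∪S-module abc (Y⊆X∪S a∈Y) c∉ ∘ Y⊆X∪S
                 , replace X∪S-module abc (Y⊆X∪S a∈Y) c∉ ∘ Y⊆X∪S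
      where
      c∉ : c ∉ X ∪ ⟪ S? ⟫
      c∉ c∈ = [ c∉X , c∉Y ∘ x∈p∪q⁺ ∘ inj₂ ]′ (x∈p∪q⁻ X _ c∈)
    ... | yes c∈X with x∈p∪q⁻ ⟪ X⁻? ⟫ _ a∈Y
    ...   | inj₂ a∈S = contradiction (E₃-rot {K = K} (E₃-rot {K = K} abc)) (no-edge c∈X (∈⟪⟫⁻ S? a∈S))
    ...   | inj₁ a∈X⁻ with ∈⟪⟫⁻ X⁻? a∈X⁻ | b ∈? X
    ...     | a∈X , av | no b∉X  = contradiction c∈X (single mX (E₃-swap₂₃ {K = K} abc) a∈X b∉X)
    ...     | a∈X , av | yes b∈X = contradiction (E₃-swap₂₃ {K = K} abc)
                (no-edge-in-X a∈X av c∈X (v⟶ c∈X c∉Y) b∈X)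
    Y-module : Module K Y
    Y-module = record
      { ⊆V      = ⊆V X∪S-module ∘ Y⊆X∪S
      ; single  = λ abc a∈ c∉ → proj₁ (both abc a∈ c∉)
      ; replace = λ abc a∈ c∉ → proj₂ (both abc a∈ c∉)
      }

  strong⊆block : IsStrong K N → N ≢ V K → ∃[ M ] N ⊆ M × IsMaximalProperStrong K M
  strong⊆block sN N≢V with maximal (λ M → isStrong? K M ×-dec ¬? (M ≟ˢ V K)) (sN , N≢V)
  ... | M , N⊆M , PM , max = M , N⊆M , PM , max

  block-unique : IsMaximalProperStrong K M → IsMaximalProperStrong K N → x ∈ M → x ∈ N → M ≡ N
  block-unique (sM@((_ , strong) , _) , maxM) (sN@((isN , _) , _) , maxN) x∈M x∈N
    with strong _ isN (_ , x∈p∩q⁺ (x∈M , x∈N))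
  ... | inj₁ M⊆N = maxM _ sN M⊆N
  ... | inj₂ N⊆M = sym (maxN _ sM N⊆M)

  block∋ : 2 ≤ ∣ V K ∣ → x ∈ V K → ∃[ M ] x ∈ M × IsMaximalProperStrong K M
  block∋ {x} 2≤ x∈ with strong⊆block (singleton-strong x∈) ≢V
    where
    ≢V : ⁅ x ⁆ ≢ V K
    ≢V eq with subst (2 ≤_) (trans (cong ∣_∣ (sym eq)) (∣⁅x⁆∣≡1 x)) 2≤
    ... | s≤s ()
  ... | M , x⊆M , blk = M , x⊆M (x∈⁅x⁆ x) , blk

  block-module : IsMaximalProperStrong K M → Module K M
  block-module = isModule⇒module ∘ proj₁ ∘ proj₁ ∘ proj₁

  -- The connected component `C` of `a` is a strong module. If `K` were disconnected, `C` would be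
  -- proper and so lie in a single block, which would contain both `a` and `b`.
  crossing⇒connected : E₃ K a b c → (∀ M → IsMaximalProperStrong K M → a ∈ M → b ∉ M) → Connected K
  crossing⇒connected {a} {b} {c} abc cross {Z} {x} x∈Z Z⊆V closed-Z = decidable-stable (Z ≟ˢ V K) λ Z≢V →
    let M , C⊆M , blk = strong⊆block C-strong (C≢V Z≢V)
    in  cross M blk (C⊆M a∈C) (C⊆M (closed-C abc a∈C))
    where
    Closed : Subset n → Set
    Closed Z = ∀ a b c → E₃ K a b c → a ∈ Z → b ∈ Z
    P : Subset n → Set
    P Z = a ∈ Z × Z ⊆ V K × Closed Z
    P? : Decidable P
    P? Z = a ∈? Z ×-dec Z ⊆? V K ×-dec all? λ a → all? λ b → all? λ c → E? K (tri a b c) →-dec a ∈? Z →-dec b ∈? Z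
    component = minimal P? {V K} (E₃⇒∈₁ {K = K} abc , id , λ _ _ _ abc _ → E₃⇒∈₂ {K = K} abc)
    C : Subset n
    C = proj₁ component
    a∈C = proj₁ (proj₁ (proj₂ (proj₂ component)))
    C⊆V = proj₁ (proj₂ component)
    closed-C : ∀ {a b c} → E₃ K a b c → a ∈ C → b ∈ C
    closed-C = proj₂ (proj₂ (proj₁ (proj₂ (proj₂ component)))) _ _ _
    C-min : ∀ Z → P Z → Z ⊆ C → C ⊆ Z
    C-min = proj₂ (proj₂ (proj₂ component))
    -- Both `Z` and its complement are closed under edges; whichever contains `a` would contain all
    -- of `C`.
    C≢V : Z ≢ V K → C ≢ V K
    C≢V Z≢V C≡V with a ∈? Z
    ... | yes a∈Z = Z≢V (⊆-antisym Z⊆V (subst (_⊆ Z) C≡V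
          (C-min Z (a∈Z , Z⊆V , λ _ _ _ → closed-Z) (subst (Z ⊆_) (sym C≡V) Z⊆V))))
    ... | no a∉Z = proj₂ (∈─⁻ (C-min (V K ─ Z)
          ( x∈p∧x∉q⇒x∈p─q (E₃⇒∈₁ {K = K} abc) a∉Z , p─q⊆p _ _
          , λ _ _ _ abc a∈ → x∈p∧x∉q⇒x∈p─q (E₃⇒∈₂ {K = K} abc)
              λ b∈Z → proj₂ (∈─⁻ a∈) (closed-Z (E₃-swap {K = K} abc) b∈Z))
          (subst (V K ─ Z ⊆_) (sym C≡V) (p─q⊆p _ _)) (subst (x ∈_) (sym C≡V) (Z⊆V x∈Z)))) x∈Z
    C-module : Module K C
    C-module = record
      { ⊆V = C⊆V
      ; single  = λ abc a∈ c∉ → contradiction (closed-C (E₃-swap₂₃ {K = K} abc) a∈) c∉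
      ; replace = λ abc a∈ c∉ → contradiction (closed-C (E₃-swap₂₃ {K = K} abc) a∈) c∉
      }
    C-strong : IsStrong K C
    C-strong = module⇒isModule C-module , comparable
      where
      comparable : ∀ N → IsModule K N → Nonempty (C ∩ N) → C ⊆ N ⊎ N ⊆ C
      comparable N isN (p , p∈) with N ⊆? C
      ... | yes N⊆C = inj₂ N⊆C
      ... | no N⊈C with ⊈⇒∃∉ N⊈C
      ...   | m , m∈N , m∉C = inj₁ C⊆N
        where
        -- An edge inside `C` that leaves `N` could be moved to `m`, and the moved edge would leave
        -- `C`. So no edge joins `C ∩ N` to `C ─ N`, and minimality of `C` makes one of them empty.
        closed : ∀ {a b c} → E₃ K a b c → a ∈ C → a ∈ N → b ∈ N
        closed {b = b} abc a∈C a∈N = decidable-stable (b ∈? N) λ b∉N →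
          let acb = E₃-swap₂₃ {K = K} abc in
          m∉C (closed-C (E₃-swap {K = K} (replace (isModule⇒module isN) acb a∈N b∉N m∈N)) (closed-C acb a∈C))
        C⊆N : C ⊆ N
        C⊆N with a ∈? N
        ... | yes a∈N = proj₂ ∘ x∈p∩q⁻ C N ∘ C-min (C ∩ N)
                ( x∈p∩q⁺ (a∈C , a∈N) , C⊆V ∘ p∩q⊆p C N
                , λ _ _ _ abc a∈ → let a∈C , a∈N = x∈p∩q⁻ C N a∈ in
                    x∈p∩q⁺ (closed-C abc a∈C , closed abc a∈C a∈N))
                (p∩q⊆p C N)
        ... | no a∉N = contradiction (proj₂ (x∈p∩q⁻ C N p∈)) (proj₂ (∈─⁻ (C-min (C ─ N)
                ( x∈p∧x∉q⇒x∈p─q a∈C a∉N , C⊆V ∘ p─q⊆p C N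
                , λ _ _ _ abc a∈ → let a∈C , a∉N = ∈─⁻ a∈ ; b∈C = closed-C abc a∈C in
                    x∈p∧x∉q⇒x∈p─q b∈C λ b∈N → a∉N (closed (E₃-swap {K = K} abc) b∈C b∈N))
                (p─q⊆p C N) (proj₁ (x∈p∩q⁻ C N p∈)))))

  -- A maximal proper module `M` containing `N` is strong: a module `L` overlapping `M` would make
  -- `M ∪ L` the whole vertex set, and then no edge could leave `M`, against connectedness.
  connected⇒module⊆block : Connected K → Module K N → x ∈ N → N ≢ V K →
                           ∃[ M ] N ⊆ M × IsMaximalProperStrong K M
  connected⇒module⊆block {N} {x} conn mN x∈N N≢V
    with maximal (λ M → isModule? K M ×-dec ¬? (M ≟ˢ V K)) (module⇒isModule mN , N≢V)
  ... | M , N⊆M , (isM , M≢V) , max =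
    let B , M⊆B , blk = strong⊆block (isM , comparable) M≢V in B , M⊆B ∘ N⊆M , blk
    where
    mM : Module K M
    mM = isModule⇒module isM
    comparable : ∀ L → IsModule K L → Nonempty (M ∩ L) → M ⊆ L ⊎ L ⊆ M
    comparable L isL (y , y∈) with M ⊆? L | (M ∪ L) ≟ˢ V K
    ... | yes M⊆L | _ = inj₁ M⊆L
    ... | no _ | no M∪L≢V = inj₂ λ z∈L → subst (_ ∈_)
          (sym (max (M ∪ L) (module⇒isModule (∪-module mM mL y∈M y∈L) , M∪L≢V) (p⊆p∪q L))) (q⊆p∪q M L z∈L)
      where
      mL = isModule⇒module isL
      y∈M = proj₁ (x∈p∩q⁻ M L y∈)
      y∈L = proj₂ (x∈p∩q⁻ M L y∈)
    ... | no M⊈L | yes M∪L≡V with ⊈⇒∃∉ M⊈L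
    ...   | d , d∈M , d∉L = contradiction (conn (N⊆M x∈N) (⊆V mM) closed) M≢V
      where
      mL = isModule⇒module isL
      ∉M⇒∈L : ∀ {z} → z ∈ V K → z ∉ M → z ∈ L
      ∉M⇒∈L z∈ z∉M = [ (λ z∈M → contradiction z∈M z∉M) , id ]′ (x∈p∪q⁻ M L (subst (_ ∈_) (sym M∪L≡V) z∈))
      -- An edge leaving `M` has its two other vertices outside `M`, hence in `L`. Moved to `d`,
      -- which is outside `L`, it would meet `L` in exactly two vertices.
      closed : ∀ {a b c} → E₃ K a b c → a ∈ M → b ∈ M
      closed {a} {b} {c} abc a∈M = decidable-stable (b ∈? M) λ b∉M →
        let acb = E₃-swap₂₃ {K = K} abc
            c∉M = single mM acb a∈M b∉M
            dcb = replace mM acb a∈M b∉M d∈M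
            c∈L = ∉M⇒∈L (E₃⇒∈₃ {K = K} abc) c∉M
            b∈L = ∉M⇒∈L (E₃⇒∈₂ {K = K} abc) b∉M
        in  single mL (E₃-rot {K = K} dcb) c∈L d∉L b∈L

-- Strong modules inside a strong module

module _ {n} {T : Arcs n} {H : Hypergraph n} (r : Realizes T H) where

  open Realized

  private
    rZ : ∀ {Z} → Z ⊆ V H → Realizes T (H [ Z ])
    rZ = realizes-restrict r

  -- A module `L` of `H` that meets `N` also meets the strong module `Z`. It either contains `Z`,
  -- and with it `N`, or is a module of `H [ Z ]`.
  strong-sub⁺ : ∀ {Z} → IsStrong H Z → IsStrong (H [ Z ]) N → IsStrong H N
  strong-sub⁺ {N} {Z} (isZ , sZ) (isN , sN) =
    module⇒isModule r (module-sub⁺ mZ (isModule⇒module (rZ (⊆V mZ)) isN)) , comparable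
    where
    mZ = isModule⇒module r isZ
    N⊆Z = IsModule.M⊆V isN
    comparable : ∀ L → IsModule H L → Nonempty (N ∩ L) → N ⊆ L ⊎ L ⊆ N
    comparable L isL (y , y∈) with x∈p∩q⁻ N L y∈
    ... | y∈N , y∈L with sZ L isL (y , x∈p∩q⁺ (N⊆Z y∈N , y∈L))
    ...   | inj₁ Z⊆L = inj₁ (Z⊆L ∘ N⊆Z)
    ...   | inj₂ L⊆Z = sN L (module⇒isModule (rZ (⊆V mZ)) (module-sub⁻ (isModule⇒module r isL) L⊆Z)) (y , y∈)

  strong-sub⁻ : ∀ {Z} → IsStrong H Z → IsStrong H N → N ⊆ Z → IsStrong (H [ Z ]) N
  strong-sub⁻ {N} {Z} (isZ , _) (isN , sN) N⊆Z =
      module⇒isModule (rZ (⊆V mZ)) (module-sub⁻ (isModule⇒module r isN) N⊆Z)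
    , λ L isL → sN L (module⇒isModule r (module-sub⁺ mZ (isModule⇒module (rZ (⊆V mZ)) isL)))
    where
    mZ = isModule⇒module r isZ

-- Two-coloured tournaments

Rel : ℕ → Set₁
Rel n = Fin n → Fin n → Set

-- Strong connectivity expressed by cuts instead of paths: a nonempty part that no arc enters is
-- everything.
Strong : Rel n → Subset n → Set
Strong {n} _⟶_ W = ∀ Z → Z ⊆ W → Nonempty Z → (∀ y z → y ∈ W → y ∉ Z → z ∈ Z → ¬ y ⟶ z) → W ⊆ Z

strong-op : {_⟶_ : Rel n} → Strong _⟶_ W → Strong (flip _⟶_) W
strong-op {W = W} s Z Z⊆W (x , x∈Z) closed {w} w∈W = decidable-stable (w ∈? Z) λ w∉Z →
  proj₂ (∈─⁻ (s (W ─ Z) (p─q⊆p W Z) (w , x∈p∧x∉q⇒x∈p─q w∈W w∉Z)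
    (λ y z y∈W y∉ z∈ yz → closed z y (proj₁ (∈─⁻ z∈)) (proj₂ (∈─⁻ z∈))
       (decidable-stable (y ∈? Z) λ y∉Z → y∉ (x∈p∧x∉q⇒x∈p─q y∈W y∉Z)) yz)
    (Z⊆W x∈Z))) x∈Z

-- All pairs between Z and its complement in W are in A.
Join : Rel n → Subset n → Subset n → Set
Join A W Z = ∀ a b → a ∈ Z → b ∈ W → b ∉ Z → A a b

Split : Rel n → Subset n → Set
Split A W = ∃[ Z ] Z ⊆ W × Nonempty Z × Nonempty (W ─ Z) × Join A W Z

-- Below, A and D hold of the pairs on which two realizations agree and differ.
record Colouring (W : Subset n) (_⟶_ A D : Rel n) : Set where
  field
    _⟶?_  : ∀ a b → Dec (a ⟶ b)
    A?     : ∀ a b → Dec (A a b)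
    D?     : ∀ a b → Dec (D a b)
    asym   : a ⟶ b → ¬ b ⟶ a
    total  : a ∈ W → b ∈ W → a ≢ b → a ⟶ b ⊎ b ⟶ a
    A-sym  : A a b → A b a
    D-sym  : D a b → D b a
    cover  : a ∈ W → b ∈ W → a ≢ b → A a b ⊎ D a b
    excl   : A a b → ¬ D a b
    A-path : a ∈ W → b ∈ W → c ∈ W → A a b → A b c → a ⟶ b → b ⟶ c → A a c
    D-path : a ∈ W → b ∈ W → c ∈ W → D a b → D b c → a ⟶ b → b ⟶ c → D a c

-- C is a component, rooted at x, of the complement of A on W.
record Component (A : Rel n) (W : Subset n) (x : Fin n) (C : Subset n) : Set where
  field
    C⊆W         : C ⊆ W
    root        : x ∈ C
    join        : Join A W C
    indivisible : ∀ Z → Join A C Z → y ∈ C → y ∈ Z → C ⊆ Z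

module _ {_⟶_ A D : Rel n} where

  colouring-⊆ : U ⊆ W → Colouring W _⟶_ A D → Colouring U _⟶_ A D
  colouring-⊆ U⊆W col = record
    { _⟶?_  = _⟶?_
    ; A?     = A?
    ; D?     = D?
    ; asym   = asym
    ; total  = λ a∈ b∈ → total (U⊆W a∈) (U⊆W b∈)
    ; A-sym  = A-sym
    ; D-sym  = D-sym
    ; cover  = λ a∈ b∈ → cover (U⊆W a∈) (U⊆W b∈)
    ; excl   = excl
    ; A-path = λ a∈ b∈ c∈ → A-path (U⊆W a∈) (U⊆W b∈) (U⊆W c∈)
    ; D-path = λ a∈ b∈ c∈ → D-path (U⊆W a∈) (U⊆W b∈) (U⊆W c∈)
    }
    where open Colouring col

  colouring-op : Colouring W _⟶_ A D → Colouring W (flip _⟶_) A D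
  colouring-op col = record
    { _⟶?_  = flip _⟶?_
    ; A?     = A?
    ; D?     = D?
    ; asym   = asym
    ; total  = λ a∈ b∈ a≢b → swap (total a∈ b∈ a≢b)
    ; A-sym  = A-sym
    ; D-sym  = D-sym
    ; cover  = cover
    ; excl   = excl
    ; A-path = λ a∈ b∈ c∈ ab bc ba cb → A-sym (A-path c∈ b∈ a∈ (A-sym bc) (A-sym ab) cb ba)
    ; D-path = λ a∈ b∈ c∈ ab bc ba cb → D-sym (D-path c∈ b∈ a∈ (D-sym bc) (D-sym ab) cb ba)
    }
    where open Colouring col

  colouring-swap : Colouring W _⟶_ A D → Colouring W _⟶_ D A
  colouring-swap col = record
    { _⟶?_  = _⟶?_
    ; A?     = D?
    ; D?     = A?
    ; asym   = asym
    ; total  = total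
    ; A-sym  = D-sym
    ; D-sym  = A-sym
    ; cover  = λ a∈ b∈ a≢b → swap (cover a∈ b∈ a≢b)
    ; excl   = λ ab ba → excl ba ab
    ; A-path = D-path
    ; D-path = A-path
    }
    where open Colouring col

  join-∁ : Colouring W _⟶_ A D → ∀ {Z} → Join A W Z → Join A W (W ─ Z)
  join-∁ {W} col {Z} join a b a∈ b∈W b∉ =
    Colouring.A-sym col (join b a (decidable-stable (b ∈? Z) λ b∉Z → b∉ (x∈p∧x∉q⇒x∈p─q b∈W b∉Z))
      (proj₁ (∈─⁻ a∈)) (proj₂ (∈─⁻ a∈)))

  module _ (col : Colouring W _⟶_ A D) where
    open Colouring col

    component : x ∈ W → ∃[ C ] Component A W x C
    component {x} x∈ with minimal P? (id , x∈ , λ a b _ b∈ b∉ → contradiction b∈ b∉)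
      where
      P : Subset n → Set
      P Z = Z ⊆ W × x ∈ Z × Join A W Z
      P? : Decidable P
      P? Z = Z ⊆? W ×-dec x ∈? Z ×-dec all? λ a → all? λ b → a ∈? Z →-dec b ∈? W →-dec ¬? (b ∈? Z) →-dec A? a b
    ... | C , _ , (C⊆W , x∈C , join) , min = C , record
      { C⊆W = C⊆W ; root = x∈C ; join = join ; indivisible = indivisible }
      where
      indivisible : ∀ {y} Z → Join A C Z → y ∈ C → y ∈ Z → C ⊆ Z
      indivisible {y} Z joinZ y∈C y∈Z with x ∈? Z
      ... | yes x∈Z = proj₂ ∘ x∈p∩q⁻ C Z ∘ min (C ∩ Z) (C⊆W ∘ p∩q⊆p C Z , x∈p∩q⁺ (x∈C , x∈Z) , j) (p∩q⊆p C Z)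
        where
        j : Join A W (C ∩ Z)
        j a b a∈ b∈W b∉ with x∈p∩q⁻ C Z a∈ | b ∈? C
        ... | a∈C , a∈Z | yes b∈C = joinZ a b a∈Z b∈C λ b∈Z → b∉ (x∈p∩q⁺ (b∈C , b∈Z))
        ... | a∈C , a∈Z | no b∉C  = join a b a∈C b∈W b∉C
      ... | no x∉Z = contradiction y∈Z (proj₂ (∈─⁻ (min (C ─ Z)
              (C⊆W ∘ p─q⊆p C Z , x∈p∧x∉q⇒x∈p─q x∈C x∉Z , j) (p─q⊆p C Z) y∈C)))
        where
        j : Join A W (C ─ Z)
        j a b a∈ b∈W b∉ with ∈─⁻ a∈ | b ∈? C
        ... | a∈C , a∉Z | yes b∈C = A-sym (joinZ b a (decidable-stable (b ∈? Z) λ b∉Z →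
                                      b∉ (x∈p∧x∉q⇒x∈p─q b∈C b∉Z)) a∈C a∉Z)
        ... | a∈C , a∉Z | no b∉C  = join a b a∈C b∈W b∉C

    -- If `b → v → a` with `a` and `b` in `C`, both pairs with `v` are in `A`, so the path rule puts
    -- `ab` in `A`. The out-neighbours of `v` in `C` are thus joined in `A` to the rest of `C`,
    -- which is indivisible.
    component-module : ∀ {C} → Component A W x C → v ∈ W → v ∉ C → a ∈ C → b ∈ C → v ⟶ a → v ⟶ b
    component-module {v = v} {C = C} comp v∈ v∉ a∈ b∈ va =
      proj₂ (∈⟪⟫⁻ Z? (indivisible ⟪ Z? ⟫ join-Z a∈ (∈⟪⟫⁺ Z? (a∈ , va)) b∈))
      where
      open Component comp
      Z? : Decidable (λ u → u ∈ C × v ⟶ u)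
      Z? u = u ∈? C ×-dec v ⟶? u
      join-Z : Join A C ⟪ Z? ⟫
      join-Z a b a∈Z b∈C b∉Z with ∈⟪⟫⁻ Z? a∈Z
      ... | a∈C , va with total v∈ (C⊆W b∈C) (≢-sym (∈∧∉⇒≢ b∈C v∉))
      ...   | inj₁ vb = contradiction (∈⟪⟫⁺ Z? (b∈C , vb)) b∉Z
      ...   | inj₂ bv = A-sym (A-path (C⊆W b∈C) v∈ (C⊆W a∈C) (join b v b∈C v∈ v∉) (A-sym (join a v a∈C v∈ v∉)) bv va)

  module _ (col : Colouring W _⟶_ A D) where
    open Colouring col

    split? : Dec (Split A W)
    split? = anySubset? λ Z → Z ⊆? W ×-dec nonempty? Z ×-dec nonempty? (W ─ Z)
      ×-dec all? λ a → all? λ b → a ∈? Z →-dec b ∈? W →-dec ¬? (b ∈? Z) →-dec A? a b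

module _ {_⟶_ A D : Rel n} {W U : Subset n} where

  module Core (col : Colouring W _⟶_ A D) (strongW : Strong _⟶_ W) (strongU : Strong _⟶_ U)
              (U⊆W : U ⊆ W) (v∈ : v ∈ W) (v∉ : v ∉ U) (W⊆ : ∀ {w} → w ∈ W → w ≢ v → w ∈ U)
              (nbr : ∀ {C x} → x ∈ C → C ⊆ U → Join A U C → ∃[ d ] d ∈ C × D v d)
              {Z : Subset n} (joinZ : Join A U Z) where
    open Colouring col
    colU = colouring-⊆ U⊆W col

    -- A path `p → v → q` in `D` between different sides of `Z` would put `pq` in `D`. So, like `c`,
    -- all `D`-neighbours of `v` are out-neighbours, and an in-neighbour `s` of `v` is an
    -- `A`-neighbour. No arc enters the component of `s` in `U`, so it is all of `U`, although `U`
    -- splits along `Z`.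
    contra : ∀ {c c′} → c ∈ U → c ∈ Z → D v c → c′ ∈ U → c′ ∉ Z → D v c′ → ¬ v ⟶ c
    contra {c} {c′} c∈ c∈Z vc c′∈ c′∉Z vc′ v⟶c =
      finish (component colU s∈)
      where
      same : ∀ {p q} → p ∈ U → p ∈ Z → q ∈ U → q ∉ Z → D v p → D v q → (v ⟶ p → v ⟶ q) × (v ⟶ q → v ⟶ p)
      same p∈ p∈Z q∈ q∉Z vp vq
        with total v∈ (U⊆W p∈) (≢-sym (∈∧∉⇒≢ p∈ v∉)) | total v∈ (U⊆W q∈) (≢-sym (∈∧∉⇒≢ q∈ v∉))
      ... | inj₁ v⟶p | inj₁ v⟶q = (λ _ → v⟶q) , (λ _ → v⟶p)
      ... | inj₁ v⟶p | inj₂ q⟶v = contradiction (D-path (U⊆W q∈) v∈ (U⊆W p∈) (D-sym vq) vp q⟶v v⟶p)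
                                      (excl (A-sym (joinZ _ _ p∈Z q∈ q∉Z)))
      ... | inj₂ p⟶v | inj₁ v⟶q = contradiction (D-path (U⊆W p∈) v∈ (U⊆W q∈) (D-sym vp) vq p⟶v v⟶q)
                                      (excl (joinZ _ _ p∈Z q∈ q∉Z))
      ... | inj₂ p⟶v | inj₂ q⟶v = (λ v⟶p → contradiction p⟶v (asym v⟶p)) , (λ v⟶q → contradiction q⟶v (asym v⟶q))
      v⟶c′ : v ⟶ c′
      v⟶c′ = proj₁ (same c∈ c∈Z c′∈ c′∉Z vc vc′) v⟶c
      v⟶D : ∀ {d} → d ∈ U → D v d → v ⟶ d
      v⟶D {d} d∈ vd with d ∈? Z
      ... | yes d∈Z = proj₂ (same d∈ d∈Z c′∈ c′∉Z vd vc′) v⟶c′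
      ... | no d∉Z  = proj₁ (same c∈ c∈Z d∈ d∉Z vc vd) v⟶c
      in-arc : ∃[ s ] s ∈ W × s ⟶ v
      in-arc with any? (λ s → s ∈? W ×-dec s ⟶? v)
      ... | yes p = p
      ... | no ∄ = contradiction (x∈⁅y⁆⇒x≡y v (strongW ⁅ v ⁆ (λ y∈ → subst (_∈ W) (sym (x∈⁅y⁆⇒x≡y v y∈)) v∈)
              (v , x∈⁅x⁆ v) (λ y z y∈ _ z∈ yz → ∄ (y , y∈ , subst (y ⟶_) (x∈⁅y⁆⇒x≡y v z∈) yz)) (U⊆W c∈)))
              (∈∧∉⇒≢ c∈ v∉)
      s : Fin n
      s = proj₁ in-arc
      s⟶v : s ⟶ v
      s⟶v = proj₂ (proj₂ in-arc)
      s∈ : s ∈ U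
      s∈ = W⊆ (proj₁ (proj₂ in-arc)) λ { s≡v → asym (subst (_⟶ v) s≡v s⟶v) (subst (_⟶ v) s≡v s⟶v) }
      sv : A s v
      sv with cover (U⊆W s∈) v∈ (∈∧∉⇒≢ s∈ v∉)
      ... | inj₁ sv = sv
      ... | inj₂ sv = contradiction s⟶v (asym (v⟶D s∈ (D-sym sv)))
      finish : ¬ (∃[ C ] Component A U s C)
      finish (C , comp) = c′∉Z (C⊆Z (U⊆C c′∈))
        where
        open Component comp
        -- The component of `y` contains a `D`-neighbour `d` of `v`. If `d → s`, the path
        -- `d → s → v` in `A` would put `dv` in `A`. Hence `s → d`, and this spreads to `y` because
        -- components are modules.
        s⟶ : ∀ {y} → y ∈ U → y ∉ C → s ⟶ y
        s⟶ {y} y∈ y∉ with component colU y∈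
        ... | C′ , comp′ with nbr (Component.root comp′) (Component.C⊆W comp′) (Component.join comp′)
        ...   | d , d∈C′ , vd = component-module colU comp′ s∈ a∉C′ d∈C′ (Component.root comp′) s⟶d
          where
          disjoint : ∀ {z} → z ∈ C′ → z ∉ C
          disjoint z∈C′ z∈C = y∉ (Component.indivisible comp′ C
            (λ p q p∈ q∈ → join p q p∈ (Component.C⊆W comp′ q∈)) z∈C′ z∈C (Component.root comp′))
          a∉C′ : s ∉ C′
          a∉C′ s∈C′ = disjoint s∈C′ root
          d∈ = Component.C⊆W comp′ d∈C′
          s⟶d : s ⟶ d
          s⟶d with total (U⊆W s∈) (U⊆W d∈) (≢-sym (∈∧∉⇒≢ d∈C′ a∉C′))
          ... | inj₁ s⟶d = s⟶d
          ... | inj₂ d⟶a = contradiction (D-sym vd) (excl (A-path (U⊆W d∈) (U⊆W s∈) v∈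
                  (A-sym (join s d root d∈ (disjoint d∈C′))) sv d⟶a s⟶v))
        U⊆C : U ⊆ C
        U⊆C = strongU C C⊆W (s , root) λ y z y∈ y∉ z∈ y⟶z →
          asym (s⟶ y∈ y∉) (component-module colU comp y∈ y∉ z∈ root y⟶z)
        C⊆Z : C ⊆ Z
        C⊆Z = indivisible Z (λ p q p∈ q∈ → joinZ p q p∈ (C⊆W q∈)) (U⊆C c∈) c∈Z

module _ {_⟶_ A D : Rel n} {W U : Subset n} where

  split-extend : Colouring W _⟶_ A D → Strong _⟶_ W → Strong _⟶_ U → U ⊆ W → v ∈ W → v ∉ U →
                 (∀ {w} → w ∈ W → w ≢ v → w ∈ U) → Split A U → Split A W
  split-extend {v} col sW sU U⊆W v∈ v∉ W⊆ (Z , Z⊆U , (z , z∈Z) , (z′ , z′∈) , joinZ) =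
    decidable-stable (split? col) λ ¬split →
    -- A part joined in `A` to the rest of `U` and without a `D`-neighbour of `v` would be joined in
    -- `A` to `v` too, and so would split `W`.
    let nbr : ∀ {C x} → x ∈ C → C ⊆ U → Join A U C → ∃[ d ] d ∈ C × D v d
        nbr = λ {C} {x} x∈C C⊆U joinC → decidable-stable (any? λ d → d ∈? C ×-dec D? v d) λ ∄ →
          ¬split (C , U⊆W ∘ C⊆U , (x , x∈C) , (v , x∈p∧x∉q⇒x∈p─q v∈ (v∉ ∘ C⊆U)) , λ a b a∈ b∈ b∉ →
            [ id , (λ ab → contradiction ab (¬D C⊆U joinC ∄ a∈ b∈ b∉)) ]′
              (cover (U⊆W (C⊆U a∈)) b∈ (∈∧∉⇒≢ a∈ b∉)))
        c  , c∈Z  , vc  = nbr z∈Z Z⊆U joinZ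
        c′ , c′∈  , vc′ = nbr z′∈ (p─q⊆p U Z) (join-∁ (colouring-⊆ U⊆W col) joinZ)
        c∈ = Z⊆U c∈Z
        c′∈U , c′∉Z = ∈─⁻ c′∈
    -- The case `c → v` is the case `v → c` in the reversed tournament, where the colours obey the
    -- same path rules.
    in [ Core.contra {_⟶_ = _⟶_} col sW sU U⊆W v∈ v∉ W⊆ nbr joinZ c∈ c∈Z vc c′∈U c′∉Z vc′
       , Core.contra {_⟶_ = flip _⟶_} (colouring-op col) (strong-op sW) (strong-op sU) U⊆W v∈ v∉ W⊆ nbr joinZ c∈ c∈Z vc c′∈U c′∉Z vc′
       ]′ (total v∈ (U⊆W c∈) (≢-sym (∈∧∉⇒≢ c∈ v∉)))
    where
    open Colouring col
    ¬D : ∀ {C} → C ⊆ U → Join A U C → ¬ (∃[ d ] d ∈ C × D v d) → a ∈ C → b ∈ W → b ∉ C → ¬ D a b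
    ¬D {a = a} {b = b} C⊆U joinC ∄ a∈ b∈ b∉ ab with b ≟ᶠ v
    ... | yes refl = ∄ (a , a∈ , D-sym ab)
    ... | no b≢v = excl (joinC a b a∈ (W⊆ b∈ b≢v) b∉) ab

star-split : {A : Rel n} → (∀ {w} → w ∈ W → w ≢ x → A x w) → x ∈ W → y ∈ W → x ≢ y → Split A W
star-split {W = W} {x} {y} {A} star x∈ y∈ x≢y =
    ⁅ x ⁆ , (λ z∈ → subst (_∈ W) (sym (x∈⁅y⁆⇒x≡y x z∈)) x∈) , (x , x∈⁅x⁆ x)
  , (y , x∈p∧x∉q⇒x∈p─q y∈ λ y∈x → x≢y (sym (x∈⁅y⁆⇒x≡y x y∈x)))
  , λ a b a∈ b∈ b∉ → subst (λ a → A a b) (sym (x∈⁅y⁆⇒x≡y x a∈)) (star b∈ λ { refl → b∉ (x∈⁅x⁆ x) })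

module _ {_⟶_ : Rel n} where

  strong-⁅⁆ : Strong _⟶_ ⁅ x ⁆
  strong-⁅⁆ {x} Z Z⊆ (z , z∈) _ w∈
    with refl ← x∈⁅y⁆⇒x≡y x w∈ | refl ← x∈⁅y⁆⇒x≡y x (Z⊆ z∈) = z∈

  module _ {S : Subset n} (sS : Strong _⟶_ S) where

    strong-insert : v ∉ S → x ∈ S → y ∈ S → x ⟶ v → v ⟶ y → Strong _⟶_ (S ∪ ⁅ v ⁆)
    strong-insert {v} {x} {y} v∉ x∈ y∈ xv vy Z Z⊆ (z , z∈) closed w∈ =
      [ S⊆Z x∈Z , (λ w∈v → subst (_∈ Z) (sym (x∈⁅y⁆⇒x≡y v w∈v)) v∈Z) ]′ (x∈p∪q⁻ S _ w∈)
      where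
      S⊆Z : ∀ {z} → z ∈ Z × z ∈ S → S ⊆ Z
      S⊆Z (z∈Z , z∈S) = proj₁ ∘ x∈p∩q⁻ Z S ∘ sS (Z ∩ S) (p∩q⊆q Z S) (-, x∈p∩q⁺ (z∈Z , z∈S))
        λ a b a∈S a∉ b∈ → closed a b (x∈p∪q⁺ (inj₁ a∈S)) (λ a∈Z → a∉ (x∈p∩q⁺ (a∈Z , a∈S))) (proj₁ (x∈p∩q⁻ Z S b∈))
      x∈Z : x ∈ Z × x ∈ S
      x∈Z with x∈p∪q⁻ S _ (Z⊆ z∈)
      ... | inj₁ z∈S = S⊆Z (z∈ , z∈S) x∈ , x∈
      ... | inj₂ z∈v with refl ← x∈⁅y⁆⇒x≡y v z∈v =
            decidable-stable (x ∈? Z) (λ x∉Z → closed x v (x∈p∪q⁺ (inj₁ x∈)) x∉Z z∈ xv) , x∈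
      v∈Z : v ∈ Z
      v∈Z = decidable-stable (v ∈? Z) λ v∉Z →
        closed v y (x∈p∪q⁺ (inj₂ (x∈⁅x⁆ v))) v∉Z (S⊆Z x∈Z y∈) vy

  -- Here S need not be strong: every vertex of S lies on a 3-cycle through p and q.
  strong-3cycles : ∀ {p q : Fin n} {S W} → x ∈ S → q ⟶ p → (∀ {s} → s ∈ S → p ⟶ s × s ⟶ q) →
                   S ⊆ W → p ∈ W → q ∈ W → (∀ {w} → w ∈ W → w ∈ S ⊎ w ≡ p ⊎ w ≡ q) → Strong _⟶_ W
  strong-3cycles {x} {p} {q} {S} {W} x∈ qp ps S⊆W p∈ q∈ W⊆ Z Z⊆ (z , z∈) closed w∈ =
    [ S⊆Z , [ (λ { refl → p∈Z }) , (λ { refl → q∈Z }) ]′ ]′ (W⊆ w∈)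
    where
    into : ∀ {a b} → a ∈ W → b ∈ Z → a ⟶ b → a ∈ Z
    into {a} {b} a∈ b∈ ab = decidable-stable (a ∈? Z) λ a∉ → closed a b a∈ a∉ b∈ ab
    q∈Z : q ∈ Z
    q∈Z with W⊆ (Z⊆ z∈)
    ... | inj₁ z∈S = into q∈ (into p∈ z∈ (proj₁ (ps z∈S))) qp
    ... | inj₂ (inj₁ refl) = into q∈ z∈ qp
    ... | inj₂ (inj₂ refl) = z∈
    S⊆Z : S ⊆ Z
    S⊆Z s∈ = into (S⊆W s∈) q∈Z (proj₂ (ps s∈))
    p∈Z : p ∈ Z
    p∈Z = into p∈ (S⊆Z x∈) (proj₁ (ps x∈))

module _ {_⟶_ A D : Rel n} where

  -- `S` is a maximal strongly connected proper subset containing `x`. Either `W` has one vertex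
  -- more than `S`, and the induction passes to `S`; or `W` adds vertices `p` and `q` with
  -- `q → p → S → q`, and it passes to `W` without some vertex of `S` other than `x`.
  split : Colouring W _⟶_ A D → Strong _⟶_ W → x ∈ W → y ∈ W → x ≢ y → Split A W ⊎ Split D W
  split = go (<-wellFounded _)
    where
    go : Acc _<_ ∣ W ∣ → Colouring W _⟶_ A D → Strong _⟶_ W →
         x ∈ W → y ∈ W → x ≢ y → Split A W ⊎ Split D W
    go {W = W} {x = x} {y = y} (acc rec) col sW x∈ y∈ x≢y = result
      where
      open Colouring col
      P : Subset n → Set
      P S = S ⊆ W × x ∈ S × Strong _⟶_ S × S ≢ W
      P? : Decidable P
      P? S = S ⊆? W ×-dec x ∈? S ×-dec
        (allSubset? λ Z → Z ⊆? S →-dec nonempty? Z →-dec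
          (all? λ y → all? λ z → y ∈? S →-dec ¬? (y ∈? Z) →-dec z ∈? Z →-dec ¬? (y ⟶? z)) →-dec S ⊆? Z)
        ×-dec ¬? (S ≟ˢ W)
      P⁅x⁆ : P ⁅ x ⁆
      P⁅x⁆ = (λ z∈ → subst (_∈ W) (sym (x∈⁅y⁆⇒x≡y x z∈)) x∈) , x∈⁅x⁆ x , strong-⁅⁆
           , λ eq → x≢y (sym (x∈⁅y⁆⇒x≡y x (subst (y ∈_) (sym eq) y∈)))
      recurse : ∀ {U v u} → Strong _⟶_ U → U ⊆ W → v ∈ W → v ∉ U → (∀ {w} → w ∈ W → w ≢ v → w ∈ U) →
                x ∈ U → u ∈ U → u ≢ x → Split A W ⊎ Split D W
      recurse sU U⊆W v∈ v∉ W⊆ x∈U u∈U u≢x = Sum.map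
        (split-extend col sW sU U⊆W v∈ v∉ W⊆)
        (split-extend (colouring-swap col) sW sU U⊆W v∈ v∉ W⊆)
        (go (rec (p⊂q⇒∣p∣<∣q∣ (U⊆W , -, v∈ , v∉))) (colouring-⊆ U⊆W col) sU x∈U u∈U (≢-sym u≢x))
      result : Split A W ⊎ Split D W
      result with maximal P? P⁅x⁆
      ... | S , _ , (S⊆W , x∈S , sS , S≢W) , max
        with any? (λ v → v ∈? W ×-dec ¬? (v ∈? S) ×-dec W ⊆? (S ∪ ⁅ v ⁆)) | any? (λ s → s ∈? S ×-dec ¬? (s ≟ᶠ x))
      ... | yes (v , v∈ , v∉S , W⊆) | yes (s , s∈S , s≢x) = recurse sS S⊆W v∈ v∉S
              (λ w∈ w≢v → [ id , (λ w∈v → contradiction (x∈⁅y⁆⇒x≡y v w∈v) w≢v) ]′ (x∈p∪q⁻ S _ (W⊆ w∈)))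
              x∈S s∈S s≢x
      -- Now `W` consists of `x` and `v`, and the colour of this one pair gives the split.
      ... | yes (v , v∈ , v∉S , W⊆) | no only-x = Sum.map
              (λ xv → star-split (λ w∈ w≢x → subst (A x) (sym (≡v w∈ w≢x)) xv) x∈ y∈ x≢y)
              (λ xv → star-split (λ w∈ w≢x → subst (D x) (sym (≡v w∈ w≢x)) xv) x∈ y∈ x≢y)
              (cover x∈ v∈ (∈∧∉⇒≢ x∈S v∉S))
        where
        ≡v : ∀ {w} → w ∈ W → w ≢ x → w ≡ v
        ≡v w∈ w≢x = [ (λ w∈S → contradiction (-, w∈S , w≢x) only-x) , x∈⁅y⁆⇒x≡y v ]′ (x∈p∪q⁻ S _ (W⊆ w∈))
      ... | no ∄v | second = pq (any? λ q → any? λ p → q ∈? W ×-dec ¬? (q ∈? S) ×-dec p ∈? W ×-dec ¬? (p ∈? S)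
                                          ×-dec x ⟶? q ×-dec p ⟶? x ×-dec q ⟶? p)
        where
        -- A vertex with both an in-neighbour and an out-neighbour in `S` could be added to `S`, and
        -- by `∄v` the result would still be proper.
        one-sided : ∀ {v s t} → v ∈ W → v ∉ S → s ∈ S → t ∈ S → s ⟶ v → ¬ v ⟶ t
        one-sided {v} v∈ v∉ s∈ t∈ sv vt = v∉ (subst (v ∈_)
          (sym (max (S ∪ ⁅ v ⁆)
            ( (λ w∈ → [ S⊆W , (λ w∈v → subst (_∈ W) (sym (x∈⁅y⁆⇒x≡y v w∈v)) v∈) ]′ (x∈p∪q⁻ S _ w∈))
            , x∈p∪q⁺ (inj₁ x∈S) , strong-insert sS v∉ s∈ t∈ sv vt
            , λ eq → ∄v (v , v∈ , v∉ , subst (W ⊆_) (sym eq) id))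
            (p⊆p∪q _)))
          (x∈p∪q⁺ (inj₂ (x∈⁅x⁆ v))))
        pq : Dec (∃[ q ] ∃[ p ] q ∈ W × q ∉ S × p ∈ W × p ∉ S × x ⟶ q × p ⟶ x × q ⟶ p) → Split A W ⊎ Split D W
        -- Without such a 3-cycle through `x`, no arc enters the union of `S` and the in-neighbours
        -- of `x`, so every vertex outside `S` points to `x`. By one-sidedness no arc then leaves
        -- `S`, against strong connectivity of `W`.
        pq (no ∄pq) = contradiction x∈S (proj₂ (∈─⁻ (sW (W ─ S) (p─q⊆p W S)
              (let w , w∈ , w∉ = ⊈⇒∃∉ (λ W⊆S → S≢W (⊆-antisym S⊆W W⊆S)) in w , x∈p∧x∉q⇒x∈p─q w∈ w∉)
              (λ y z y∈ y∉ z∈ yz → let z∈W , z∉S = ∈─⁻ z∈ in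
                one-sided z∈W z∉S
                  (decidable-stable (y ∈? S) λ y∉S → y∉ (x∈p∧x∉q⇒x∈p─q y∈ y∉S)) x∈S yz (in-x z∈W z∉S))
              x∈)))
          where
          Z? : Decidable (λ w → w ∈ W × (w ∈ S ⊎ w ⟶ x))
          Z? w = w ∈? W ×-dec (w ∈? S ⊎-dec w ⟶? x)
          W⊆Z : W ⊆ ⟪ Z? ⟫
          W⊆Z = sW ⟪ Z? ⟫ (proj₁ ∘ ∈⟪⟫⁻ Z?) (x , ∈⟪⟫⁺ Z? (x∈ , inj₁ x∈S)) no-arc
            where
            no-arc : ∀ y z → y ∈ W → y ∉ ⟪ Z? ⟫ → z ∈ ⟪ Z? ⟫ → ¬ y ⟶ z
            no-arc y z y∈ y∉ z∈ yz with z ∈? S | ∈⟪⟫⁻ Z? z∈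
            ... | yes z∈S | _ = one-sided y∈ y∉S x∈S z∈S xy yz
              where
              y∉S : y ∉ S
              y∉S y∈S = y∉ (∈⟪⟫⁺ Z? (y∈ , inj₁ y∈S))
              xy : x ⟶ y
              xy = [ id , (λ yx → contradiction (∈⟪⟫⁺ Z? (y∈ , inj₂ yx)) y∉) ]′ (total x∈ y∈ (∈∧∉⇒≢ x∈S y∉S))
            ... | no z∉S | _ , inj₁ z∈S = z∉S z∈S
            ... | no z∉S | z∈W , inj₂ zx = ∄pq (y , z , y∈ , y∉S , z∈W , z∉S , xy , zx , yz)
              where
              y∉S : y ∉ S
              y∉S y∈S = y∉ (∈⟪⟫⁺ Z? (y∈ , inj₁ y∈S))
              xy : x ⟶ y
              xy = [ id , (λ yx → contradiction (∈⟪⟫⁺ Z? (y∈ , inj₂ yx)) y∉) ]′ (total x∈ y∈ (∈∧∉⇒≢ x∈S y∉S))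
          in-x : ∀ {w} → w ∈ W → w ∉ S → w ⟶ x
          in-x w∈ w∉S = [ (λ w∈S → contradiction w∈S w∉S) , id ]′ (proj₂ (∈⟪⟫⁻ Z? (W⊆Z w∈)))
        pq (yes (q , p , q∈ , q∉S , p∈ , p∉S , xq , px , qp)) = finish second
          where
          S⟶q : ∀ {s} → s ∈ S → s ⟶ q
          S⟶q s∈ = [ id , (λ qs → contradiction qs (one-sided q∈ q∉S x∈S s∈ xq)) ]′
            (total (S⊆W s∈) q∈ (∈∧∉⇒≢ s∈ q∉S))
          p⟶S : ∀ {s} → s ∈ S → p ⟶ s
          p⟶S s∈ = [ (λ sp → contradiction px (one-sided p∈ p∉S s∈ x∈S sp)) , id ]′
            (total (S⊆W s∈) p∈ (∈∧∉⇒≢ s∈ p∉S))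
          S⁺? : Decidable (λ w → w ∈ S ⊎ w ≡ p ⊎ w ≡ q)
          S⁺? w = w ∈? S ⊎-dec w ≟ᶠ p ⊎-dec w ≟ᶠ q
          S⁺⊆W : ⟪ S⁺? ⟫ ⊆ W
          S⁺⊆W w∈ = [ S⊆W , [ (λ { refl → p∈ }) , (λ { refl → q∈ }) ]′ ]′ (∈⟪⟫⁻ S⁺? w∈)
          S⁺≡W : ⟪ S⁺? ⟫ ≡ W
          S⁺≡W = decidable-stable (⟪ S⁺? ⟫ ≟ˢ W) λ S⁺≢W → p∉S (subst (p ∈_)
            (sym (max ⟪ S⁺? ⟫ (S⁺⊆W , ∈⟪⟫⁺ S⁺? (inj₁ x∈S)
              , strong-3cycles x∈S qp (λ s∈ → p⟶S s∈ , S⟶q s∈) (∈⟪⟫⁺ S⁺? ∘ inj₁)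
                  (∈⟪⟫⁺ S⁺? (inj₂ (inj₁ refl))) (∈⟪⟫⁺ S⁺? (inj₂ (inj₂ refl))) (∈⟪⟫⁻ S⁺?)
              , S⁺≢W) (∈⟪⟫⁺ S⁺? ∘ inj₁)))
            (∈⟪⟫⁺ S⁺? (inj₂ (inj₁ refl))))
          W⊆ : ∀ {w} → w ∈ W → w ∈ S ⊎ w ≡ p ⊎ w ≡ q
          W⊆ w∈ = ∈⟪⟫⁻ S⁺? (subst (_ ∈_) (sym S⁺≡W) w∈)
          finish : Dec (∃[ s ] s ∈ S × s ≢ x) → Split A W ⊎ Split D W
          -- After deleting `s` every remaining vertex of `S` is still on a 3-cycle with `p` and
          -- `q`, and `x` keeps `S` nonempty; so the rest is strongly connected.
          finish (yes (s , s∈S , s≢x)) = recurse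
            (strong-3cycles (x∈p∧x≢y⇒x∈p-y x∈S (≢-sym s≢x)) qp
              (λ t∈ → let t∈S = proj₁ (∈─⁻ t∈) in p⟶S t∈S , S⟶q t∈S)
              (λ t∈ → let t∈S , t∉ = ∈─⁻ t∈ in x∈p∧x∉q⇒x∈p─q (S⊆W t∈S) t∉)
              (x∈p∧x≢y⇒x∈p-y p∈ (≢-sym (∈∧∉⇒≢ s∈S p∉S)))
              (x∈p∧x≢y⇒x∈p-y q∈ (≢-sym (∈∧∉⇒≢ s∈S q∉S)))
              (λ w∈ → let w∈W , w∉ = ∈─⁻ w∈ in Sum.map (λ w∈S → x∈p∧x∉q⇒x∈p─q w∈S w∉) id (W⊆ w∈W)))
            (p─q⊆p W _) (S⊆W s∈S) (λ s∈ → proj₂ (∈─⁻ s∈) (x∈⁅x⁆ s)) x∈p∧x≢y⇒x∈p-y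
            (x∈p∧x≢y⇒x∈p-y x∈ (≢-sym s≢x)) (x∈p∧x≢y⇒x∈p-y p∈ (≢-sym (∈∧∉⇒≢ s∈S p∉S)))
            (≢-sym (∈∧∉⇒≢ x∈S p∉S))
          -- `W` is the 3-cycle `x → q → p → x`. If `xp` and `xq` have different colours, `qp`
          -- shares the colour of one of them, these two arcs form a path, and the path rule gives
          -- the third pair a second colour.
          finish (no only-x) with cover x∈ p∈ (∈∧∉⇒≢ x∈S p∉S) | cover x∈ q∈ (∈∧∉⇒≢ x∈S q∉S)
          ... | inj₁ xp | inj₁ xq′ = inj₁ (star-split (star xp xq′) x∈ y∈ x≢y)
            where
            star : A x p → A x q → ∀ {w} → w ∈ W → w ≢ x → A x w
            star xp xq w∈ w≢x with W⊆ w∈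
            ... | inj₁ w∈S = contradiction (-, w∈S , w≢x) only-x
            ... | inj₂ (inj₁ refl) = xp
            ... | inj₂ (inj₂ refl) = xq
          ... | inj₂ xp | inj₂ xq′ = inj₂ (star-split (star xp xq′) x∈ y∈ x≢y)
            where
            star : D x p → D x q → ∀ {w} → w ∈ W → w ≢ x → D x w
            star xp xq w∈ w≢x with W⊆ w∈
            ... | inj₁ w∈S = contradiction (-, w∈S , w≢x) only-x
            ... | inj₂ (inj₁ refl) = xp
            ... | inj₂ (inj₂ refl) = xq
          ... | inj₁ xp | inj₂ xq′ with cover q∈ p∈ (λ { refl → asym qp qp })
          ...   | inj₁ qp′ = contradiction xq′ (excl (A-sym (A-path q∈ p∈ x∈ qp′ (A-sym xp) qp px)))
          ...   | inj₂ qp′ = contradiction (D-path x∈ q∈ p∈ xq′ qp′ xq qp) (excl xp)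
          finish (no only-x) | inj₂ xp | inj₁ xq′ with cover q∈ p∈ (λ { refl → asym qp qp })
          ...   | inj₁ qp′ = contradiction xp (excl (A-path x∈ q∈ p∈ xq′ qp′ xq qp))
          ...   | inj₂ qp′ = contradiction (D-sym (D-path q∈ p∈ x∈ qp′ (D-sym xp) qp px)) (excl xq′)

-- Pairs of realizations

arcs : {R : Rel n} → (∀ u v → Dec (R u v)) → Arcs n
arcs R? = tabulate λ u → ⟪ R? u ⟫

arcs⁺ : {R : Rel n} (R? : ∀ u v → Dec (R u v)) → R u v → arcs R? ⊢ u ⟶ v
arcs⁺ {u = u} R? uv = subst (_ ∈_) (sym (lookup∘tabulate _ u)) (∈⟪⟫⁺ (R? u) uv)

arcs⁻ : {R : Rel n} (R? : ∀ u v → Dec (R u v)) → arcs R? ⊢ u ⟶ v → R u v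
arcs⁻ {u = u} R? uv = ∈⟪⟫⁻ (R? u) (subst (_ ∈_) (lookup∘tabulate _ u) uv)

arcs-ext : (∀ u v → T ⊢ u ⟶ v → T′ ⊢ u ⟶ v) → (∀ u v → T′ ⊢ u ⟶ v → T ⊢ u ⟶ v) → T ≡ T′
arcs-ext {T = T} {T′} f g = trans (sym (tabulate∘lookup T)) (trans
  (tabulate-cong λ u → ⊆-antisym (f u _) (g u _)) (tabulate∘lookup T′))

rev : Arcs n → Arcs n
rev T = arcs λ u v → T ⊢ v ⟶? u

rev⁺ : T ⊢ v ⟶ u → rev T ⊢ u ⟶ v
rev⁺ {T = T} = arcs⁺ λ u v → T ⊢ v ⟶? u

rev⁻ : rev T ⊢ u ⟶ v → T ⊢ v ⟶ u
rev⁻ {T = T} = arcs⁻ λ u v → T ⊢ v ⟶? u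

realizes-rev : Realizes T K → Realizes (rev T) K
realizes-rev {T = T} {K} r = record
  { asym     = λ ab ba → asym (rev⁻ {T = T} ab) (rev⁻ {T = T} ba)
  ; total    = λ a∈ b∈ a≢b → Sum.map (rev⁺ {T = T}) (rev⁺ {T = T}) (swap (total a∈ b∈ a≢b))
  ; cyc⇒edge = λ a∈ b∈ c∈ (ab , bc , ca) → E₃-swap {K = K} (cyc⇒edge b∈ a∈ c∈
                 (rev⁻ {T = T} ab , rev⁻ {T = T} ca , rev⁻ {T = T} bc))
  ; edge⇒cyc = λ e∈ → let a , b , c , (ab , bc , ca) , eq = edge⇒cyc e∈ in
      b , a , c , (rev⁺ {T = T} ab , rev⁺ {T = T} ca , rev⁺ {T = T} bc) , trans eq tri-swap
  }
  where open Realizes r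

-- Disagreement is expressed by the same relation, as `Agree T (rev T′)`, so one proof of the path
-- rule covers both colours.
Agree : Arcs n → Arcs n → Rel n
Agree T T′ a b = (T ⊢ a ⟶ b × T′ ⊢ a ⟶ b) ⊎ (T ⊢ b ⟶ a × T′ ⊢ b ⟶ a)

module _ {T T′ : Arcs n} {K : Hypergraph n} (r : Realizes T K) (r′ : Realizes T′ K) where
  private
    module R  = Realizes r
    module R′ = Realizes r′

  agree-dir : Agree T T′ a b → T ⊢ a ⟶ b → T′ ⊢ a ⟶ b
  agree-dir (inj₁ (_ , ab′)) _  = ab′
  agree-dir (inj₂ (ba , _))  ab = contradiction ba (R.asym ab)

  -- If `T` and `T′` ordered `a` and `c` differently, the three vertices would be a 3-cycle in one
  -- and transitive in the other, although both realize `K`.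
  agree-path : a ∈ V K → b ∈ V K → c ∈ V K → Agree T T′ a b → Agree T T′ b c →
               T ⊢ a ⟶ b → T ⊢ b ⟶ c → Agree T T′ a c
  agree-path a∈ b∈ c∈ agab agbc ab bc
    with R.total a∈ c∈ a≢c | R′.total a∈ c∈ a≢c
    where
    a≢c : _ ≢ _
    a≢c refl = R.asym ab bc
  ... | inj₁ ac | inj₁ ac′ = inj₁ (ac , ac′)
  ... | inj₂ ca | inj₂ ca′ = inj₂ (ca , ca′)
  ... | inj₁ ac | inj₂ ca′ with Realized.edge⇒dir r (R′.cyc⇒edge a∈ b∈ c∈ (agree-dir agab ab , agree-dir agbc bc , ca′))
  ...   | inj₁ (_ , _ , ca) = contradiction ca (R.asym ac)
  ...   | inj₂ (ba , _)     = contradiction ba (R.asym ab)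
  agree-path a∈ b∈ c∈ agab agbc ab bc | inj₂ ca | inj₁ ac′ with Realized.edge⇒dir r′ (R.cyc⇒edge a∈ b∈ c∈ (ab , bc , ca))
  ...   | inj₁ (_ , _ , ca′) = contradiction ca′ (R′.asym ac′)
  ...   | inj₂ (ba′ , _)     = contradiction ba′ (R′.asym (agree-dir agab ab))

agree? : (T T′ : Arcs n) → ∀ a b → Dec (Agree T T′ a b)
agree? T T′ a b = (T ⊢ a ⟶? b ×-dec T′ ⊢ a ⟶? b) ⊎-dec (T ⊢ b ⟶? a ×-dec T′ ⊢ b ⟶? a)

agree-colouring : Realizes T K → Realizes T′ K →
                  Colouring (V K) (T ⊢_⟶_) (Agree T T′) (Agree T (rev T′))
agree-colouring {T = T} {K} {T′} r r′ = record
  { _⟶?_  = T ⊢_⟶?_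
  ; A?     = agree? T T′
  ; D?     = agree? T (rev T′)
  ; asym   = R.asym
  ; total  = R.total
  ; A-sym  = swap
  ; D-sym  = swap
  ; cover  = cover
  ; excl   = excl
  ; A-path = agree-path r r′
  ; D-path = agree-path r (realizes-rev r′)
  }
  where
  module R  = Realizes r
  module R′ = Realizes r′
  cover : a ∈ V K → b ∈ V K → a ≢ b → Agree T T′ a b ⊎ Agree T (rev T′) a b
  cover a∈ b∈ a≢b with R.total a∈ b∈ a≢b | R′.total a∈ b∈ a≢b
  ... | inj₁ ab | inj₁ ab′ = inj₁ (inj₁ (ab , ab′))
  ... | inj₁ ab | inj₂ ba′ = inj₂ (inj₁ (ab , rev⁺ {T = T′} ba′))
  ... | inj₂ ba | inj₁ ab′ = inj₂ (inj₂ (ba , rev⁺ {T = T′} ab′))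
  ... | inj₂ ba | inj₂ ba′ = inj₁ (inj₂ (ba , ba′))
  excl : Agree T T′ a b → ¬ Agree T (rev T′) a b
  excl (inj₁ (_  , ab′)) (inj₁ (_  , ba′)) = R′.asym ab′ (rev⁻ {T = T′} ba′)
  excl (inj₁ (ab , _))   (inj₂ (ba , _))   = R.asym ab ba
  excl (inj₂ (ba , _))   (inj₁ (ab , _))   = R.asym ab ba
  excl (inj₂ (_  , ba′)) (inj₂ (_  , ab′)) = R′.asym ba′ (rev⁻ {T = T′} ab′)

Together : Hypergraph n → Rel n
Together K u v = ∃[ M ] IsMaximalProperStrong K M × u ∈ M × v ∈ M

Cross : Hypergraph n → Rel n
Cross K u v = u ∈ V K × v ∈ V K × ¬ Together K u v

together? : (K : Hypergraph n) → ∀ u v → Dec (Together K u v)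
together? K u v = anySubset? λ M → isMaximalProperStrong? K M ×-dec u ∈? M ×-dec v ∈? M

abstract
  cross? : (K : Hypergraph n) → ∀ u v → Dec (Cross K u v)
  cross? K u v = u ∈? V K ×-dec v ∈? V K ×-dec ¬? (together? K u v)

together-sym : Together K u v → Together K v u
together-sym (M , blk , u∈ , v∈) = M , blk , v∈ , u∈

cross-sym : Cross K u v → Cross K v u
cross-sym {K = K} (u∈ , v∈ , ¬tog) = v∈ , u∈ , ¬tog ∘ together-sym {K = K}

¬cross⇒together : (K : Hypergraph n) → u ∈ V K → v ∈ V K → ¬ Cross K u v → Together K u v
¬cross⇒together {u = u} {v} K u∈ v∈ ¬cr = decidable-stable (together? K u v) λ ¬tog → ¬cr (u∈ , v∈ , ¬tog)

module _ {T : Arcs n} {K : Hypergraph n} (r : Realizes T K) where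
  open Realized r
  open Realizes r

  together-trans : Together K u v → Together K v z → Together K u z
  together-trans (M , blk , u∈M , v∈M) (N , blk′ , v∈N , z∈N) =
    M , blk , u∈M , subst (_ ∈_) (sym (block-unique blk blk′ v∈M v∈N)) z∈N

  cross-irrefl : 2 ≤ ∣ V K ∣ → Cross K u v → u ≢ v
  cross-irrefl 2≤ (u∈ , _ , ¬tog) refl with block∋ 2≤ u∈
  ... | M , u∈M , blk = ¬tog (M , blk , u∈M , u∈M)

  -- A block is a module, so an edge with `a` outside the block of `b` has only `b` in it. Hence an
  -- edge meeting two blocks meets three, and all its pairs are cross pairs.
  cross-edge : E₃ K a b c → Cross K a b → Cross K b c
  cross-edge abc (a∈ , b∈ , ¬tog) = b∈ , E₃⇒∈₃ {K = K} abc , λ (M , blk , b∈M , c∈M) →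
    Module.single (block-module blk) (E₃-rot {K = K} abc) b∈M (λ a∈M → ¬tog (M , blk , a∈M , b∈M)) c∈M

  -- A 3-cycle with vertices inside and outside `Z` has an arc entering `Z`. So a set without
  -- entering arcs is closed under edges.
  connected⇒strong : Connected K → Strong (T ⊢_⟶_) (V K)
  connected⇒strong conn Z Z⊆V (x , x∈Z) closed = subst (V K ⊆_) (sym (conn x∈Z Z⊆V Z-closed)) id
    where
    Z-closed : ∀ {a b c} → E₃ K a b c → a ∈ Z → b ∈ Z
    Z-closed {a} {b} {c} abc a∈ = decidable-stable (b ∈? Z) λ b∉ → go b∉ (edge⇒dir abc) (c ∈? Z)
      where
      b∈V = E₃⇒∈₂ {K = K} abc
      go : b ∉ Z → Cyc T a b c ⊎ Cyc T b a c → ¬ Dec (c ∈ Z)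
      go b∉ (inj₂ (ba , _)) _           = closed b a b∈V b∉ a∈ ba
      go b∉ (inj₁ (_ , bc , _)) (yes c∈) = closed b c b∈V b∉ c∈ bc
      go b∉ (inj₁ (_ , _ , ca)) (no c∉)  = closed c a (E₃⇒∈₃ {K = K} abc) c∉ a∈ ca

  split⇒cross : ∀ {A D} → Connected K → Colouring (V K) (T ⊢_⟶_) A D → Split A (V K) → Cross K u v → A u v
  split⇒cross {u} {v} conn col (Z , Z⊆V , (z , z∈Z) , (z′ , z′∈) , join) (u∈ , v∈ , ¬tog)
    with component col u∈
  ... | C , comp = Component.join comp u v (Component.root comp) v∈ v∉C
    where
    open Component comp using (C⊆W; root; indivisible)
    C≢V : C ≢ V K
    C≢V refl = proj₂ (∈─⁻ z′∈) (indivisible Z join (Z⊆V z∈Z) z∈Z (p─q⊆p _ Z z′∈))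
    v∉C : v ∉ C
    v∉C v∈C with connected⇒module⊆block conn (tModule⇒module C⊆W (component-module col comp)) root C≢V
    ... | M , C⊆M , blk = ¬tog (M , blk , C⊆M root , C⊆M v∈C)

two-realizations : Realizes T K → Realizes T′ K → Connected K → x ∈ V K → y ∈ V K → x ≢ y →
  (∀ {u v} → Cross K u v → Agree T T′ u v) ⊎ (∀ {u v} → Cross K u v → Agree T (rev T′) u v)
two-realizations r r′ conn x∈ y∈ x≢y = Sum.map
  (λ sp cr → split⇒cross r conn col sp cr)
  (λ sp cr → split⇒cross r conn (colouring-swap col) sp cr)
  (split col (connected⇒strong r conn) x∈ y∈ x≢y)
  where col = agree-colouring r r′

-- Exchanging arcs across the blocks of a strong module

Exchanged : Hypergraph n → Arcs n → Arcs n → Rel n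
Exchanged K T S u v = Cross K u v × S ⊢ u ⟶ v ⊎ ¬ Cross K u v × T ⊢ u ⟶ v

exchanged? : (K : Hypergraph n) (T S : Arcs n) → ∀ u v → Dec (Exchanged K T S u v)
exchanged? K T S u v = (cross? K u v ×-dec S ⊢ u ⟶? v) ⊎-dec (¬? (cross? K u v) ×-dec T ⊢ u ⟶? v)

abstract
  exchange : Hypergraph n → Arcs n → Arcs n → Arcs n
  exchange K T S = arcs (exchanged? K T S)

  exchange⁺ : Exchanged K T S u v → exchange K T S ⊢ u ⟶ v
  exchange⁺ {K = K} {T} {S} = arcs⁺ (exchanged? K T S)

  exchange⁻ : exchange K T S ⊢ u ⟶ v → Exchanged K T S u v
  exchange⁻ {K = K} {T} {S} = arcs⁻ (exchanged? K T S)

module _ {K : Hypergraph n} {T S : Arcs n} where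
  cross⁺ : Cross K u v → S ⊢ u ⟶ v → exchange K T S ⊢ u ⟶ v
  cross⁺ cr uv = exchange⁺ {K = K} {T} {S} (inj₁ (cr , uv))

  cross⁻ : Cross K u v → exchange K T S ⊢ u ⟶ v → S ⊢ u ⟶ v
  cross⁻ cr uv = [ proj₂ , (λ (¬cr , _) → contradiction cr ¬cr) ]′ (exchange⁻ {K = K} {T} {S} uv)

  ¬cross⁺ : ¬ Cross K u v → T ⊢ u ⟶ v → exchange K T S ⊢ u ⟶ v
  ¬cross⁺ ¬cr uv = exchange⁺ {K = K} {T} {S} (inj₂ (¬cr , uv))

  ¬cross⁻ : ¬ Cross K u v → exchange K T S ⊢ u ⟶ v → T ⊢ u ⟶ v
  ¬cross⁻ ¬cr uv = [ (λ (cr , _) → contradiction cr ¬cr) , proj₂ ]′ (exchange⁻ {K = K} {T} {S} uv)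

-- S induces a realization of K / Π K, spread over the blocks of K.
record CrossRealizes (S : Arcs n) (K : Hypergraph n) : Set where
  field
    asym     : Cross K u v → S ⊢ u ⟶ v → ¬ S ⊢ v ⟶ u
    total    : Cross K u v → S ⊢ u ⟶ v ⊎ S ⊢ v ⟶ u
    from     : Together K u v → Cross K u z → Cross K v z → S ⊢ u ⟶ z → S ⊢ v ⟶ z
    to       : Together K u v → Cross K u z → Cross K v z → S ⊢ z ⟶ u → S ⊢ z ⟶ v
    cyc⇒edge : Cross K a b → Cross K b c → Cross K c a → Cyc S a b c → E₃ K a b c
    edge⇒cyc : Cross K a b → Cross K b c → Cross K c a → E₃ K a b c → Cyc S a b c ⊎ Cyc S b a c

module _ {T : Arcs n} {H : Hypergraph n} {X : Subset n} (r : Realizes T H) (sX : IsStrong H X) (2≤ : 2 ≤ ∣ X ∣) where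

  private
    X⊆V = IsModule.M⊆V (proj₁ sX)
    K′ = H [ X ]
    rX : Realizes T K′
    rX = realizes-restrict r X⊆V
    mX = Realized.isModule⇒module r (proj₁ sX)

  block-tModule : IsMaximalProperStrong K′ M → TModule T (V H) M
  block-tModule ((sM , _) , _) = Realized.strong⇒tModule r (strong-sub⁺ r sX sM)

  -- Blocks of `H [ X ]` are strong modules of `H`, hence modules of `T`; this is the content of
  -- `from` and `to`.
  realizes⇒crossRealizes : CrossRealizes T K′
  realizes⇒crossRealizes = record
    { asym     = λ _ → asym
    ; total    = λ cr@(u∈ , v∈ , _) → total (X⊆V u∈) (X⊆V v∈) (cross-irrefl rX 2≤ cr)
    ; from     = λ (M , blk , u∈ , v∈) cr@(u∈X , z∈ , ¬tog) cr′@(v∈X , _) uz →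
        let z∉ = λ z∈M → ¬tog (M , blk , u∈ , z∈M) in
        ¬⟶⇒⟵ (X⊆V z∈) (X⊆V v∈X) (cross-irrefl rX 2≤ (cross-sym {K = K′} cr′)) λ zv →
          asym uz (block-tModule blk (X⊆V z∈) z∉ v∈ u∈ zv)
    ; to       = λ (M , blk , u∈ , v∈) (_ , z∈ , ¬tog) _ →
        block-tModule blk (X⊆V z∈) (λ z∈M → ¬tog (M , blk , u∈ , z∈M)) u∈ v∈
    ; cyc⇒edge = λ (a∈ , b∈ , _) (_ , c∈ , _) _ → Realizes.cyc⇒edge rX a∈ b∈ c∈
    ; edge⇒cyc = λ _ _ _ → Realized.edge⇒dir rX
    }
    where open Realizes r

  module _ {S : Arcs n} (crS : CrossRealizes S K′) where
    private
      module T = Realizes r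
      module S = CrossRealizes crS
      O = exchange K′ T S

      xedge : E₃ H a b c → Cross K′ a b → E₃ K′ a b c
      xedge {a} {b} {c} abc (a∈ , b∈ , _) = abc , tri-⊆ a∈ b∈ (decidable-stable (c ∈? X) λ c∉ →
        Module.single mX abc a∈ c∉ b∈)

      -- If `c` is outside `X`, the arcs `b → c → a` come from `T` and contradict that `X` is a
      -- module of `T`. If `c` is in `X` and shares a block with `a` or `b`, the arcs of `S` from
      -- both to the third vertex have the same direction, which breaks the cycle. Otherwise all
      -- pairs are cross pairs.
      ¬cyc : Cross K′ a b → Cyc O a b c → ¬ E₃ H a b c → ¬ (b ∈ V H × c ∈ V H)
      ¬cyc {a} {b} {c} cr@(a∈ , b∈ , ¬tog) (ab , bc , ca) ¬abc (_ , c∈V) with c ∈? X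
      ... | no c∉ = T.asym (¬cross⁻ {T = T} {S} (λ cr → c∉ (proj₁ (proj₂ cr))) bc)
              (Realized.strong⇒tModule r sX c∈V c∉ a∈ b∈ (¬cross⁻ {T = T} {S} (c∉ ∘ proj₁) ca))
      ... | yes c∈ with cross? K′ b c | cross? K′ c a
      ...   | yes crbc | yes crca = ¬abc (proj₁ (S.cyc⇒edge cr crbc crca
              (cross⁻ {T = T} {S} cr ab , cross⁻ {T = T} {S} crbc bc , cross⁻ {T = T} {S} crca ca)))
      ...   | no ¬crbc | _ = S.asym crca (cross⁻ {T = T} {S} crca ca)
                (S.to (¬cross⇒together K′ b∈ c∈ ¬crbc) (cross-sym {K = K′} cr) crca (cross⁻ {T = T} {S} cr ab))
        where
        crca : Cross K′ c a
        crca = c∈ , a∈ , λ tog → ¬tog (together-sym {K = K′}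
          (together-trans rX (¬cross⇒together K′ b∈ c∈ ¬crbc) tog))
      ...   | yes crbc | no ¬crca = S.asym cr (cross⁻ {T = T} {S} cr ab)
                (S.to (¬cross⇒together K′ c∈ a∈ ¬crca) (cross-sym {K = K′} crbc) cr (cross⁻ {T = T} {S} crbc bc))

    exchange-realizes : Realizes O H
    exchange-realizes = record
      { asym     = λ {a} {b} → asym {a} {b}
      ; total    = total
      ; cyc⇒edge = cyc⇒edge
      ; edge⇒cyc = λ e∈ → let a , b , c , cyc , eq = T.edge⇒cyc e∈ in edge eq cyc (subst (E H) eq e∈)
      }
      where
      asym : O ⊢ a ⟶ b → ¬ O ⊢ b ⟶ a
      asym {a} {b} ab ba with cross? K′ a b
      ... | yes cr = S.asym cr (cross⁻ {T = T} {S} cr ab) (cross⁻ {T = T} {S} (cross-sym {K = K′} cr) ba)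
      ... | no ¬cr = T.asym (¬cross⁻ {T = T} {S} ¬cr ab) (¬cross⁻ {T = T} {S} (¬cr ∘ cross-sym {K = K′}) ba)
      total : a ∈ V H → b ∈ V H → a ≢ b → O ⊢ a ⟶ b ⊎ O ⊢ b ⟶ a
      total {a} {b} a∈ b∈ a≢b with cross? K′ a b
      ... | yes cr = Sum.map (cross⁺ {T = T} {S} cr) (cross⁺ {T = T} {S} (cross-sym {K = K′} cr)) (S.total cr)
      ... | no ¬cr = Sum.map (¬cross⁺ {T = T} {S} ¬cr) (¬cross⁺ {T = T} {S} (¬cr ∘ cross-sym {K = K′})) (T.total a∈ b∈ a≢b)
      cyc⇒edge : a ∈ V H → b ∈ V H → c ∈ V H → Cyc O a b c → E₃ H a b c
      cyc⇒edge {a} {b} {c} a∈ b∈ c∈ cyc@(ab , bc , ca) = decidable-stable (E? H (tri a b c)) λ ¬abc →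
        go ¬abc (cross? K′ a b) (cross? K′ b c) (cross? K′ c a)
        where
        go : ¬ E₃ H a b c → Dec (Cross K′ a b) → Dec (Cross K′ b c) → ¬ Dec (Cross K′ c a)
        go ¬abc (yes cr) _ _ = ¬cyc cr cyc ¬abc (b∈ , c∈)
        go ¬abc (no _) (yes cr) _ = ¬cyc cr (bc , ca , ab) (¬abc ∘ E₃-rot {K = H} ∘ E₃-rot {K = H}) (c∈ , a∈)
        go ¬abc (no _) (no _) (yes cr) = ¬cyc cr (ca , ab , bc) (¬abc ∘ E₃-rot {K = H}) (a∈ , b∈)
        go ¬abc (no ¬ab) (no ¬bc) (no ¬ca) = ¬abc (T.cyc⇒edge a∈ b∈ c∈
          (¬cross⁻ {T = T} {S} ¬ab ab , ¬cross⁻ {T = T} {S} ¬bc bc , ¬cross⁻ {T = T} {S} ¬ca ca))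
      all-cross : ∀ {e} → e ≡ tri a b c → E₃ H a b c → Cross K′ a b → ∃[ x ] ∃[ y ] ∃[ z ] Cyc O x y z × e ≡ tri x y z
      all-cross eq abc crab with xedge abc crab
      ... | abc′ with cross-edge rX abc′ crab
      ...   | crbc with cross-edge rX (E₃-rot {K = K′} abc′) crbc
      ...     | crca with S.edge⇒cyc crab crbc crca abc′
      ...       | inj₁ (ab , bc , ca) = -, -, -, (cross⁺ {T = T} {S} crab ab , cross⁺ {T = T} {S} crbc bc , cross⁺ {T = T} {S} crca ca) , eq
      ...       | inj₂ (ba , ac , cb) = -, -, -, ( cross⁺ {T = T} {S} (cross-sym {K = K′} crab) ba
                      , cross⁺ {T = T} {S} (cross-sym {K = K′} crca) ac
                      , cross⁺ {T = T} {S} (cross-sym {K = K′} crbc) cb) , trans eq tri-swap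
      edge : ∀ {e} → e ≡ tri a b c → Cyc T a b c → E₃ H a b c → ∃[ x ] ∃[ y ] ∃[ z ] Cyc O x y z × e ≡ tri x y z
      edge {a} {b} {c} eq (ab , bc , ca) abc with cross? K′ a b | cross? K′ b c | cross? K′ c a
      ... | yes cr | _ | _ = all-cross eq abc cr
      ... | no _ | yes cr | _ = all-cross (trans eq tri-rot) (E₃-rot {K = H} abc) cr
      ... | no _ | no _ | yes cr = all-cross (trans eq (trans tri-rot tri-rot)) (E₃-rot {K = H} (E₃-rot {K = H} abc)) cr
      ... | no ¬ab | no ¬bc | no ¬ca = a , b , c , (¬cross⁺ {T = T} {S} ¬ab ab , ¬cross⁺ {T = T} {S} ¬bc bc , ¬cross⁺ {T = T} {S} ¬ca ca) , eq

    exchange-realization : IsUniform 3 H → (∀ a b → T ⊢ a ⟶ b → a ∈ V H × b ∈ V H) → IsRealization H O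
    exchange-realization uni arcs⊆ = realizes⇒isRealization uni O⊆ exchange-realizes
      where
      O⊆ : ∀ a b → O ⊢ a ⟶ b → a ∈ V H × b ∈ V H
      O⊆ a b ab with cross? K′ a b
      ... | yes (a∈ , b∈ , _) = X⊆V a∈ , X⊆V b∈
      ... | no ¬cr = arcs⊆ a b (¬cross⁻ {T = T} {S} ¬cr ab)

-- The quotient by the blocks

lookup-injective : ∀ {A : Set} {xs : List A} → Unique xs → ∀ i j → List.lookup xs i ≡ List.lookup xs j → i ≡ j
lookup-injective (_   ∷ _)  zero    zero    _  = refl
lookup-injective {xs = _ ∷ xs} (x∉ ∷ _) zero (suc j) eq = contradiction eq (All.lookup x∉ (∈-lookup {xs = xs} j))
lookup-injective {xs = _ ∷ xs} (x∉ ∷ _) (suc i) zero eq = contradiction (sym eq) (All.lookup x∉ (∈-lookup {xs = xs} i))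
lookup-injective (_   ∷ uq) (suc i) (suc j) eq = cong suc (lookup-injective uq i j eq)

record IsBlocks (K : Hypergraph n) (P : List (Subset n)) : Set where
  field
    sound    : ∀ {M} → M ∈ˡ P → IsMaximalProperStrong K M
    complete : ∀ {M} → IsMaximalProperStrong K M → M ∈ˡ P
    unique   : Unique P

Π-blocks : (K : Hypergraph n) → IsBlocks K (Π K)
Π-blocks {n} K = record
  { sound    = proj₂ ∘ ∈-filter⁻ (isMaximalProperStrong? K) {xs = subsets n}
  ; complete = ∈-filter⁺ (isMaximalProperStrong? K) (subsets-complete _)
  ; unique   = filter⁺ (isMaximalProperStrong? K) (subsets-unique n)
  }

-- P is a parameter, not Π K itself, lest Agda unfold the filtered list.
module Quotient {n} {T : Arcs n} {K : Hypergraph n} (r : Realizes T K) (2≤ : 2 ≤ ∣ V K ∣)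
                {P : List (Subset n)} (blocks : IsBlocks K P) where
  open Realized r
  open Module

  Index : Set
  Index = Fin (length P)

  B : Index → Subset n
  B = List.lookup P

  B-block : ∀ i → IsMaximalProperStrong K (B i)
  B-block i = IsBlocks.sound blocks (∈-lookup {xs = P} i)

  B-module : ∀ i → Module K (B i)
  B-module i = block-module (B-block i)

  B-injective : ∀ i j → B i ≡ B j → i ≡ j
  B-injective = lookup-injective (IsBlocks.unique blocks)

  B-disjoint : ∀ {i j} → x ∈ B i → x ∈ B j → i ≡ j
  B-disjoint {i = i} {j} x∈i x∈j = B-injective i j (block-unique (B-block i) (B-block j) x∈i x∈j)

  B-≢ : ∀ {i j} → i ≢ j → x ∈ B i → x ∉ B j
  B-≢ i≢j x∈i x∈j = i≢j (B-disjoint x∈i x∈j)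

  abstract
    B-cover : x ∈ V K → ∃[ i ] x ∈ B i
    B-cover x∈ with block∋ 2≤ x∈
    ... | M , x∈M , blk = Any.index M∈ , subst (_ ∈_) (Any.lookup-index M∈) x∈M
      where
      M∈ : M ∈ˡ P
      M∈ = IsBlocks.complete blocks blk

  together⇒≡ : ∀ {i j} → Together K u v → u ∈ B i → v ∈ B j → i ≡ j
  together⇒≡ {i = i} (M , blk , u∈M , v∈M) u∈ v∈
    with refl ← block-unique blk (B-block i) u∈M u∈ = B-disjoint v∈M v∈

  cross⁺-B : ∀ {i j} → i ≢ j → u ∈ B i → v ∈ B j → Cross K u v
  cross⁺-B {i = i} {j} i≢j u∈ v∈ = ⊆V (B-module i) u∈ , ⊆V (B-module j) v∈ , λ tog → i≢j (together⇒≡ tog u∈ v∈)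

  cross⁻-B : ∀ {i j} → Cross K u v → u ∈ B i → v ∈ B j → i ≢ j
  cross⁻-B {i = i} (_ , _ , ¬tog) u∈ v∈ refl = ¬tog (B i , B-block i , u∈ , v∈)

  abstract
    V-nonempty : Nonempty (V K)
    V-nonempty = let x , _ , x∈ , _ = two≤∣p∣⁻ 2≤ in x , x∈

    -- The empty set is a strong module too, but it lies inside the block of any vertex, so
    -- maximality keeps it from being a block.
    B-nonempty : ∀ i → Nonempty (B i)
    B-nonempty i with nonempty? (B i)
    ... | yes ne = ne
    ... | no ∄ with B-cover (proj₂ V-nonempty)
    ...   | j , x∈j = contradiction (-, subst (_ ∈_)
            (sym (proj₂ (B-block i) (B j) (proj₁ (B-block j)) (λ y∈ → contradiction (-, y∈) ∄))) x∈j) ∄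

    cross-exists : ∃[ u ] ∃[ v ] Cross K u v
    cross-exists with B-cover (proj₂ V-nonempty)
    ... | i , x∈i with ⊈⇒∃∉ (λ V⊆B → proj₂ (proj₁ (B-block i)) (⊆-antisym (⊆V (B-module i)) V⊆B))
    ...   | y , y∈ , y∉ with B-cover y∈
    ...     | j , y∈j = -, -, cross⁺-B (λ { refl → y∉ y∈j }) x∈i y∈j

  ∈trace⁺ : ∀ {i e} → x ∈ B i → x ∈ e → i ∈ trace P e
  ∈trace⁺ {e = e} x∈i x∈e = ∈⟪⟫⁺ (λ i → nonempty? (B i ∩ e)) (-, x∈p∩q⁺ (x∈i , x∈e))

  ∈trace⁻ : ∀ {i e} → i ∈ trace P e → ∃[ x ] x ∈ B i × x ∈ e
  ∈trace⁻ {i} {e} i∈ with ∈⟪⟫⁻ (λ i → nonempty? (B i ∩ e)) i∈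
  ... | x , x∈ = x , x∈p∩q⁻ (B i) e x∈

  trace-edge : ∀ {i j} → E₃ K a b c → a ∈ B i → b ∈ B j → i ≢ j → E (K / P) (trace P (tri a b c))
  trace-edge abc a∈ b∈ i≢j = two≤∣p∣ (∈trace⁺ a∈ tri-∋₁) (∈trace⁺ b∈ tri-∋₂) i≢j , -, abc , refl

  cross⇒¬empty : E₃ K a b c → Cross K a b → ¬ IsEmpty (K / P)
  cross⇒¬empty abc cr@(a∈ , b∈ , _) empty with B-cover a∈ | B-cover b∈
  ... | i , a∈i | j , b∈j = empty _ (trace-edge abc a∈i b∈j (cross⁻-B cr a∈i b∈j))

  abstract
    ¬empty⇒cross : ¬ IsEmpty (K / P) → ∃[ a ] ∃[ b ] ∃[ c ] E₃ K a b c × Cross K a b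
    ¬empty⇒cross ¬empty = decidable-stable
      (any? λ a → any? λ b → any? λ c → E? K (tri a b c) ×-dec cross? K a b)
      λ ∄ → ¬empty λ 𝓔 → no-edge ∄
      where
      no-edge : ∀ {𝓔} → ¬ (∃[ a ] ∃[ b ] ∃[ c ] E₃ K a b c × Cross K a b) → ¬ E (K / P) 𝓔
      no-edge ∄ (2≤𝓔 , e , e∈ , refl) with two≤∣p∣⁻ 2≤𝓔
      ... | i , j , i∈ , j∈ , i≢j with ∈trace⁻ i∈ | ∈trace⁻ j∈
      ...   | x , x∈i , x∈e | y , y∈j , y∈e with pick e∈ x∈e y∈e (∈∧∉⇒≢ x∈i (B-≢ (≢-sym i≢j) y∈j))
      ...     | z , xyz , _ = ∄ (x , y , z , xyz , cross⁺-B i≢j x∈i y∈j)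

  module _ {𝓜 : Subset (length P)} (is𝓜 : IsModule (K / P) 𝓜) where
    private
      U? : Decidable (λ x → ∃[ i ] i ∈ 𝓜 × x ∈ B i)
      U? x = any? λ i → i ∈? 𝓜 ×-dec x ∈? B i

    union-of-module : Subset n
    union-of-module = ⟪ U? ⟫

    ∈union⁺ : ∀ {i} → i ∈ 𝓜 → x ∈ B i → x ∈ union-of-module
    ∈union⁺ i∈ x∈ = ∈⟪⟫⁺ U? (-, i∈ , x∈)

    ∈union⁻ : x ∈ union-of-module → ∃[ i ] i ∈ 𝓜 × x ∈ B i
    ∈union⁻ = ∈⟪⟫⁻ U?

    -- An edge of `K` leaving the union is projected to the quotient, replaced there, and lifted
    -- back.
    union-is-module : Module K union-of-module
    union-is-module = record
      { ⊆V      = λ x∈ → let i , _ , x∈i = ∈union⁻ x∈ in ⊆V (B-module i) x∈i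
      ; single  = λ abc a∈ c∉ → proj₁ (both abc a∈ c∉)
      ; replace = λ abc a∈ c∉ → proj₂ (both abc a∈ c∉)
      }
      where
      both : ∀ {a b c} → E₃ K a b c → a ∈ union-of-module → c ∉ union-of-module →
             b ∉ union-of-module × (∀ {y} → y ∈ union-of-module → E₃ K y b c)
      both {a} {b} {c} abc a∈ c∉
        with ∈union⁻ a∈ | B-cover (E₃⇒∈₂ {K = K} abc) | B-cover (E₃⇒∈₃ {K = K} abc)
      ... | i , i∈ , a∈i | j , b∈j | k , c∈k
        with IsModule.replace is𝓜 _ (trace-edge (E₃-swap₂₃ {K = K} abc) a∈i c∈k i≢k)
               (i , x∈p∩q⁺ (∈trace⁺ a∈i tri-∋₁ , i∈)) (k , x∈p∧x∉q⇒x∈p─q (∈trace⁺ c∈k tri-∋₂) k∉)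
        where
        k∉ : k ∉ 𝓜
        k∉ k∈ = c∉ (∈union⁺ k∈ c∈k)
        i≢k : i ≢ k
        i≢k = ∈∧∉⇒≢ i∈ k∉
      ... | m , m∈ , eq , rep = b∉ , λ y∈ → replaced (∈union⁻ y∈)
        where
        k∉ : k ∉ 𝓜
        k∉ k∈ = c∉ (∈union⁺ k∈ c∈k)
        ≡m : ∀ {l} → l ∈ trace P (tri a c b) → l ∈ 𝓜 → l ≡ m
        ≡m l∈ l∈𝓜 = x∈⁅y⁆⇒x≡y m (subst (_ ∈_) eq (x∈p∩q⁺ (l∈ , l∈𝓜)))
        i≡m : i ≡ m
        i≡m = ≡m (∈trace⁺ a∈i tri-∋₁) i∈
        b∉ : b ∉ union-of-module
        b∉ b∈ with ∈union⁻ b∈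
        ... | l , l∈ , b∈l with refl ← trans i≡m (sym (≡m (∈trace⁺ b∈l tri-∋₃) l∈)) =
          single (B-module l) abc a∈i (λ c∈l → c∉ (∈union⁺ l∈ c∈l)) b∈l
        j∉ : j ∉ 𝓜
        j∉ j∈ = b∉ (∈union⁺ j∈ b∈j)
        j≢k : j ≢ k
        j≢k refl = single (B-module j) (E₃-rot {K = K} abc) b∈j (B-≢ (∈∧∉⇒≢ i∈ j∉) a∈i) c∈k
        replaced : ∀ {y} → ∃[ l ] l ∈ 𝓜 × y ∈ B l → E₃ K y b c
        -- The replacement only yields some edge `e′` through the blocks `l`, `j` and `k`. Its
        -- vertices are moved to `y`, `b` and `c` one at a time, each within its block.
        replaced {y} (l , l∈ , y∈l) with rep l l∈
        ... | _ , e′ , e′∈ , eq′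
          with ∈trace⁻ {e = e′} (subst (l ∈_) eq′ (x∈p∪q⁺ (inj₂ (x∈⁅x⁆ l))))
             | ∈trace⁻ {e = e′} (subst (j ∈_) eq′ (x∈p∪q⁺ (inj₁ (x∈p∧x≢y⇒x∈p-y (∈trace⁺ b∈j tri-∋₃) (≢-sym (∈∧∉⇒≢ m∈ j∉))))))
             | ∈trace⁻ {e = e′} (subst (k ∈_) eq′ (x∈p∪q⁺ (inj₁ (x∈p∧x≢y⇒x∈p-y (∈trace⁺ c∈k tri-∋₂) (≢-sym (∈∧∉⇒≢ m∈ k∉))))))
        ... | y′ , y′∈ , y′∈e | b′ , b′∈ , b′∈e | c′ , c′∈ , c′∈e
          with pick e′∈ y′∈e b′∈e (∈∧∉⇒≢ y′∈ (B-≢ (≢-sym (∈∧∉⇒≢ l∈ j∉)) b′∈))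
        ... | z , y′b′z , refl with ∈tri⁻ c′∈e
        ... | inj₁ refl        = contradiction y′∈ (B-≢ (≢-sym (∈∧∉⇒≢ l∈ k∉)) c′∈)
        ... | inj₂ (inj₁ refl) = contradiction b′∈ (B-≢ (≢-sym j≢k) c′∈)
        ... | inj₂ (inj₂ refl) = E₃-swap {K = K} (E₃-rot {K = K} cby)
          where
          l≢k = ∈∧∉⇒≢ l∈ k∉
          yb′c′ : E₃ K y b′ c′
          yb′c′ = replace (B-module l) y′b′z y′∈ (B-≢ (≢-sym l≢k) c′∈) y∈l
          byc′ : E₃ K b y c′
          byc′ = replace (B-module j) (E₃-swap {K = K} yb′c′) b′∈ (B-≢ (≢-sym j≢k) c′∈) b∈j
          cby : E₃ K c b y
          cby = replace (B-module k) (E₃-rot {K = K} (E₃-rot {K = K} byc′)) c′∈ (B-≢ l≢k y∈l) c∈k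

  cross⇒connected : E₃ K a b c → Cross K a b → Connected K
  cross⇒connected abc (_ , _ , ¬tog) = crossing⇒connected abc λ M blk a∈ b∈ → ¬tog (M , blk , a∈ , b∈)

  -- A nontrivial module of the quotient would have as union a proper module of `K` meeting two
  -- blocks, but in a connected hypergraph nonempty proper modules lie inside blocks.
  cross⇒prime : E₃ K a b c → Cross K a b → IsPrime (K / P)
  cross⇒prime {a} {b} {c} abc cr = three , trivial
    where
    crbc = cross-edge r abc cr
    crca = cross-edge r (E₃-rot {K = K} abc) crbc
    three : ∣ ⊤ {length P} ∣ ≥ 3
    three with B-cover (E₃⇒∈₁ {K = K} abc) | B-cover (E₃⇒∈₂ {K = K} abc) | B-cover (E₃⇒∈₃ {K = K} abc)
    ... | i , a∈ | j , b∈ | k , c∈ = subst (_≤ ∣ ⊤ {length P} ∣)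
      (∣tri∣ (cross⁻-B cr a∈ b∈) (≢-sym (cross⁻-B crca c∈ a∈)) (cross⁻-B crbc b∈ c∈)) (p⊆q⇒∣p∣≤∣q∣ {p = tri i j k} {q = ⊤} ⊆⊤)
    trivial : ∀ 𝓜 → IsModule (K / P) 𝓜 → IsTrivial (K / P) 𝓜
    trivial 𝓜 is𝓜 with nonempty? 𝓜
    ... | no ∄ = inj₁ (Empty-unique ∄)
    ... | yes (i , i∈) with union-of-module is𝓜 ≟ˢ V K
    ...   | yes M≡V = inj₂ (inj₁ (⊆-antisym ⊆⊤ λ {j} _ → full j))
      where
      full : ∀ j → j ∈ 𝓜
      full j with B-nonempty j
      ... | x , x∈j with ∈union⁻ is𝓜 (subst (x ∈_) (sym M≡V) (⊆V (B-module j) x∈j))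
      ...   | l , l∈ , x∈l = subst (_∈ 𝓜) (B-disjoint x∈l x∈j) l∈
    ...   | no M≢V = inj₂ (inj₂ (i , ∈⊤ , ⊆-antisym (λ {j} j∈ → subst (j ∈_) (cong ⁅_⁆ (≡i j∈)) (x∈⁅x⁆ j))
                         λ j∈ → subst (_∈ 𝓜) (sym (x∈⁅y⁆⇒x≡y i j∈)) i∈))
      where
      ≡i : ∀ {j} → j ∈ 𝓜 → j ≡ i
      ≡i {j} j∈ with B-nonempty i | B-nonempty j
      ... | x , x∈i | y , y∈j
        with connected⇒module⊆block (cross⇒connected abc cr) (union-is-module is𝓜) (∈union⁺ is𝓜 i∈ x∈i) M≢V
      ...   | M , U⊆M , blk = together⇒≡ (M , blk , U⊆M (∈union⁺ is𝓜 j∈ y∈j) , U⊆M (∈union⁺ is𝓜 i∈ x∈i)) y∈j x∈i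

-- Without edges every pair of vertices is a module, and it is nontrivial as there are at least
-- three vertices. So no `X` enters both factors of the formula.
empty⇒¬prime : {H : Hypergraph n} → IsEmpty H → ¬ IsPrime H
empty⇒¬prime {H = H} empty (3≤ , trivial) with two≤∣p∣⁻ (≤-trans (s≤s (s≤s z≤n)) 3≤)
... | x , y , x∈ , y∈ , x≢y with trivial (⁅ x ⁆ ∪ ⁅ y ⁆) record
        { M⊆V     = λ z∈ → [ (λ z∈x → subst (_∈ V H) (sym (x∈⁅y⁆⇒x≡y x z∈x)) x∈)
                           , (λ z∈y → subst (_∈ V H) (sym (x∈⁅y⁆⇒x≡y y z∈y)) y∈) ]′ (x∈p∪q⁻ ⁅ x ⁆ _ z∈)
        ; replace = λ e e∈ → contradiction e∈ (empty e) }
...   | inj₁ eq = ∉⊥ (subst (x ∈_) eq (x∈p∪q⁺ (inj₁ (x∈⁅x⁆ x))))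
...   | inj₂ (inj₂ (v , _ , eq)) = x≢y (trans (≡v (x∈p∪q⁺ (inj₁ (x∈⁅x⁆ x)))) (sym (≡v (x∈p∪q⁺ (inj₂ (x∈⁅x⁆ y))))))
  where
  ≡v : ∀ {z} → z ∈ ⁅ x ⁆ ∪ ⁅ y ⁆ → z ≡ v
  ≡v z∈ = x∈⁅y⁆⇒x≡y v (subst (_ ∈_) eq z∈)
...   | inj₂ (inj₁ eq) with subst (3 ≤_) (trans (cong ∣_∣ (sym eq))
            (trans (x∉p⇒∣⁅x⁆∪p∣ (x≢y ∘ x∈⁅y⁆⇒x≡y y)) (cong ℕ.suc (∣⁅x⁆∣≡1 y)))) 3≤
...     | s≤s (s≤s ())

-- Linear orders

unique-length : {A : Set} {xs ys : List A} → Unique xs → Unique ys →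
                (∀ {x} → x ∈ˡ xs → x ∈ˡ ys) → (∀ {x} → x ∈ˡ ys → x ∈ˡ xs) → length xs ≡ length ys
unique-length uxs uys f g = ↭-length (∼bag⇒↭ (unique∧set⇒bag uxs uys (mk⇔ f g)))

map-unique : {A B : Set} {xs : List A} (f : A → B) → (∀ {x y} → x ∈ˡ xs → y ∈ˡ xs → f x ≡ f y → x ≡ y) →
             Unique xs → Unique (List.map f xs)
map-unique f inj []         = []
map-unique f inj (x∉ ∷ uxs) =
    All.tabulate (λ fy∈ fx≡ → let y , y∈ , eq = ∈-map⁻ f fy∈ in
      All.lookup x∉ y∈ (inj (here refl) (there y∈) (trans fx≡ eq)))
  ∷ map-unique f (λ x∈ y∈ → inj (there x∈) (there y∈)) uxs

length-cartesianProductWith : {A B C : Set} (f : A → B → C) (xs : List A) (ys : List B) →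
                              length (cartesianProductWith f xs ys) ≡ length xs * length ys
length-cartesianProductWith f []       ys = refl
length-cartesianProductWith f (x ∷ xs) ys = trans (List.length-++ (List.map (f x) ys))
  (cong₂ _+_ (List.length-map (f x) ys) (length-cartesianProductWith f xs ys))

-- A linear order on Fin k is coded by its vector of ranks.
insertLeast : Fin (suc k) → Vec ℕ k → Vec ℕ (suc k)
insertLeast s r = insertAt (Vec.map suc r) s 0

rankings : ∀ k → List (Vec ℕ k)
rankings zero    = [] ∷ []
rankings (suc k) = cartesianProductWith insertLeast (allFin (suc k)) (rankings k)

length-rankings : ∀ k → length (rankings k) ≡ k !
length-rankings zero    = refl
length-rankings (suc k) = trans (length-cartesianProductWith insertLeast (allFin (suc k)) (rankings k))
  (cong₂ _*_ (List.length-tabulate {n = suc k} id) (length-rankings k))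

lookup-least : ∀ (s : Fin (suc k)) r → lookup (insertLeast s r) s ≡ 0
lookup-least s r = insertAt-lookup (Vec.map suc r) s 0

lookup-punchIn : ∀ (s : Fin (suc k)) r i → lookup (insertLeast s r) (punchIn s i) ≡ suc (lookup r i)
lookup-punchIn s r i = trans (insertAt-punchIn (Vec.map suc r) s 0 i) (lookup-map i suc r)

data Position (s : Fin (suc k)) : Fin (suc k) → Set where
  least : Position s s
  other : ∀ i → Position s (punchIn s i)

position : ∀ (s i : Fin (suc k)) → Position s i
position s i with s ≟ᶠ i
... | yes refl = least
... | no s≢i   = subst (Position s) (punchIn-punchOut s≢i) (other (punchOut s≢i))

-- A rank vector is determined by the order that it codes; hence different vectors give different
-- patterns.
rankings-monotone-≡ : ∀ k {r r′} → r ∈ˡ rankings k → r′ ∈ˡ rankings k →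
                      (∀ i j → lookup r i < lookup r j → lookup r′ i < lookup r′ j) → r ≡ r′
rankings-monotone-≡ zero (here refl) (here refl) _ = refl
rankings-monotone-≡ (suc k) r∈ r′∈ mono
  with ∈-cartesianProductWith⁻ insertLeast (allFin (suc k)) (rankings k) r∈
     | ∈-cartesianProductWith⁻ insertLeast (allFin (suc k)) (rankings k) r′∈
... | s , q , _ , q∈ , refl | s′ , q′ , _ , q′∈ , refl with position s s′
...   | least = cong (insertLeast s) (rankings-monotone-≡ k q∈ q′∈ λ i j i<j → lower (subst₂ _<_
                  (lookup-punchIn s q′ i) (lookup-punchIn s q′ j) (mono (punchIn s i) (punchIn s j)
                    (subst₂ _<_ (sym (lookup-punchIn s q i)) (sym (lookup-punchIn s q j)) (s≤s i<j)))))
  where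
  lower : ∀ {m n} → suc m < suc n → m < n
  lower (s≤s m<n) = m<n
-- If the least positions differed, `s` would precede `s′` in the first order, and monotonicity
-- would put it below rank 0 in the second.
...   | other i = contradiction (subst (lookup (insertLeast s′ q′) s <_) (lookup-least s′ q′)
                    (mono s s′ (subst₂ _<_ (sym (lookup-least s q)) (sym (lookup-punchIn s q i)) (s≤s z≤n)))) λ ()

unique-rankings : ∀ k → Unique (rankings k)
unique-rankings zero    = [] ∷ []
unique-rankings (suc k) = cartesianProductWith⁺ insertLeast injective (allFin⁺ (suc k)) (unique-rankings k)
  where
  vec-injective : ∀ {k} {q q′ : Vec ℕ k} → (∀ i → lookup q i ≡ lookup q′ i) → q ≡ q′
  vec-injective {q = []}    {[]}     _  = refl
  vec-injective {q = _ ∷ _} {_ ∷ _} eq = cong₂ _∷_ (eq zero) (vec-injective (eq ∘ suc))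
  injective : ∀ {s s′ : Fin (suc k)} {q q′} → insertLeast s q ≡ insertLeast s′ q′ → s ≡ s′ × q ≡ q′
  injective {s} {s′} {q} {q′} eq with position s s′
  ... | least = refl , vec-injective λ i → suc-injective (trans (sym (lookup-punchIn s q i))
                  (trans (cong (λ r → lookup r (punchIn s i)) eq) (lookup-punchIn s q′ i)))
  ... | other i = contradiction (trans (sym (lookup-punchIn s q i))
                  (trans (cong (λ r → lookup r s′) eq) (lookup-least s′ q′))) λ ()

rankings-injective : ∀ k {r} → r ∈ˡ rankings k → ∀ i j → i ≢ j → lookup r i ≢ lookup r j
rankings-injective (suc k) r∈ i j i≢j eq with ∈-cartesianProductWith⁻ insertLeast (allFin (suc k)) (rankings k) r∈
... | s , q , _ , q∈ , refl with position s i | position s j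
...   | least    | least    = i≢j refl
...   | least    | other j′ = contradiction (trans (sym (lookup-least s q)) (trans eq (lookup-punchIn s q j′))) λ ()
...   | other i′ | least    = contradiction (trans (sym (lookup-punchIn s q i′)) (trans eq (lookup-least s q))) λ ()
...   | other i′ | other j′ = rankings-injective k q∈ i′ j′ (i≢j ∘ cong (punchIn s))
        (suc-injective (trans (sym (lookup-punchIn s q i′)) (trans eq (lookup-punchIn s q j′))))

record IsLinear (R : Rel k) : Set where
  field
    asym    : ∀ i j → R i j → ¬ R j i
    total   : ∀ i j → i ≢ j → R i j ⊎ R j i
    transit : ∀ i j l → R i j → R j l → R i l

linear-restrict : ∀ {m} {R : Rel k} (f : Fin m → Fin k) → (∀ i j → f i ≡ f j → i ≡ j) →
                  IsLinear R → IsLinear (λ i j → R (f i) (f j))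
linear-restrict f inj lin = record
  { asym    = λ i j → asym (f i) (f j)
  ; total   = λ i j i≢j → total (f i) (f j) (i≢j ∘ inj i j)
  ; transit = λ i j l → transit (f i) (f j) (f l)
  }
  where open IsLinear lin

linear-least : ∀ k {R : Rel (suc k)} → IsLinear R → ∃[ s ] (∀ j → s ≢ j → R s j)
linear-least zero    lin = zero , λ { zero ≢ → contradiction refl ≢ }
linear-least (suc k) lin with linear-least k (linear-restrict suc (λ { i j refl → refl }) lin)
... | s , least-s with IsLinear.total lin zero (suc s) (λ ())
...   | inj₂ s0 = suc s , λ where
  zero    _ → s0
  (suc j) ≢ → least-s j (≢ ∘ cong suc)
...   | inj₁ 0s = zero , least-0
  where
  least-0 : ∀ j → zero ≢ j → _
  least-0 zero ≢ = contradiction refl ≢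
  least-0 (suc j) _ with s ≟ᶠ j
  ... | yes refl = 0s
  ... | no s≢j   = IsLinear.transit lin zero (suc s) (suc j) 0s (least-s j s≢j)

linear-ranking : ∀ k {R : Rel k} → IsLinear R → ∃[ r ] r ∈ˡ rankings k × (∀ i j → R i j → lookup r i < lookup r j)
linear-ranking zero    lin = [] , here refl , λ ()
linear-ranking (suc k) {R} lin with linear-least k lin
... | s , least-s with linear-ranking k (linear-restrict (punchIn s) (punchIn-injective s) lin)
...   | q , q∈ , mono = insertLeast s q , ∈-cartesianProductWith⁺ insertLeast (∈-allFin s) q∈ , mono′
  where
  mono′ : ∀ i j → R i j → lookup (insertLeast s q) i < lookup (insertLeast s q) j
  mono′ i j ij with position s i | position s j
  ... | least    | least    = contradiction ij (IsLinear.asym lin s s ij)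
  ... | least    | other j′ = subst₂ _<_ (sym (lookup-least s q)) (sym (lookup-punchIn s q j′)) (s≤s z≤n)
  ... | other i′ | least    = contradiction ij (IsLinear.asym lin s _ (least-s _ (≢-sym (punchInᵢ≢i s i′))))
  ... | other i′ | other j′ = subst₂ _<_ (sym (lookup-punchIn s q i′)) (sym (lookup-punchIn s q j′)) (s≤s (mono i′ j′ ij))

-- Counting

product-split : {A : Set} {P Q : Pred A 0ℓ} (P? : Decidable P) (Q? : Decidable Q) {f g : A → ℕ} {xs : List A} →
  All (λ x → (P x × ¬ Q x × f x ≡ 2) ⊎ (¬ P x × Q x × f x ≡ g x)) xs →
  product (map f xs) ≡ 2 ^ length (filter P? xs) * product (map g (filter Q? xs))
product-split P? Q? [] = refl
product-split P? Q? {f} {g} {x ∷ xs} (inj₁ (Px , ¬Qx , fx≡2) ∷ rest) = begin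
  f x * product (map f xs)                                      ≡⟨ cong₂ _*_ fx≡2 (product-split P? Q? rest) ⟩
  2 * (2 ^ length (filter P? xs) * product (map g (filter Q? xs))) ≡⟨ *-assoc 2 (2 ^ length (filter P? xs)) (product (map g (filter Q? xs))) ⟨
  2 ^ length (x ∷ filter P? xs) * product (map g (filter Q? xs))
    ≡⟨ cong₂ (λ ps qs → 2 ^ length ps * product (map g qs)) (List.filter-accept P? Px) (List.filter-reject Q? ¬Qx) ⟨
  2 ^ length (filter P? (x ∷ xs)) * product (map g (filter Q? (x ∷ xs))) ∎
  where open ≡-Reasoning
product-split P? Q? {f} {g} {x ∷ xs} (inj₂ (¬Px , Qx , fx≡gx) ∷ rest) = begin
  f x * product (map f xs)                                      ≡⟨ cong₂ _*_ fx≡gx (product-split P? Q? rest) ⟩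
  g x * (2 ^ length (filter P? xs) * product (map g (filter Q? xs))) 
    ≡⟨ x∙yz≈y∙xz *-commutativeSemigroup (g x) (2 ^ length (filter P? xs)) (product (map g (filter Q? xs))) ⟩
  2 ^ length (filter P? xs) * product (map g (x ∷ filter Q? xs))
    ≡⟨ cong₂ (λ ps qs → 2 ^ length ps * product (map g qs)) (List.filter-reject P? ¬Px) (List.filter-accept Q? Qx) ⟨
  2 ^ length (filter P? (x ∷ xs)) * product (map g (filter Q? (x ∷ xs))) ∎
  where open ≡-Reasoning

module Count {n : ℕ} {H : Hypergraph n} (uni : IsUniform 3 H) {T₀ : Arcs n} (real₀ : IsRealization H T₀) where

  Big : Subset n → Set
  Big X = IsStrong H X × 2 ≤ ∣ X ∣

  CrossIn : Subset n → Rel n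
  CrossIn X = Cross (H [ X ])

  Off : List (Subset n) → Rel n
  Off xs u v = All (λ X → ¬ CrossIn X u v) xs

  Agrees : List (Subset n) → Arcs n → Set
  Agrees xs T = ∀ u v → Off xs u v → (T₀ ⊢ u ⟶ v → T ⊢ u ⟶ v) × (T ⊢ u ⟶ v → T₀ ⊢ u ⟶ v)

  agrees? : ∀ xs → Decidable (Agrees xs)
  agrees? xs T = all? λ u → all? λ v → All.all? (λ X → ¬? (cross? (H [ X ]) u v)) xs →-dec
    ((T₀ ⊢ u ⟶? v →-dec T ⊢ u ⟶? v) ×-dec (T ⊢ u ⟶? v →-dec T₀ ⊢ u ⟶? v))

  abstract
    -- For a single `X` these stand for the patterns on its cross pairs; for all of `𝓓≥2 H` they are
    -- all realizations.
    variants : List (Subset n) → List (Arcs n)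
    variants xs = filter (λ T → isRealization? H T ×-dec agrees? xs T) (arcSets n)

    ∈variants⁺ : ∀ {xs T} → IsRealization H T → Agrees xs T → T ∈ˡ variants xs
    ∈variants⁺ {xs} real agr = ∈-filter⁺ (λ T → isRealization? H T ×-dec agrees? xs T) (arcSets-complete _) (real , agr)

    ∈variants⁻ : ∀ {xs T} → T ∈ˡ variants xs → IsRealization H T × Agrees xs T
    ∈variants⁻ {xs} = proj₂ ∘ ∈-filter⁻ (λ T → isRealization? H T ×-dec agrees? xs T) {xs = arcSets n}

    variants-unique : ∀ xs → Unique (variants xs)
    variants-unique xs = filter⁺ (λ T → isRealization? H T ×-dec agrees? xs T) (arcSets-unique n)

  realizes : ∀ {T} → IsRealization H T → Realizes T H
  realizes = isRealization⇒realizes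

  arcs⊆V×V : ∀ {T} → IsRealization H T → ∀ u v → T ⊢ u ⟶ v → u ∈ V H × v ∈ V H
  arcs⊆V×V = IsTournament.arcs⊆V×V ∘ proj₁

  r₀ : Realizes T₀ H
  r₀ = realizes real₀

  strong⊆V : ∀ {X} → IsStrong H X → X ⊆ V H
  strong⊆V = IsModule.M⊆V ∘ proj₁

  r₀[_] : ∀ {X} → IsStrong H X → Realizes T₀ (H [ X ])
  r₀[ sX ] = realizes-restrict r₀ (strong⊆V sX)

  -- If `X` were properly contained in `Y`, it would lie in a block of `H [ Y ]`, and `u` and `v`
  -- would be together there.
  cross-nested : ∀ {X Y u v} → Big X → Big Y → CrossIn X u v → CrossIn Y u v → X ⊆ Y → X ≡ Y
  cross-nested {X} {Y} (sX , _) (sY , _) (u∈X , v∈X , _) (_ , _ , ¬tog) X⊆Y = decidable-stable (X ≟ˢ Y) λ X≢Y →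
    let M , X⊆M , blk = Realized.strong⊆block r₀[ sY ] (strong-sub⁻ r₀ sY sX X⊆Y) X≢Y
    in  ¬tog (M , blk , X⊆M u∈X , X⊆M v∈X)

  cross-unique : ∀ {X Y u v} → Big X → Big Y → CrossIn X u v → CrossIn Y u v → X ≡ Y
  cross-unique bX@(sX , _) bY@(sY , _) crX@(u∈X , _) crY@(u∈Y , _)
    with proj₂ sX _ (proj₁ sY) (-, x∈p∩q⁺ (u∈X , u∈Y))
  ... | inj₁ X⊆Y = cross-nested bX bY crX crY X⊆Y
  ... | inj₂ Y⊆X = sym (cross-nested bY bX crY crX Y⊆X)

  -- A minimal strong module containing `u` and `v` works: a block of it containing both would be a
  -- smaller strong module of `H`.
  cross-cover : ∀ {u v} → u ∈ V H → v ∈ V H → u ≢ v → ∃[ X ] Big X × CrossIn X u v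
  cross-cover {u} {v} u∈ v∈ u≢v
    with minimal (λ X → isStrong? H X ×-dec u ∈? X ×-dec v ∈? X) (Realized.V-strong r₀ , u∈ , v∈)
  ... | X , _ , (sX , u∈X , v∈X) , min = X , (sX , two≤∣p∣ u∈X v∈X u≢v) , u∈X , v∈X ,
        λ (M , ((sM , M≢X) , _) , u∈M , v∈M) → M≢X (⊆-antisym (IsModule.M⊆V (proj₁ sM))
          (min M (strong-sub⁺ r₀ sX sM , u∈M , v∈M) (IsModule.M⊆V (proj₁ sM))))

  length-variants-[] : length (variants []) ≡ 1
  length-variants-[] = unique-length (variants-unique []) ([] ∷ [])
    (λ {T} T∈ → let _ , agr = ∈variants⁻ T∈ in
      here (arcs-ext (λ u v → proj₂ (agr u v [])) (λ u v → proj₁ (agr u v []))))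
    λ { (here refl) → ∈variants⁺ real₀ (λ u v _ → id , id) }

  module _ {X : Subset n} (bX : Big X) where
    private
      sX  = proj₁ bX
      2≤X = proj₂ bX
      L   = H [ X ]

    exchange-real : ∀ {T S} → IsRealization H T → CrossRealizes S L → IsRealization H (exchange L T S)
    exchange-real realT crS = exchange-realization (realizes realT) sX 2≤X crS uni (arcs⊆V×V realT)

    real⇒cross : ∀ {T} → IsRealization H T → CrossRealizes T L
    real⇒cross realT = realizes⇒crossRealizes (realizes realT) sX 2≤X

    ∈variants[X]⁺ : ∀ {S} → CrossRealizes S L → exchange L T₀ S ∈ˡ variants (X ∷ [])
    ∈variants[X]⁺ {S} crS = ∈variants⁺ (exchange-real real₀ crS)
      λ { u v (¬cr ∷ []) → ¬cross⁺ {T = T₀} {S} ¬cr , ¬cross⁻ {T = T₀} {S} ¬cr }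

    -- The bijection is `f`, and `U` arises from `exchange L T₀ U` and `exchange L U T₀`. Nothing of
    -- `T` is lost under `f`: cross pairs of `X` are off all of `xs`, so there `T` coincides with
    -- `T₀`.
    length-variants-∷ : ∀ {xs} → X ∉ˡ xs → All Big xs →
                        length (variants (X ∷ xs)) ≡ length (variants (X ∷ [])) * length (variants xs)
    length-variants-∷ {xs} X∉ bigs = trans
      (sym (unique-length
        (map-unique f f-injective (cartesianProduct⁺ (variants-unique (X ∷ [])) (variants-unique xs)))
        (variants-unique (X ∷ xs)) f-into f-onto))
      (trans (List.length-map f pairs) (length-cartesianProductWith _,_ (variants (X ∷ [])) (variants xs)))
      where
      f : Arcs n × Arcs n → Arcs n
      f (S , T) = exchange L T S
      pairs : List (Arcs n × Arcs n)
      pairs = cartesianProduct (variants (X ∷ [])) (variants xs)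
      pairs⁻ : ∀ {S T} → (S , T) ∈ˡ pairs → S ∈ˡ variants (X ∷ []) × T ∈ˡ variants xs
      pairs⁻ = ∈-cartesianProduct⁻ (variants (X ∷ [])) (variants xs)
      cross⇒off : ∀ {u v} → CrossIn X u v → Off xs u v
      cross⇒off cr = All.tabulate λ {Y} Y∈ crY →
        X∉ (subst (_∈ˡ xs) (sym (cross-unique bX (All.lookup bigs Y∈) cr crY)) Y∈)
      f-injective : ∀ {p q} → p ∈ˡ pairs → q ∈ˡ pairs → f p ≡ f q → p ≡ q
      f-injective {S , T} {S′ , T′} p∈ q∈ eq with pairs⁻ p∈ | pairs⁻ q∈
      ... | S∈ , T∈ | S′∈ , T′∈ = cong₂ _,_
        (arcs-ext (S⊆S′ eq (proj₂ (∈variants⁻ S∈)) (proj₂ (∈variants⁻ S′∈)))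
                  (S⊆S′ (sym eq) (proj₂ (∈variants⁻ S′∈)) (proj₂ (∈variants⁻ S∈))))
        (arcs-ext (T⊆T′ eq (proj₂ (∈variants⁻ T∈)) (proj₂ (∈variants⁻ T′∈)))
                  (T⊆T′ (sym eq) (proj₂ (∈variants⁻ T′∈)) (proj₂ (∈variants⁻ T∈))))
        where
        S⊆S′ : ∀ {S S′ T T′} → f (S , T) ≡ f (S′ , T′) → Agrees (X ∷ []) S → Agrees (X ∷ []) S′ →
               ∀ u v → S ⊢ u ⟶ v → S′ ⊢ u ⟶ v
        S⊆S′ {S} {S′} {T} {T′} eq agr agr′ u v uv with cross? L u v
        ... | yes cr = cross⁻ {T = T′} {S′} cr (subst (_⊢ u ⟶ v) eq (cross⁺ {T = T} {S} cr uv))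
        ... | no ¬cr = proj₁ (agr′ u v (¬cr ∷ [])) (proj₂ (agr u v (¬cr ∷ [])) uv)
        T⊆T′ : ∀ {S S′ T T′} → f (S , T) ≡ f (S′ , T′) → Agrees xs T → Agrees xs T′ →
               ∀ u v → T ⊢ u ⟶ v → T′ ⊢ u ⟶ v
        T⊆T′ {S} {S′} {T} {T′} eq agr agr′ u v uv with cross? L u v
        ... | yes cr = proj₁ (agr′ u v (cross⇒off cr)) (proj₂ (agr u v (cross⇒off cr)) uv)
        ... | no ¬cr = ¬cross⁻ {T = T′} {S′} ¬cr (subst (_⊢ u ⟶ v) eq (¬cross⁺ {T = T} {S} ¬cr uv))
      f-into : ∀ {U} → U ∈ˡ map f pairs → U ∈ˡ variants (X ∷ xs)
      f-into U∈ with ∈-map⁻ f U∈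
      ... | (S , T) , p∈ , refl with pairs⁻ p∈
      ...   | S∈ , T∈ with ∈variants⁻ S∈ | ∈variants⁻ T∈
      ...     | realS , _ | realT , agrT = ∈variants⁺ (exchange-real realT (real⇒cross realS))
                λ { u v (¬cr ∷ off) → ¬cross⁺ {T = T} {S} ¬cr ∘ proj₁ (agrT u v off)
                                    , proj₂ (agrT u v off) ∘ ¬cross⁻ {T = T} {S} ¬cr }
      f-onto : ∀ {U} → U ∈ˡ variants (X ∷ xs) → U ∈ˡ map f pairs
      f-onto {U} U∈ with ∈variants⁻ U∈
      ... | realU , agrU = subst (_∈ˡ map f pairs) (arcs-ext U⊇ U⊆)
            (∈-map⁺ f (∈-cartesianProduct⁺ (∈variants[X]⁺ (real⇒cross realU))
              (∈variants⁺ (exchange-real realU (real⇒cross real₀)) agrT)))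
        where
        S₁ = exchange L T₀ U
        T₁ = exchange L U T₀
        agrT : Agrees xs T₁
        agrT u v off with cross? L u v
        ... | yes cr = cross⁺ {T = U} {T₀} cr , cross⁻ {T = U} {T₀} cr
        ... | no ¬cr = ¬cross⁺ {T = U} {T₀} ¬cr ∘ proj₁ (agrU u v (¬cr ∷ off))
                     , proj₂ (agrU u v (¬cr ∷ off)) ∘ ¬cross⁻ {T = U} {T₀} ¬cr
        U⊇ : ∀ u v → exchange L T₁ S₁ ⊢ u ⟶ v → U ⊢ u ⟶ v
        U⊇ u v uv with cross? L u v
        ... | yes cr = cross⁻ {T = T₀} {U} cr (cross⁻ {T = T₁} {S₁} cr uv)
        ... | no ¬cr = ¬cross⁻ {T = U} {T₀} ¬cr (¬cross⁻ {T = T₁} {S₁} ¬cr uv)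
        U⊆ : ∀ u v → U ⊢ u ⟶ v → exchange L T₁ S₁ ⊢ u ⟶ v
        U⊆ u v uv with cross? L u v
        ... | yes cr = cross⁺ {T = T₁} {S₁} cr (cross⁺ {T = T₀} {U} cr uv)
        ... | no ¬cr = ¬cross⁺ {T = T₁} {S₁} ¬cr (¬cross⁺ {T = U} {T₀} ¬cr uv)

    module _ {P : List (Subset n)} (blocks : IsBlocks L P) where
      private
        module Q = Quotient r₀[ sX ] 2≤X blocks

      -- The second variant is `T₀` with its arcs on the cross pairs of `X` reversed. It differs
      -- from `T₀` because there is more than one block.
      length-variants-connected : ¬ IsEmpty (L / P) → length (variants (X ∷ [])) ≡ 2
      length-variants-connected ¬empty = unique-length (variants-unique (X ∷ [])) ((T₀≢ ∷ []) ∷ [] ∷ []) to from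
        where
        T₁ = exchange L T₀ (rev T₀)
        T₁∈ : T₁ ∈ˡ variants (X ∷ [])
        T₁∈ = ∈variants[X]⁺ (realizes⇒crossRealizes (realizes-rev r₀) sX 2≤X)
        T₀≢ : T₀ ≢ T₁
        T₀≢ eq with Q.cross-exists
        ... | u , v , cr with CrossRealizes.total (real⇒cross real₀) cr
        ...   | inj₁ uv = Realizes.asym r₀ uv (rev⁻ {T = T₀} (cross⁻ {T = T₀} {rev T₀} cr (subst (_⊢ u ⟶ v) eq uv)))
        ...   | inj₂ vu = Realizes.asym r₀ vu (rev⁻ {T = T₀} (cross⁻ {T = T₀} {rev T₀} (cross-sym {K = L} cr) (subst (_⊢ v ⟶ u) eq vu)))
        from : ∀ {T} → T ∈ˡ T₀ ∷ T₁ ∷ [] → T ∈ˡ variants (X ∷ [])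
        from (here refl)         = ∈variants⁺ real₀ (λ _ _ _ → id , id)
        from (there (here refl)) = T₁∈
        to : ∀ {T} → T ∈ˡ variants (X ∷ []) → T ∈ˡ T₀ ∷ T₁ ∷ []
        to {T} T∈ with ∈variants⁻ T∈
        ... | realT , agr with Q.¬empty⇒cross ¬empty
        ...   | a , b , c , abc , cr
          with two-realizations r₀[ sX ] rT (Q.cross⇒connected abc cr) (proj₁ cr) (proj₁ (proj₂ cr)) (cross-irrefl r₀[ sX ] 2≤X cr)
          where rT = realizes-restrict (realizes realT) (strong⊆V sX)
        ...     | inj₁ same = here (arcs-ext T⊆ T⊇)
          where
          T⊆ : ∀ u v → T ⊢ u ⟶ v → T₀ ⊢ u ⟶ v
          T⊆ u v uv with cross? L u v
          ... | yes cr = agree-dir (realizes realT) r₀ (agree-flip {T₀} {T} (same cr)) uv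
            where
            agree-flip : ∀ {T T′ u v} → Agree T T′ u v → Agree T′ T u v
            agree-flip (inj₁ (p , q)) = inj₁ (q , p)
            agree-flip (inj₂ (p , q)) = inj₂ (q , p)
          ... | no ¬cr = proj₂ (agr u v (¬cr ∷ [])) uv
          T⊇ : ∀ u v → T₀ ⊢ u ⟶ v → T ⊢ u ⟶ v
          T⊇ u v uv with cross? L u v
          ... | yes cr = agree-dir r₀ (realizes realT) (same cr) uv
          ... | no ¬cr = proj₁ (agr u v (¬cr ∷ [])) uv
        ...     | inj₂ opposite = there (here (arcs-ext T⊆ T⊇))
          where
          T⊆ : ∀ u v → T ⊢ u ⟶ v → T₁ ⊢ u ⟶ v
          T⊆ u v uv with cross? L u v
          ... | no ¬cr = ¬cross⁺ {T = T₀} {rev T₀} ¬cr (proj₂ (agr u v (¬cr ∷ [])) uv)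
          ... | yes cr with opposite cr
          ...   | inj₁ (_  , uv′) = contradiction (rev⁻ {T = T} uv′) (Realizes.asym (realizes realT) uv)
          ...   | inj₂ (vu , _)   = cross⁺ {T = T₀} {rev T₀} cr (rev⁺ {T = T₀} vu)
          T⊇ : ∀ u v → T₁ ⊢ u ⟶ v → T ⊢ u ⟶ v
          T⊇ u v uv with cross? L u v
          ... | no ¬cr = proj₁ (agr u v (¬cr ∷ [])) (¬cross⁻ {T = T₀} {rev T₀} ¬cr uv)
          ... | yes cr with opposite cr
          ...   | inj₁ (uv₀ , _) = contradiction (rev⁻ {T = T₀} (cross⁻ {T = T₀} {rev T₀} cr uv)) (Realizes.asym r₀ uv₀)
          ...   | inj₂ (_ , vu)  = rev⁻ {T = T} vu

      module _ (empty : IsEmpty (L / P)) where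
        private
          m = length P

        Ord : Vec ℕ m → Rel n
        Ord q u v = ∃[ i ] ∃[ j ] u ∈ Q.B i × v ∈ Q.B j × lookup q i < lookup q j

        ord? : ∀ q u v → Dec (Ord q u v)
        ord? q u v = any? λ i → any? λ j → u ∈? Q.B i ×-dec v ∈? Q.B j ×-dec lookup q i <? lookup q j

        ord : Vec ℕ m → Arcs n
        ord q = arcs (ord? q)

        ord⁺ : ∀ q {u v i j} → u ∈ Q.B i → v ∈ Q.B j → lookup q i < lookup q j → ord q ⊢ u ⟶ v
        ord⁺ q u∈ v∈ i<j = arcs⁺ (ord? q) (-, -, u∈ , v∈ , i<j)

        ord⁻ : ∀ q {u v i j} → u ∈ Q.B i → v ∈ Q.B j → ord q ⊢ u ⟶ v → lookup q i < lookup q j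
        ord⁻ q u∈ v∈ uv with arcs⁻ (ord? q) uv
        ... | _ , _ , u∈′ , v∈′ , i<j = subst₂ (λ i j → lookup q i < lookup q j)
          (Q.B-disjoint u∈′ u∈) (Q.B-disjoint v∈′ v∈) i<j

        no-cross-edge : ∀ {a b c} → E₃ L a b c → ¬ Cross L a b
        no-cross-edge abc cr = Q.cross⇒¬empty abc cr empty

        -- Linearly ordered blocks give no 3-cycle across them, and since the quotient is empty no
        -- edge of `L` demands one.
        ord-crossRealizes : ∀ {q} → q ∈ˡ rankings m → CrossRealizes (ord q) L
        ord-crossRealizes {q} q∈ = record
          { asym     = λ cr uv vu → let i , j , u∈ , v∈ = index cr in <-asym (ord⁻ q u∈ v∈ uv) (ord⁻ q v∈ u∈ vu)
          ; total    = total
          ; from     = λ tog cr cr′ uz → let i , l , u∈ , z∈ = index cr ; j , _ , v∈ , _ = index cr′ in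
              ord⁺ q v∈ z∈ (subst (λ i → lookup q i < lookup q l) (Q.together⇒≡ tog u∈ v∈) (ord⁻ q u∈ z∈ uz))
          ; to       = λ tog cr cr′ zu → let i , l , u∈ , z∈ = index cr ; j , _ , v∈ , _ = index cr′ in
              ord⁺ q z∈ v∈ (subst (λ i → lookup q l < lookup q i) (Q.together⇒≡ tog u∈ v∈) (ord⁻ q z∈ u∈ zu))
          ; cyc⇒edge = λ crab crbc _ (ab , bc , ca) →
              let i , j , a∈ , b∈ = index crab ; _ , l , _ , c∈ = index crbc in
              contradiction (<-trans (ord⁻ q a∈ b∈ ab) (ord⁻ q b∈ c∈ bc)) (<-asym (ord⁻ q c∈ a∈ ca))
          ; edge⇒cyc = λ crab _ _ abc → contradiction crab (no-cross-edge abc)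
          }
          where
          index : ∀ {u v} → Cross L u v → ∃[ i ] ∃[ j ] u ∈ Q.B i × v ∈ Q.B j
          index (u∈ , v∈ , _) = let i , u∈i = Q.B-cover u∈ ; j , v∈j = Q.B-cover v∈ in i , j , u∈i , v∈j
          total : ∀ {u v} → Cross L u v → ord q ⊢ u ⟶ v ⊎ ord q ⊢ v ⟶ u
          total cr with index cr
          ... | i , j , u∈ , v∈ with <-cmp (lookup q i) (lookup q j)
          ...   | tri< i<j _ _ = inj₁ (ord⁺ q u∈ v∈ i<j)
          ...   | tri> _ _ j<i = inj₂ (ord⁺ q v∈ u∈ j<i)
          ...   | tri≈ _ eq _  = contradiction eq (rankings-injective m q∈ i j (Q.cross⁻-B cr u∈ v∈))

        rep : Q.Index → Fin n
        rep i = proj₁ (Q.B-nonempty i)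

        rep∈ : ∀ i → rep i ∈ Q.B i
        rep∈ i = proj₂ (Q.B-nonempty i)

        rep-cross : ∀ {i j} → i ≢ j → Cross L (rep i) (rep j)
        rep-cross {i} {j} i≢j = Q.cross⁺-B i≢j (rep∈ i) (rep∈ j)

        module _ {T : Arcs n} (realT : IsRealization H T) where
          private
            module T = CrossRealizes (real⇒cross realT)
            rT = realizes-restrict (realizes realT) (strong⊆V sX)

          rep-linear : IsLinear (λ i j → T ⊢ rep i ⟶ rep j)
          rep-linear = record
            { asym    = λ _ _ → Realizes.asym (realizes realT)
            ; total   = λ i j i≢j → T.total (rep-cross i≢j)
            ; transit = transit
            }
            where
            -- A failure of transitivity would be a 3-cycle of representatives, hence an edge across
            -- blocks, which an empty quotient excludes.
            transit : ∀ i j l → T ⊢ rep i ⟶ rep j → T ⊢ rep j ⟶ rep l → T ⊢ rep i ⟶ rep l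
            transit i j l ij jl with i ≟ᶠ l
            ... | yes refl = contradiction jl (Realizes.asym (realizes realT) ij)
            ... | no i≢l with T.total (rep-cross i≢l)
            ...   | inj₁ il = il
            ...   | inj₂ li = contradiction (rep-cross i≢j) (no-cross-edge (Realizes.cyc⇒edge rT
                      (∈V i) (∈V j) (∈V l) (ij , jl , li)))
              where
              ∈V : ∀ i → rep i ∈ X
              ∈V i = Module.⊆V (Q.B-module i) (rep∈ i)
              i≢j : i ≢ j
              i≢j refl = Realizes.irrefl (realizes realT) ij

          to-rep : ∀ {u v i j} → Cross L u v → u ∈ Q.B i → v ∈ Q.B j → T ⊢ u ⟶ v → T ⊢ rep i ⟶ rep j
          to-rep {i = i} {j} cr u∈ v∈ uv =
            T.to (Q.B j , Q.B-block j , v∈ , rep∈ j) (Q.cross⁺-B (≢-sym i≢j) v∈ (rep∈ i)) (rep-cross (≢-sym i≢j))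
              (T.from (Q.B i , Q.B-block i , u∈ , rep∈ i) cr (Q.cross⁺-B i≢j (rep∈ i) v∈) uv)
            where i≢j = Q.cross⁻-B cr u∈ v∈

          ranked : Agrees (X ∷ []) T → T ∈ˡ map (exchange L T₀ ∘ ord) (rankings m)
          ranked agr with linear-ranking m rep-linear
          ... | q , q∈ , mono = subst (_∈ˡ map (exchange L T₀ ∘ ord) (rankings m)) (arcs-ext T⊇ T⊆)
                (∈-map⁺ (exchange L T₀ ∘ ord) q∈)
            where
            T⊆ : ∀ u v → T ⊢ u ⟶ v → exchange L T₀ (ord q) ⊢ u ⟶ v
            T⊆ u v uv with cross? L u v
            ... | no ¬cr = ¬cross⁺ {T = T₀} {ord q} ¬cr (proj₂ (agr u v (¬cr ∷ [])) uv)
            ... | yes cr with Q.B-cover (proj₁ cr) | Q.B-cover (proj₁ (proj₂ cr))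
            ...   | i , u∈ | j , v∈ = cross⁺ {T = T₀} {ord q} cr (ord⁺ q u∈ v∈ (mono i j (to-rep cr u∈ v∈ uv)))
            T⊇ : ∀ u v → exchange L T₀ (ord q) ⊢ u ⟶ v → T ⊢ u ⟶ v
            T⊇ u v uv with cross? L u v
            ... | no ¬cr = proj₁ (agr u v (¬cr ∷ [])) (¬cross⁻ {T = T₀} {ord q} ¬cr uv)
            ... | yes cr with Q.B-cover (proj₁ cr) | Q.B-cover (proj₁ (proj₂ cr)) | T.total cr
            ...   | i , u∈ | j , v∈ | inj₁ uv′ = uv′
            ...   | i , u∈ | j , v∈ | inj₂ vu  = contradiction
                    (mono j i (to-rep (cross-sym {K = L} cr) v∈ u∈ vu))
                    (<-asym (ord⁻ q u∈ v∈ (cross⁻ {T = T₀} {ord q} cr uv)))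

        length-variants-empty : length (variants (X ∷ [])) ≡ m !
        length-variants-empty = trans
          (unique-length (variants-unique (X ∷ [])) (map-unique g g-injective (unique-rankings m))
            (λ T∈ → let realT , agr = ∈variants⁻ T∈ in ranked realT agr)
            (λ T∈ → into (∈-map⁻ g T∈)))
          (trans (List.length-map g (rankings m)) (length-rankings m))
          where
          g : Vec ℕ m → Arcs n
          g = exchange L T₀ ∘ ord
          into : ∀ {T} → ∃[ q ] q ∈ˡ rankings m × T ≡ g q → T ∈ˡ variants (X ∷ [])
          into (q , q∈ , refl) = ∈variants[X]⁺ (ord-crossRealizes q∈)
          g-injective : ∀ {q q′} → q ∈ˡ rankings m → q′ ∈ˡ rankings m → g q ≡ g q′ → q ≡ q′
          g-injective {q} {q′} q∈ q′∈ eq = rankings-monotone-≡ m q∈ q′∈ λ i j i<j →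
            let cr = rep-cross λ i≡j → <-irrefl (cong (lookup q) i≡j) i<j in
            ord⁻ q′ (rep∈ i) (rep∈ j) (cross⁻ {T = T₀} {ord q′} cr (subst (_⊢ rep i ⟶ rep j) eq
              (cross⁺ {T = T₀} {ord q} cr (ord⁺ q (rep∈ i) (rep∈ j) i<j))))

  length-variants : ∀ {xs} → Unique xs → All Big xs →
                    length (variants xs) ≡ product (map (λ X → length (variants (X ∷ []))) xs)
  length-variants {[]}     _                []         = length-variants-[]
  length-variants {X ∷ xs} uniq@(_ ∷ uniqs) (bX ∷ bigs) = trans
    (length-variants-∷ bX (Unique[x∷xs]⇒x∉xs uniq) bigs) (cong (length (variants (X ∷ [])) *_) (length-variants uniqs bigs))

  -- A nonempty quotient comes from an edge across blocks, which makes it prime; so deciding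
  -- emptiness decides primality, and each `X` contributes to exactly one factor.
  prime-or-empty : ∀ {X} → Big X → let Q = H [ X ] / Π (H [ X ]) in
    (IsPrime Q × ¬ IsEmpty Q × length (variants (X ∷ [])) ≡ 2) ⊎
    (¬ IsPrime Q × IsEmpty Q × length (variants (X ∷ [])) ≡ length (Π (H [ X ])) !)
  prime-or-empty {X} bX@(sX , 2≤) = decide (isEmpty? Q)
    where
    Q = H [ X ] / Π (H [ X ])
    decide : Dec (IsEmpty Q) →
      (IsPrime Q × ¬ IsEmpty Q × length (variants (X ∷ [])) ≡ 2) ⊎
      (¬ IsPrime Q × IsEmpty Q × length (variants (X ∷ [])) ≡ length (Π (H [ X ])) !)
    decide (yes empty) = inj₂ (empty⇒¬prime empty , empty , length-variants-empty bX (Π-blocks _) empty)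
    decide (no ¬empty) = inj₁
      ( (let _ , _ , _ , abc , cr = Quotient.¬empty⇒cross r₀[ sX ] 2≤ (Π-blocks _) ¬empty in
          Quotient.cross⇒prime r₀[ sX ] 2≤ (Π-blocks _) abc cr)
      , ¬empty , length-variants-connected bX (Π-blocks _) ¬empty)

  product-variants : ∀ {xs} → All Big xs →
    product (map (λ X → length (variants (X ∷ []))) xs) ≡
      2 ^ length (filter (λ X → isPrime? (H [ X ] / Π (H [ X ]))) xs) *
      product (map (λ X → length (Π (H [ X ])) !) (filter (λ X → isEmpty? (H [ X ] / Π (H [ X ]))) xs))
  product-variants = product-split (λ X → isPrime? (H [ X ] / Π (H [ X ]))) (λ X → isEmpty? (H [ X ] / Π (H [ X ])))
    {f = λ X → length (variants (X ∷ []))} {g = λ X → length (Π (H [ X ])) !} ∘ All.map prime-or-empty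

  𝓓≥2-big : All Big (𝓓≥2 H)
  𝓓≥2-big = All.tabulate λ X∈ →
    proj₂ (∈-filter⁻ (λ X → isStrong? H X ×-dec ∣ X ∣ ≥? 2) {xs = subsets n} X∈)

  𝓓≥2-unique : Unique (𝓓≥2 H)
  𝓓≥2-unique = filter⁺ (λ X → isStrong? H X ×-dec ∣ X ∣ ≥? 2) (subsets-unique n)

  off⇒¬arc : ∀ {T u v} → IsRealization H T → Off (𝓓≥2 H) u v → ¬ T ⊢ u ⟶ v
  off⇒¬arc realT off uv with arcs⊆V×V realT _ _ uv
  ... | u∈ , v∈ with cross-cover u∈ v∈ (Realizes.⟶⇒≢ (realizes realT) uv)
  ...   | X , bX , cr = All.lookup off
          (∈-filter⁺ (λ X → isStrong? H X ×-dec ∣ X ∣ ≥? 2) (subsets-complete X) bX) cr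

  -- Every pair of distinct vertices is a cross pair of some member of `𝓓≥2 H`. The remaining pairs
  -- carry no arc in any realization, so agreeing with `T₀` on them is no restriction.
  length-𝓡 : length (𝓡 H) ≡ length (variants (𝓓≥2 H))
  length-𝓡 = unique-length (filter⁺ (isRealization? H) (arcSets-unique n)) (variants-unique (𝓓≥2 H))
    (λ T∈ → let realT = proj₂ (∈-filter⁻ (isRealization? H) {xs = arcSets n} T∈) in
      ∈variants⁺ realT λ u v off →
        (λ uv → contradiction uv (off⇒¬arc real₀ off)) , (λ uv → contradiction uv (off⇒¬arc realT off)))
    (λ T∈ → ∈-filter⁺ (isRealization? H) (arcSets-complete _) (proj₁ (∈variants⁻ T∈)))

corollary57 : (n : ℕ) (H : Hypergraph n) → IsUniform 3 H → Realizable H →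
    length (𝓡 H) ≡ 2 ^ length (𝓓△ H) * product (map (λ X → length (Π (H [ X ])) !) (𝓓∘ H))
corollary57 n H uni (T₀ , real₀) = begin
  length (𝓡 H)                                              ≡⟨ length-𝓡 ⟩
  length (variants (𝓓≥2 H))                                 ≡⟨ length-variants 𝓓≥2-unique 𝓓≥2-big ⟩
  product (map (λ X → length (variants (X ∷ []))) (𝓓≥2 H))  ≡⟨ product-variants 𝓓≥2-big ⟩
  2 ^ length (𝓓△ H) * product (map (λ X → length (Π (H [ X ])) !) (𝓓∘ H)) ∎
  where
  open Count {n} {H} uni {T₀} real₀
  open ≡-Reasoning
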